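{- Let $q=p^s$ with $p>3$ prime and $s$ a positive integer, and let $\alpha\in\mathbb{F}_q$ with $\alpha\neq \pm 2$. Then the polynomial $$x^3+3\alpha x^2+(3\alpha^2-3)x+(\alpha^3-4\alpha)$$ is dynamically irreducible over $\mathbb{F}_q$ if and only if $-3(\alpha^2-4)$ is a nonzero square in $\mathbb{F}_{q}$ and the roots $\frac{1}{2}(\alpha\pm\sqrt{\alpha^2-4})$ of $x^2-\alpha x+1$ are not cubes in $\mathbb{F}_q(\sqrt{ -3})$.
   Context: $\mathbb{F}_q$ is the finite field with $q$ elements. A polynomial $f\in K[x]$ of degree at least $2$ over a field $K$ is dynamically irreducible over $K$ if the $n$-fold composition $f^n=f\circ\cdots\circ f$ is irreducible over $K$ for all positive integers $n$. -}

module Defs where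

open import Algebra.Apartness using (HeytingField; module HeytingCommutativeRing)
open import Algebra.Bundles using (CommutativeRing)
open import Algebra.Bundles.Raw using (RawRing; RawSemiring)
open import Algebra.Morphism.Structures using (module RingMorphisms)
import Algebra.Definitions.RawSemiring
open import Data.Fin.Base using (Fin)
open import Data.List.Base using (List; []; _∷_; map)
open import Data.Nat.Base using (ℕ; zero; suc; _≥_)
open import Data.Product.Base using (_×_; ∃-syntax)
open import Function.Bundles using (Inverse)
open import Level using (Level; _⊔_) renaming (suc to lsuc)
import Relation.Binary.PropositionalEquality as ≡

private
  variable
    c ℓ₁ ℓ₂ : Level

-- "Field" is the library's HeytingField.  Its laws make x # 0# equivalent to
-- x being invertible and force 0# # 1#, so the zero ring is excluded.  With
-- decidable equality, as for every finite field, this is the usual notion.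
module Field (K : HeytingField c ℓ₁ ℓ₂) where

  open HeytingField K public

  commutativeRing : CommutativeRing c ℓ₁
  commutativeRing = HeytingCommutativeRing.commutativeRing heytingCommutativeRing

  open CommutativeRing commutativeRing public using (rawRing; _≉_)

  -- n · x is the n-fold sum of x.
  open Algebra.Definitions.RawSemiring (RawRing.rawSemiring rawRing) public
    using (_^_) renaming (_×_ to infixr 8 _·_)

  IsNonzeroSquare : Carrier → Set (c ⊔ ℓ₁)
  IsNonzeroSquare x = x ≉ 0# × ∃[ y ] y ^ 2 ≈ x

HasCardinality : HeytingField c ℓ₁ ℓ₂ → ℕ → Set (c ⊔ ℓ₁)
HasCardinality K q = Inverse setoid (≡.setoid (Fin q))
  where open Field K

-- a₀ ∷ a₁ ∷ … ∷ aₙ ∷ [] is the polynomial a₀ + a₁ x + … + aₙ xⁿ.  The last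
-- coefficient may be zero, so polynomials are compared by _≋_.
module Polynomial (K : HeytingField c ℓ₁ ℓ₂) where

  open Field K using (Carrier; _≈_; _≉_; _+_; _*_; 0#; 1#)

  Poly : Set c
  Poly = List Carrier

  coeff : Poly → ℕ → Carrier
  coeff []      _       = 0#
  coeff (a ∷ f) zero    = a
  coeff (a ∷ f) (suc i) = coeff f i

  infix  4 _≋_
  infixl 6 _⊕_
  infixl 7 _⊛_
  infixr 9 _⊚_
  infixl 10 _^∘_

  _≋_ : Poly → Poly → Set ℓ₁
  f ≋ g = ∀ i → coeff f i ≈ coeff g i

  _⊕_ : Poly → Poly → Poly
  []      ⊕ g       = g
  (a ∷ f) ⊕ []      = a ∷ f
  (a ∷ f) ⊕ (b ∷ g) = (a + b) ∷ (f ⊕ g)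

  _⊛_ : Poly → Poly → Poly
  []      ⊛ g = []
  (a ∷ f) ⊛ g = map (a *_) g ⊕ (0# ∷ (f ⊛ g))

  -- f ⊚ g is the composition f(g(x)), by Horner's scheme.
  _⊚_ : Poly → Poly → Poly
  []      ⊚ g = []
  (a ∷ f) ⊚ g = (a ∷ []) ⊕ (g ⊛ (f ⊚ g))

  X : Poly
  X = 0# ∷ 1# ∷ []

  _^∘_ : Poly → ℕ → Poly
  f ^∘ zero  = X
  f ^∘ suc n = f ⊚ (f ^∘ n)

  polyRawSemiring : RawSemiring c ℓ₁
  polyRawSemiring = record
    { Carrier = Poly
    ; _≈_     = _≋_
    ; _+_     = _⊕_
    ; _*_     = _⊛_
    ; 0#      = []
    ; 1#      = 1# ∷ []
    }

  open Algebra.Definitions.RawSemiring polyRawSemiring public using (Irreducible)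

  DegreeAtLeast : ℕ → Poly → Set ℓ₁
  DegreeAtLeast d f = ∃[ i ] (i ≥ d × coeff f i ≉ 0#)

  DynamicallyIrreducible : Poly → Set (c ⊔ ℓ₁)
  DynamicallyIrreducible f =
    DegreeAtLeast 2 f × (∀ n → n ≥ 1 → Irreducible (f ^∘ n))

record FieldExtension (K : HeytingField c ℓ₁ ℓ₂) (c′ ℓ₁′ ℓ₂′ : Level)
       : Set (c ⊔ ℓ₁ ⊔ lsuc (c′ ⊔ ℓ₁′ ⊔ ℓ₂′)) where
  field
    field′ : HeytingField c′ ℓ₁′ ℓ₂′

  open Field field′ public

  open RingMorphisms (Field.rawRing K) rawRing using (IsRingHomomorphism)

  field
    ι                  : Field.Carrier K → Carrier
    isRingHomomorphism : IsRingHomomorphism ι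

  -- x ∈K⟨ ω ⟩ says that x lies in K(ω), the smallest subfield of the
  -- extension that contains K and ω.
  data _∈K⟨_⟩ : Carrier → Carrier → Set (c ⊔ c′ ⊔ ℓ₁′) where
    base : ∀ {ω} a → ι a ∈K⟨ ω ⟩
    gen  : ∀ {ω} → ω ∈K⟨ ω ⟩
    add  : ∀ {ω x y} → x ∈K⟨ ω ⟩ → y ∈K⟨ ω ⟩ → (x + y) ∈K⟨ ω ⟩
    neg  : ∀ {ω x} → x ∈K⟨ ω ⟩ → (- x) ∈K⟨ ω ⟩
    mul  : ∀ {ω x y} → x ∈K⟨ ω ⟩ → y ∈K⟨ ω ⟩ → (x * y) ∈K⟨ ω ⟩
    inv  : ∀ {ω x y} → x ∈K⟨ ω ⟩ → x * y ≈ 1# → y ∈K⟨ ω ⟩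
    resp : ∀ {ω x y} → x ≈ y → x ∈K⟨ ω ⟩ → y ∈K⟨ ω ⟩

  IsCubeInK⟨_⟩ : Carrier → Carrier → Set (c ⊔ c′ ⊔ ℓ₁′)
  IsCubeInK⟨ ω ⟩ x = ∃[ y ] (y ∈K⟨ ω ⟩ × y ^ 3 ≈ x)

{-# OPTIONS --safe #-}
-- With D(z) = z³ − 3z the polynomial is f(x) = D(x + α) − α, and D(y + 1/y) = y³ + 1/y³.
-- Hence the substitution x = y + 1/y − α turns the n-th iterate, homogenized, into
-- (y^m − u)(y^m − u′) with m = 3ⁿ, where u, u′ are the roots of x² − αx + 1.
--
-- If −3Δ is a square (Δ = α² − 4), then u and u′ lie in K = F(√−3).  If u is not a cube in K,
-- then y^m − u is irreducible over K: a factor g of y^(3m) − u has a norm N(g) from K[y] to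
-- K[y³], of the same degree and multiplicative in g, and N(y^(3m) − u) = (y^m − u)³.  So N(g)
-- is associated to a power of the prime y^m − u; exponents 0 and 3 make g or its cofactor
-- constant, and exponents 1 and 2 exhibit u as a cube.  A factor of degree d of the iterate
-- over F homogenizes to one of degree 2d, which cannot be m since m is odd.
--
-- Conversely, if −3Δ is not a square then D(z) = α has a solution in F, because D permutes
-- the finite set of z for which −3(z² − 4) is not a square.  If u = v³ with v in K, then
-- D(v + 1/v) = α, and this root in F(√−3) yields one in F.
module Submission where

open import Defs
open import Algebra.Apartness using (HeytingField)
open import Algebra.Bundles using (CommutativeRing)
import Algebra.Definitions.RawSemiring
open import Algebra.Morphism.Structures using (module RingMorphisms)
import Algebra.Properties.AbelianGroup
import Algebra.Properties.CommutativeMonoid.Sum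
import Algebra.Properties.Ring
import Algebra.Properties.Semiring.Exp
import Algebra.Properties.Semiring.Mult.TCOptimised
import Algebra.Solver.Ring
import Algebra.Solver.Ring.AlmostCommutativeRing as ACR
open import Data.Empty using (⊥; ⊥-elim)
open import Data.Fin.Base using (Fin; punchOut)
open import Data.Fin.Permutation using (Permutation; permutation)
import Data.Fin.Properties as Fin
open import Data.Integer.Base as ℤ using (ℤ; +_; -[1+_]; _⊖_)
import Data.Integer.Properties as ℤ
open import Data.List.Base using ([]; _∷_; map)
open import Data.Maybe.Base using (just; nothing)
open import Data.Nat.Base as ℕ using (ℕ; zero; suc; z≤n; s≤s; _>_; _≥_)
open import Data.Nat.Divisibility as ℕ using (divides; ∣1⇒≡1)
open import Data.Nat.DivMod using (_/_; _%_; m≡m%n+[m/n]*n; m%n<n)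
open import Data.Nat.Primality using (Prime; prime?; euclidsLemma; prime⇒irreducible)
import Data.Nat.Properties as ℕ
import Data.Nat.Solver
open import Data.Product.Base using (_×_; _,_; proj₁; proj₂; ∃-syntax)
import Data.Sign.Base as Sign
open import Data.Sum.Base as Sum using (_⊎_; inj₁; inj₂; [_,_]′)
open import Function.Base using (_∘_)
open import Function.Bundles using (_⇔_; mk⇔; module Inverse)
open import Function.Definitions using (Injective)
open import Level using (Level; _⊔_)
import Relation.Binary.Reasoning.Setoid
open import Relation.Binary.Definitions using (Decidable; WeaklyDecidable; tri<; tri≈; tri>)
open import Relation.Binary.PropositionalEquality as ≡ using (_≡_; _≢_)
open import Relation.Nullary.Decidable using (Dec; yes; no; map′; from-yes)
open import Relation.Nullary.Negation using (¬_)

-- The substitution is a semiconjugacy: it carries f to y ↦ y³, so that all iterates become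
-- questions about binomials. Being of degree 2 with a pole, it doubles degrees and forces
-- denominators to be cleared; the doubling in turn supplies the parity argument.
--
-- The norm is written as an explicit cubic form in the three residue parts of a polynomial. Thus no
-- root of u and no root of a binomial has to be adjoined to K.
--
-- E is an arbitrary extension whose equality need not be decidable, while degrees, division and
-- greatest common divisors require decisions. All factorizations are therefore made in K = F(√-3),
-- where every element is a + b√-3 and equality is decided by coordinates in the finite field F. The
-- cases √-3 in F and √-3 not in F are separated, because the coordinates are unique only in the
-- second.
--
-- The quantity -3Δ is, up to the square factor 9, the discriminant of D(z) - α. In the converse,
-- finiteness of F enters through the fact that an injective map from F to itself is onto.

-- A ring solver with integer coefficients for commutative rings

module IntegerCoefficients {c ℓ : Level} (R : CommutativeRing c ℓ) where

  open CommutativeRing R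
  open Algebra.Properties.Ring ring
  open Algebra.Properties.AbelianGroup +-abelianGroup using (⁻¹-∙-comm)
  open Algebra.Properties.Semiring.Mult.TCOptimised semiring renaming (_×_ to infixl 8 _·_)
  open Relation.Binary.Reasoning.Setoid setoid

  -- With this variant of the multiple, 0 and 1 are sent to `0#` and `1#` by computation, so
  -- `con (+ 0)` and `con (+ 1)` match these constants in solver calls. Larger numerals are written
  -- `3 :× con (+ 1)` there, which unfolds like `3 · 1#` of the statement.
  fromℤ : ℤ → Carrier
  fromℤ (+ n)    = n · 1#
  fromℤ -[1+ n ] = - (suc n · 1#)

  cancel-+ : ∀ x y z → (x + y) - (x + z) ≈ y - z
  cancel-+ x y z = begin
    (x + y) + - (x + z)     ≈⟨ +-cong (+-comm x y) (sym (⁻¹-∙-comm x z)) ⟩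
    (y + x) + (- x + - z)   ≈⟨ +-assoc y x _ ⟩
    y + (x + (- x + - z))   ≈⟨ +-congˡ (sym (+-assoc x _ _)) ⟩
    y + ((x + - x) + - z)   ≈⟨ +-congˡ (+-congʳ (-‿inverseʳ x)) ⟩
    y + (0# + - z)          ≈⟨ +-congˡ (+-identityˡ _) ⟩
    y - z                   ∎

  fromℤ-⊖ : ∀ m n → fromℤ (m ⊖ n) ≈ m · 1# - n · 1#
  fromℤ-⊖ zero zero = sym (-‿inverseʳ 0#)
  fromℤ-⊖ (suc m) zero = begin
    suc m · 1#          ≈⟨ sym (+-identityʳ _) ⟩
    suc m · 1# + 0#     ≈⟨ +-congˡ (sym -0#≈0#) ⟩
    suc m · 1# - 0#     ∎
  fromℤ-⊖ zero (suc n) = sym (+-identityˡ _)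
  fromℤ-⊖ (suc m) (suc n) = begin
    fromℤ (suc m ⊖ suc n)              ≡⟨ ≡.cong fromℤ (ℤ.[1+m]⊖[1+n]≡m⊖n m n) ⟩
    fromℤ (m ⊖ n)                      ≈⟨ fromℤ-⊖ m n ⟩
    m · 1# - n · 1#                    ≈⟨ sym (cancel-+ 1# _ _) ⟩
    (1# + m · 1#) - (1# + n · 1#)      ≈⟨ sym (+-cong (1+× m 1#) (-‿cong (1+× n 1#))) ⟩
    suc m · 1# - suc n · 1#            ∎

  fromℤ-+ : ∀ i j → fromℤ (i ℤ.+ j) ≈ fromℤ i + fromℤ j
  fromℤ-+ (+ m) (+ n) = ×-homo-+ 1# m n
  fromℤ-+ (+ m) -[1+ n ] = fromℤ-⊖ m (suc n)
  fromℤ-+ -[1+ m ] (+ n) = trans (fromℤ-⊖ n (suc m)) (+-comm _ _)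
  fromℤ-+ -[1+ m ] -[1+ n ] = begin
    - (suc (suc (m ℕ.+ n)) · 1#)         ≡⟨ ≡.cong (λ k → - (suc k · 1#)) (≡.sym (ℕ.+-suc m n)) ⟩
    - ((suc m ℕ.+ suc n) · 1#)           ≈⟨ -‿cong (×-homo-+ 1# (suc m) (suc n)) ⟩
    - (suc m · 1# + suc n · 1#)          ≈⟨ sym (⁻¹-∙-comm _ _) ⟩
    - (suc m · 1#) + - (suc n · 1#)      ∎

  fromℤ-neg : ∀ n → fromℤ (Sign.- ℤ.◃ n) ≈ - (n · 1#)
  fromℤ-neg zero    = sym -0#≈0#
  fromℤ-neg (suc n) = refl

  fromℤ-* : ∀ i j → fromℤ (i ℤ.* j) ≈ fromℤ i * fromℤ j
  fromℤ-* (+ m) (+ n) = begin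
    fromℤ (Sign.+ ℤ.◃ (m ℕ.* n))   ≡⟨ ≡.cong fromℤ (ℤ.+◃n≡+n (m ℕ.* n)) ⟩
    (m ℕ.* n) · 1#                 ≈⟨ ×1-homo-* m n ⟩
    m · 1# * (n · 1#)              ∎
  fromℤ-* (+ m) -[1+ n ] = begin
    fromℤ (Sign.- ℤ.◃ (m ℕ.* suc n))   ≈⟨ fromℤ-neg (m ℕ.* suc n) ⟩
    - ((m ℕ.* suc n) · 1#)             ≈⟨ -‿cong (×1-homo-* m (suc n)) ⟩
    - (m · 1# * (suc n · 1#))          ≈⟨ -‿distribʳ-* _ _ ⟩
    m · 1# * - (suc n · 1#)            ∎
  fromℤ-* -[1+ m ] (+ n) = begin
    fromℤ (Sign.- ℤ.◃ (suc m ℕ.* n))   ≈⟨ fromℤ-neg (suc m ℕ.* n) ⟩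
    - ((suc m ℕ.* n) · 1#)             ≈⟨ -‿cong (×1-homo-* (suc m) n) ⟩
    - (suc m · 1# * (n · 1#))          ≈⟨ -‿distribˡ-* _ _ ⟩
    - (suc m · 1#) * (n · 1#)          ∎
  fromℤ-* -[1+ m ] -[1+ n ] = begin
    (suc m ℕ.* suc n) · 1#                 ≈⟨ ×1-homo-* (suc m) (suc n) ⟩
    suc m · 1# * (suc n · 1#)              ≈⟨ sym (-‿involutive _) ⟩
    - (- (suc m · 1# * (suc n · 1#)))      ≈⟨ -‿cong (-‿distribˡ-* _ _) ⟩
    - (- (suc m · 1#) * (suc n · 1#))      ≈⟨ -‿distribʳ-* _ _ ⟩
    - (suc m · 1#) * - (suc n · 1#)        ∎

  fromℤ-‿- : ∀ i → fromℤ (ℤ.- i) ≈ - fromℤ i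
  fromℤ-‿- (+ zero)  = sym -0#≈0#
  fromℤ-‿- (+ suc n) = refl
  fromℤ-‿- -[1+ n ]  = sym (-‿involutive _)

  morphism : ACR._-Raw-AlmostCommutative⟶_ ℤ.+-*-rawRing (ACR.fromCommutativeRing R)
  morphism = record
    { ⟦_⟧    = fromℤ
    ; +-homo = fromℤ-+
    ; *-homo = fromℤ-*
    ; -‿homo = fromℤ-‿-
    ; 0-homo = refl
    ; 1-homo = refl
    }

  _≟_ : WeaklyDecidable (ACR.Induced-equivalence morphism)
  i ≟ j with i ℤ.≟ j
  ... | yes ≡.refl = just refl
  ... | no _       = nothing

  open Algebra.Solver.Ring ℤ.+-*-rawRing (ACR.fromCommutativeRing R) morphism _≟_ public
    using (solve; _:=_; _:+_; _:*_; _:-_; :-_; _:×_; _:^_; con)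

-- The commutative ring of polynomials as coefficient lists

module PolynomialRing {c ℓ₁ ℓ₂ : Level} (K : HeytingField c ℓ₁ ℓ₂) where

  open Field K
  open Polynomial K public
  private module S = IntegerCoefficients commutativeRing

  infixr 7 _⊙_
  infix 8 ⊖_

  _⊙_ : Carrier → Poly → Poly
  a ⊙ f = map (a *_) f

  ⊖_ : Poly → Poly
  ⊖ f = map (-_) f

  -- _≋_ unfolds to a function type, which hides its arguments from unification.
  infix 4 _≃_
  record _≃_ (f g : Poly) : Set ℓ₁ where
    constructor ext
    field at : f ≋ g
  open _≃_ public

  ≃-refl : ∀ {f} → f ≃ f
  ≃-refl = ext λ i → refl

  ≃-sym : ∀ {f g} → f ≃ g → g ≃ f
  ≃-sym (ext e) = ext λ i → sym (e i)

  ≃-trans : ∀ {f g h} → f ≃ g → g ≃ h → f ≃ h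
  ≃-trans (ext e) (ext e′) = ext λ i → trans (e i) (e′ i)

  ∷-cong : ∀ {a b f g} → a ≈ b → f ≃ g → a ∷ f ≃ b ∷ g
  ∷-cong p (ext e) = ext λ { zero → p ; (suc i) → e i }

  ∷-injective : ∀ {a b f g} → a ∷ f ≃ b ∷ g → a ≈ b × f ≃ g
  ∷-injective (ext e) = e 0 , ext λ i → e (suc i)

  0∷[] : 0# ∷ [] ≃ []
  0∷[] = ext λ { zero → refl ; (suc i) → refl }

  coeff-⊕ : ∀ f g i → coeff (f ⊕ g) i ≈ coeff f i + coeff g i
  coeff-⊕ []      g       i       = sym (+-identityˡ _)
  coeff-⊕ (a ∷ f) []      i       = sym (+-identityʳ _)
  coeff-⊕ (a ∷ f) (b ∷ g) zero    = refl
  coeff-⊕ (a ∷ f) (b ∷ g) (suc i) = coeff-⊕ f g i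

  coeff-⊙ : ∀ a f i → coeff (a ⊙ f) i ≈ a * coeff f i
  coeff-⊙ a []      i       = sym (zeroʳ a)
  coeff-⊙ a (b ∷ f) zero    = refl
  coeff-⊙ a (b ∷ f) (suc i) = coeff-⊙ a f i

  coeff-⊖ : ∀ f i → coeff (⊖ f) i ≈ - coeff f i
  coeff-⊖ []      i       = trans (sym (-‿inverseʳ 0#)) (+-identityˡ _)
  coeff-⊖ (a ∷ f) zero    = refl
  coeff-⊖ (a ∷ f) (suc i) = coeff-⊖ f i

  ⊕-cong : ∀ {f f′ g g′} → f ≃ f′ → g ≃ g′ → f ⊕ g ≃ f′ ⊕ g′
  ⊕-cong {f} {f′} {g} {g′} (ext e) (ext e′) = ext λ i →
    trans (coeff-⊕ f g i) (trans (+-cong (e i) (e′ i)) (sym (coeff-⊕ f′ g′ i)))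

  ⊕-assoc : ∀ f g h → (f ⊕ g) ⊕ h ≃ f ⊕ (g ⊕ h)
  ⊕-assoc f g h = ext λ i →
    trans (coeff-⊕ (f ⊕ g) h i) (trans (+-congʳ (coeff-⊕ f g i)) (trans (+-assoc _ _ _)
      (sym (trans (coeff-⊕ f (g ⊕ h) i) (+-congˡ (coeff-⊕ g h i))))))

  ⊕-comm : ∀ f g → f ⊕ g ≃ g ⊕ f
  ⊕-comm f g = ext λ i → trans (coeff-⊕ f g i) (trans (+-comm _ _) (sym (coeff-⊕ g f i)))

  ⊕-identityʳ : ∀ f → f ⊕ [] ≃ f
  ⊕-identityʳ f = ⊕-comm f []

  ⊕-interchange : ∀ f g h k → (f ⊕ g) ⊕ (h ⊕ k) ≃ (f ⊕ h) ⊕ (g ⊕ k)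
  ⊕-interchange f g h k = ext λ i →
    trans (coeff-⊕ (f ⊕ g) (h ⊕ k) i) (trans (+-cong (coeff-⊕ f g i) (coeff-⊕ h k i)) (trans
      (S.solve 4 (λ x y z w → (x S.:+ y) S.:+ (z S.:+ w) S.:= (x S.:+ z) S.:+ (y S.:+ w)) refl _ _ _ _)
      (sym (trans (coeff-⊕ (f ⊕ h) (g ⊕ k) i) (+-cong (coeff-⊕ f h i) (coeff-⊕ g k i))))))

  ⊖-cong : ∀ {f g} → f ≃ g → ⊖ f ≃ ⊖ g
  ⊖-cong {f} {g} (ext e) = ext λ i → trans (coeff-⊖ f i) (trans (-‿cong (e i)) (sym (coeff-⊖ g i)))

  ⊖-inverseʳ : ∀ f → f ⊕ ⊖ f ≃ []
  ⊖-inverseʳ f = ext λ i → trans (coeff-⊕ f (⊖ f) i) (trans (+-congˡ (coeff-⊖ f i)) (-‿inverseʳ _))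

  ⊖-inverseˡ : ∀ f → ⊖ f ⊕ f ≃ []
  ⊖-inverseˡ f = ≃-trans (⊕-comm (⊖ f) f) (⊖-inverseʳ f)

  ⊙-cong : ∀ {a b f g} → a ≈ b → f ≃ g → a ⊙ f ≃ b ⊙ g
  ⊙-cong {a} {b} {f} {g} p (ext e) = ext λ i →
    trans (coeff-⊙ a f i) (trans (*-cong p (e i)) (sym (coeff-⊙ b g i)))

  ⊙-zero : ∀ f → 0# ⊙ f ≃ []
  ⊙-zero f = ext λ i → trans (coeff-⊙ 0# f i) (zeroˡ _)

  ⊙-identity : ∀ f → 1# ⊙ f ≃ f
  ⊙-identity f = ext λ i → trans (coeff-⊙ 1# f i) (*-identityˡ _)

  ⊙-distrib-⊕ : ∀ a f g → a ⊙ (f ⊕ g) ≃ a ⊙ f ⊕ a ⊙ g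
  ⊙-distrib-⊕ a f g = ext λ i →
    trans (coeff-⊙ a (f ⊕ g) i) (trans (*-congˡ (coeff-⊕ f g i)) (trans (distribˡ _ _ _)
      (sym (trans (coeff-⊕ (a ⊙ f) (a ⊙ g) i) (+-cong (coeff-⊙ a f i) (coeff-⊙ a g i))))))

  ⊙-distrib-+ : ∀ a b f → (a + b) ⊙ f ≃ a ⊙ f ⊕ b ⊙ f
  ⊙-distrib-+ a b f = ext λ i →
    trans (coeff-⊙ (a + b) f i) (trans (distribʳ _ _ _)
      (sym (trans (coeff-⊕ (a ⊙ f) (b ⊙ f) i) (+-cong (coeff-⊙ a f i) (coeff-⊙ b f i)))))

  ⊙-⊙ : ∀ a b f → a ⊙ b ⊙ f ≃ (a * b) ⊙ f
  ⊙-⊙ a b f = ext λ i →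
    trans (coeff-⊙ a (b ⊙ f) i) (trans (*-congˡ (coeff-⊙ b f i))
      (trans (sym (*-assoc _ _ _)) (sym (coeff-⊙ (a * b) f i))))

  0∷-⊕ : ∀ f g → 0# ∷ (f ⊕ g) ≃ (0# ∷ f) ⊕ (0# ∷ g)
  0∷-⊕ f g = ∷-cong (sym (+-identityˡ 0#)) ≃-refl

  ∷-as-⊕ : ∀ a f → a ∷ f ≃ (a ∷ []) ⊕ (0# ∷ f)
  ∷-as-⊕ a f = ∷-cong (sym (+-identityʳ a)) ≃-refl

  ⊛-zeroʳ : ∀ f → f ⊛ [] ≃ []
  ⊛-zeroʳ []      = ≃-refl
  ⊛-zeroʳ (a ∷ f) = ≃-trans (∷-cong refl (⊛-zeroʳ f)) 0∷[]

  ⊛-congˡ : ∀ f {g h} → g ≃ h → f ⊛ g ≃ f ⊛ h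
  ⊛-congˡ []      e = ≃-refl
  ⊛-congˡ (a ∷ f) e = ⊕-cong (⊙-cong refl e) (∷-cong refl (⊛-congˡ f e))

  -- Mirror image of the recursion that defines `_⊛_`. Commutativity follows from it by induction,
  -- and then congruence and distributivity on one side yield those on the other.
  ⊛-∷ʳ : ∀ f b g → f ⊛ (b ∷ g) ≃ b ⊙ f ⊕ (0# ∷ f ⊛ g)
  ⊛-∷ʳ [] b g = ≃-sym 0∷[]
  ⊛-∷ʳ (a ∷ f) b g = ∷-cong (+-congʳ (*-comm a b))
    (≃-trans (⊕-cong ≃-refl (⊛-∷ʳ f b g))
    (≃-trans (≃-sym (⊕-assoc (a ⊙ g) (b ⊙ f) _))
    (≃-trans (⊕-cong (⊕-comm (a ⊙ g) (b ⊙ f)) ≃-refl)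
             (⊕-assoc (b ⊙ f) (a ⊙ g) _))))

  ⊛-comm : ∀ f g → f ⊛ g ≃ g ⊛ f
  ⊛-comm []      g = ≃-sym (⊛-zeroʳ g)
  ⊛-comm (a ∷ f) g = ≃-trans (⊕-cong ≃-refl (∷-cong refl (⊛-comm f g))) (≃-sym (⊛-∷ʳ g a f))

  ⊛-cong : ∀ {f f′ g g′} → f ≃ f′ → g ≃ g′ → f ⊛ g ≃ f′ ⊛ g′
  ⊛-cong {f} {f′} {g} {g′} e e′ =
    ≃-trans (⊛-congˡ f e′) (≃-trans (⊛-comm f g′) (≃-trans (⊛-congˡ g′ e) (⊛-comm g′ f′)))

  ⊛-distribʳ : ∀ h f g → (f ⊕ g) ⊛ h ≃ f ⊛ h ⊕ g ⊛ h
  ⊛-distribʳ h []      g       = ≃-refl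
  ⊛-distribʳ h (a ∷ f) []      = ≃-sym (⊕-identityʳ _)
  ⊛-distribʳ h (a ∷ f) (b ∷ g) =
    ≃-trans (⊕-cong (⊙-distrib-+ a b h)
                    (≃-trans (∷-cong refl (⊛-distribʳ h f g)) (0∷-⊕ (f ⊛ h) (g ⊛ h))))
            (⊕-interchange (a ⊙ h) (b ⊙ h) (0# ∷ f ⊛ h) (0# ∷ g ⊛ h))

  ⊛-distribˡ : ∀ h f g → h ⊛ (f ⊕ g) ≃ h ⊛ f ⊕ h ⊛ g
  ⊛-distribˡ h f g = ≃-trans (⊛-comm h (f ⊕ g))
    (≃-trans (⊛-distribʳ h f g) (⊕-cong (⊛-comm f h) (⊛-comm g h)))

  ⊙-⊛ : ∀ a f g → (a ⊙ f) ⊛ g ≃ a ⊙ (f ⊛ g)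
  ⊙-⊛ a []      g = ≃-refl
  ⊙-⊛ a (b ∷ f) g =
    ≃-trans (⊕-cong (≃-sym (⊙-⊙ a b g)) (∷-cong (sym (zeroʳ a)) (⊙-⊛ a f g)))
            (≃-sym (⊙-distrib-⊕ a (b ⊙ g) (0# ∷ f ⊛ g)))

  0∷-⊛ : ∀ f g → (0# ∷ f) ⊛ g ≃ 0# ∷ f ⊛ g
  0∷-⊛ f g = ⊕-cong (⊙-zero g) (≃-refl {0# ∷ f ⊛ g})

  ⊛-assoc : ∀ f g h → (f ⊛ g) ⊛ h ≃ f ⊛ (g ⊛ h)
  ⊛-assoc []      g h = ≃-refl
  ⊛-assoc (a ∷ f) g h =
    ≃-trans (⊛-distribʳ h (a ⊙ g) (0# ∷ f ⊛ g))
            (⊕-cong (⊙-⊛ a g h) (≃-trans (0∷-⊛ (f ⊛ g) h) (∷-cong refl (⊛-assoc f g h))))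

  const-⊛ : ∀ a f → (a ∷ []) ⊛ f ≃ a ⊙ f
  const-⊛ a f = ≃-trans (⊕-cong ≃-refl 0∷[]) (⊕-identityʳ _)

  ⊛-identityˡ : ∀ f → (1# ∷ []) ⊛ f ≃ f
  ⊛-identityˡ f = ≃-trans (const-⊛ 1# f) (⊙-identity f)

  polyRing : CommutativeRing c ℓ₁
  polyRing = record
    { Carrier = Poly
    ; _≈_ = _≃_
    ; _+_ = _⊕_
    ; _*_ = _⊛_
    ; -_  = ⊖_
    ; 0#  = []
    ; 1#  = 1# ∷ []
    ; isCommutativeRing = record
      { isRing = record
        { +-isAbelianGroup = record
          { isGroup = record
            { isMonoid = record
              { isSemigroup = record
                { isMagma = record
                  { isEquivalence = record
                    { refl = ≃-refl ; sym = ≃-sym ; trans = ≃-trans }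
                  ; ∙-cong = ⊕-cong }
                ; assoc = ⊕-assoc }
              ; identity = (λ f → ≃-refl) , ⊕-identityʳ }
            ; inverse = ⊖-inverseˡ , ⊖-inverseʳ
            ; ⁻¹-cong = ⊖-cong }
          ; comm = ⊕-comm }
        ; *-cong = ⊛-cong
        ; *-assoc = ⊛-assoc
        ; *-identity = ⊛-identityˡ , (λ f → ≃-trans (⊛-comm f _) (⊛-identityˡ f))
        ; distrib = ⊛-distribˡ , ⊛-distribʳ
        }
      ; *-comm = ⊛-comm
      }
    }

-- Degrees, division with remainder and primes over a field with decidable equality

-- A `HeytingField` inverts only what is apart from zero. Finding degrees and dividing need these
-- two classical properties, which are supplied once for F and once for F(√-3).
record IsDiscreteField {c ℓ₁ ℓ₂ : Level} (K : HeytingField c ℓ₁ ℓ₂) : Set (c ⊔ ℓ₁) where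
  open Field K
  field
    _≈?_    : Decidable _≈_
    inverse : ∀ {x} → x ≉ 0# → ∃[ y ] x * y ≈ 1#

module HeytingFieldProperties {c ℓ₁ ℓ₂ : Level} (K : HeytingField c ℓ₁ ℓ₂) where

  open Field K

  -- Were `1# ≈ 0#`, all elements would be equal, so the difference of `0#` with itself would be
  -- invertible and `0#` apart from itself.
  1≉0 : 1# ≉ 0#
  1≉0 1≈0 = proj₂ (tight 0# 0#) refl (invertible⇒# (1# , 0-0-inverse , 0-0-inverse))
    where
    0-0-inverse : ∀ {x} → x ≈ 1#
    0-0-inverse {x} = trans (sym (*-identityʳ x)) (trans (*-congˡ 1≈0) (trans (zeroʳ x) (sym 1≈0)))

  invertible⇒≉0 : ∀ {x y} → x * y ≈ 1# → x ≉ 0#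
  invertible⇒≉0 xy≈1 x≈0 = 1≉0 (trans (sym xy≈1) (trans (*-congʳ x≈0) (zeroˡ _)))

module DiscretePolynomials {c ℓ₁ ℓ₂ : Level} (K : HeytingField c ℓ₁ ℓ₂) (D : IsDiscreteField K) where

  open Field K
  open HeytingFieldProperties K public
  open IsDiscreteField D public
  open PolynomialRing K public
  private
    module P = CommutativeRing polyRing
    module S = IntegerCoefficients commutativeRing
    module PS = IntegerCoefficients polyRing

  *-cancel-0 : ∀ {x y} → x ≉ 0# → x * y ≈ 0# → y ≈ 0#
  *-cancel-0 {x} {y} x≉0 xy≈0 with inverse x≉0
  ... | z , xz≈1 = begin
    y              ≈⟨ *-identityˡ y ⟨
    1# * y         ≈⟨ *-congʳ xz≈1 ⟨
    x * z * y      ≈⟨ S.solve 3 (λ x y z → x S.:* z S.:* y S.:= z S.:* (x S.:* y)) refl x y z ⟩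
    z * (x * y)    ≈⟨ *-congˡ xy≈0 ⟩
    z * 0#         ≈⟨ zeroʳ z ⟩
    0#             ∎
    where open Relation.Binary.Reasoning.Setoid setoid

  *-≉0 : ∀ {x y} → x ≉ 0# → y ≉ 0# → x * y ≉ 0#
  *-≉0 x≉0 y≉0 xy≈0 = y≉0 (*-cancel-0 x≉0 xy≈0)

  -- Top n f a: f has degree at most n, and a (possibly zero) is its coefficient in degree n.
  record Top (n : ℕ) (f : Poly) (a : Carrier) : Set ℓ₁ where
    constructor mkTop
    field
      above : ∀ i → n ℕ.< i → coeff f i ≈ 0#
      top   : coeff f n ≈ a
  open Top public

  Top-resp : ∀ {n f g a b} → f ≃ g → a ≈ b → Top n f a → Top n g b
  Top-resp (ext e) p (mkTop u t) =
      mkTop (λ i n<i → trans (sym (e i)) (u i n<i)) (trans (sym (e _)) (trans t p))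

  Top-[] : ∀ {n} → Top n [] 0#
  Top-[] = mkTop (λ _ _ → refl) refl

  Top-const : ∀ a → Top 0 (a ∷ []) a
  Top-const a = mkTop (λ { (suc i) _ → refl }) refl

  Top-∷ : ∀ {n f a} b → Top n f a → Top (suc n) (b ∷ f) a
  Top-∷ b (mkTop u t) = mkTop (λ { (suc i) (s≤s n<i) → u i n<i }) t

  Top-tail : ∀ {n f a b} → Top (suc n) (b ∷ f) a → Top n f a
  Top-tail (mkTop u t) = mkTop (λ i n<i → u (suc i) (s≤s n<i)) t

  Top-raise : ∀ {m n f a} → m ℕ.< n → Top m f a → Top n f 0#
  Top-raise m<n (mkTop u t) = mkTop (λ i n<i → u i (ℕ.<-trans m<n n<i)) (u _ m<n)

  Top-⊕ : ∀ {n f g a b} → Top n f a → Top n g b → Top n (f ⊕ g) (a + b)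
  Top-⊕ {n} {f} {g} (mkTop u t) (mkTop v s) = mkTop
    (λ i n<i → trans (coeff-⊕ f g i) (trans (+-cong (u i n<i) (v i n<i)) (+-identityˡ 0#)))
    (trans (coeff-⊕ f g n) (+-cong t s))

  Top-⊙ : ∀ {n f a} b → Top n f a → Top n (b ⊙ f) (b * a)
  Top-⊙ {n} {f} b (mkTop u t) = mkTop
    (λ i n<i → trans (coeff-⊙ b f i) (trans (*-congˡ (u i n<i)) (zeroʳ b)))
    (trans (coeff-⊙ b f n) (*-congˡ t))

  Top-⊖ : ∀ {n f a} → Top n f a → Top n (⊖ f) (- a)
  Top-⊖ {n} {f} (mkTop u t) = mkTop
    (λ i n<i → trans (coeff-⊖ f i) (trans (-‿cong (u i n<i)) (S.solve 0 (S.:- S.con (+ 0)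
        S.:= S.con (+ 0)) refl)))
    (trans (coeff-⊖ f n) (-‿cong t))

  Top-⊛ : ∀ {m n a b} f g → Top m f a → Top n g b → Top (m ℕ.+ n) (f ⊛ g) (a * b)
  Top-⊛ [] g (mkTop u t) _ = Top-resp P.refl (trans (sym (zeroˡ _)) (*-congʳ t)) Top-[]
  Top-⊛ {zero} (c ∷ f) g (mkTop u t) v =
    Top-resp (P.trans (P.sym (const-⊛ c g)) (⊛-cong {c ∷ []} {c ∷ f} {g} {g} (∷-cong
        refl (ext λ i → sym (u (suc i) (s≤s z≤n)))) P.refl)) (*-congʳ t) (Top-⊙ c v)
  Top-⊛ {suc m} {n} (c ∷ f) g u v =
    Top-resp P.refl (+-identityˡ _)
      (Top-⊕ (Top-raise (s≤s (ℕ.m≤n+m n m)) (Top-⊙ c v)) (Top-∷ 0# (Top-⊛ f g (Top-tail u) v)))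

  -- Degree comparisons below take this form: two `Top` facts with nonzero coefficients are
  -- established for one polynomial.
  Top-unique : ∀ {m n f a b} → a ≉ 0# → b ≉ 0# → Top m f a → Top n f b → m ≡ n × a ≈ b
  Top-unique {m} {n} a≉0 b≉0 (mkTop u t) (mkTop v s) with ℕ.<-cmp m n
  ... | tri< m<n _ _     = ⊥-elim (b≉0 (trans (sym s) (u n m<n)))
  ... | tri≈ _ ≡.refl _  = ≡.refl , trans (sym t) s
  ... | tri> _ _ n<m     = ⊥-elim (a≉0 (trans (sym t) (v m n<m)))

  degree : ∀ f → f ≃ [] ⊎ (∃[ n ] ∃[ a ] (a ≉ 0# × Top n f a))
  degree [] = inj₁ P.refl
  degree (b ∷ f) with degree f
  ... | inj₂ (n , a , a≉0 , t) = inj₂ (suc n , a , a≉0 , Top-∷ b t)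
  ... | inj₁ f≃[] with b ≈? 0#
  ...   | yes b≈0 = inj₁ (P.trans (∷-cong b≈0 f≃[]) 0∷[])
  ...   | no b≉0  = inj₂ (0 , b , b≉0 , Top-resp (∷-cong refl (P.sym f≃[])) refl (Top-const b))

  Top⇒≄[] : ∀ {n f a} → a ≉ 0# → Top n f a → ¬ f ≃ []
  Top⇒≄[] a≉0 (mkTop _ t) (ext e) = a≉0 (trans (sym t) (e _))

  ⊛-cancel-[] : ∀ {f g} → ¬ f ≃ [] → f ⊛ g ≃ [] → g ≃ []
  ⊛-cancel-[] {f} {g} f≄[] fg≃[] with degree f | degree g
  ... | inj₁ f≃[] | _ = ⊥-elim (f≄[] f≃[])
  ... | _ | inj₁ g≃[] = g≃[]
  ... | inj₂ (m , a , a≉0 , t) | inj₂ (n , b , b≉0 , s) =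
    ⊥-elim (Top⇒≄[] (*-≉0 a≉0 b≉0) (Top-⊛ f g t s) fg≃[])

  ⊛-cancelˡ : ∀ {f g h} → ¬ f ≃ [] → f ⊛ g ≃ f ⊛ h → g ≃ h
  ⊛-cancelˡ {f} {g} {h} f≄[] e = begin
    g             ≈⟨ PS.solve 2 (λ g h → g PS.:= (g PS.:- h) PS.:+ h) P.refl g h ⟩
    (g ⊕ ⊖ h) ⊕ h ≈⟨ ⊕-cong (⊛-cancel-[] f≄[] (begin
      f ⊛ (g ⊕ ⊖ h)     ≈⟨ PS.solve 3 (λ f g h → f PS.:* (g PS.:- h)
          PS.:= f PS.:* g PS.:- f PS.:* h) P.refl f g h ⟩
      f ⊛ g ⊕ ⊖ (f ⊛ h) ≈⟨ P.+-congʳ e ⟩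
      f ⊛ h ⊕ ⊖ (f ⊛ h) ≈⟨ ⊖-inverseʳ (f ⊛ h) ⟩
      []                ∎)) P.refl ⟩
    h ∎
    where open Relation.Binary.Reasoning.Setoid P.setoid

  Unit : Poly → Set (c ⊔ ℓ₁)
  Unit f = ∃[ g ] g ⊛ f ≃ 1# ∷ []

  Unit-∣ : ∀ {f g} → Unit (f ⊛ g) → Unit f
  Unit-∣ {f} {g} (k , e) = k ⊛ g , P.trans (PS.solve 3 (λ f g k → k PS.:* g PS.:* f
      PS.:= k PS.:* (f PS.:* g)) P.refl f g k) e

  Unit-resp : ∀ {f g} → f ≃ g → Unit f → Unit g
  Unit-resp e (k , p) = k , P.trans (⊛-cong {k} P.refl (P.sym e)) p

  const-Unit : ∀ {f a} → a ≉ 0# → Top 0 f a → Unit f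
  const-Unit {f} {a} a≉0 t with inverse a≉0
  ... | b , ab≈1 = b ∷ [] , P.trans (const-⊛ b f) (ext λ
    { zero    → trans (coeff-⊙ b f 0) (trans (*-congˡ (top t)) (trans (*-comm b a) ab≈1))
    ; (suc i) → trans (coeff-⊙ b f (suc i)) (trans (*-congˡ (above t (suc i) (s≤s z≤n))) (zeroʳ b)) })

  Unit-const : ∀ {f} → Unit f → ∃[ a ] (a ≉ 0# × Top 0 f a)
  Unit-const {f} (g , e) with degree f | degree g
  ... | inj₁ f≃[] | _ = ⊥-elim (Top⇒≄[] 1≉0 (Top-const 1#) (P.trans (P.sym e) (P.trans (⊛-cong {g}
      P.refl f≃[]) (⊛-zeroʳ g))))
  ... | _ | inj₁ g≃[] = ⊥-elim (Top⇒≄[] 1≉0 (Top-const 1#) (P.trans (P.sym e) (⊛-cong {g′ =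
      f} g≃[] P.refl)))
  ... | inj₂ (m , a , a≉0 , t) | inj₂ (n , b , b≉0 , s) = a , a≉0 , ≡.subst (λ k → Top k f a) m≡0 t
    where
    m≡0 : m ≡ 0
    m≡0 = ℕ.m+n≡0⇒n≡0 n (proj₁ (Top-unique (*-≉0 b≉0 a≉0) 1≉0 (Top-⊛ g f s t) (Top-resp (P.sym e)
        refl (Top-const 1#))))

  Below : ℕ → Poly → Set ℓ₁
  Below n f = ∀ i → n ℕ.≤ i → coeff f i ≈ 0#

  -- Long division as a recursion on coefficients. If f = qB + r, then a + x f = (xq)B + (a + x r);
  -- here a + x r has degree at most n, and subtracting d B with a constant d removes its
  -- coefficient in degree n.
  divMod : ∀ {n b} B → b ≉ 0# → Top n B b → ∀ f → ∃[ q ] ∃[ r ] (f ≃ q ⊛ B ⊕ r × Below n r)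
  divMod B b≉0 t [] = [] , [] , P.refl , λ _ _ → refl
  divMod {n} {b} B b≉0 t (a ∷ f) with inverse b≉0 | divMod B b≉0 t f
  ... | b⁻¹ , bb⁻¹≈1 | q , r , f≃qB+r , r-below = d ∷ q , (a ∷ r) ⊕ ⊖ (d ⊙ B) , a∷f≃ , below
    where
    d : Carrier
    d = coeff (a ∷ r) n * b⁻¹
    a∷f≃ : a ∷ f ≃ (d ∷ q) ⊛ B ⊕ ((a ∷ r) ⊕ ⊖ (d ⊙ B))
    a∷f≃ = begin
      a ∷ f                                             ≈⟨ ∷-cong (sym (+-identityˡ a)) f≃qB+r ⟩
      (0# ∷ q ⊛ B) ⊕ (a ∷ r)
        ≈⟨ PS.solve 3 (λ x y z → y PS.:+ z
            PS.:= (x PS.:+ y) PS.:+ (z PS.:- x)) P.refl (d ⊙ B) (0# ∷ q ⊛ B) (a ∷ r) ⟩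
      (d ⊙ B ⊕ (0# ∷ q ⊛ B)) ⊕ ((a ∷ r) ⊕ ⊖ (d ⊙ B))    ∎
      where open Relation.Binary.Reasoning.Setoid P.setoid
    coeff-r′ : ∀ i → coeff ((a ∷ r) ⊕ ⊖ (d ⊙ B)) i ≈ coeff (a ∷ r) i - d * coeff B i
    coeff-r′ i = trans (coeff-⊕ (a ∷ r) (⊖ (d ⊙ B)) i) (+-congˡ (trans (coeff-⊖ (d ⊙ B) i) (-‿cong
        (coeff-⊙ d B i))))
    below : Below n ((a ∷ r) ⊕ ⊖ (d ⊙ B))
    below i n≤i with ℕ.m≤n⇒m<n∨m≡n n≤i
    below (suc i) _ | inj₁ (s≤s n≤i) = begin
      coeff ((a ∷ r) ⊕ ⊖ (d ⊙ B)) (suc i)  ≈⟨ coeff-r′ (suc i) ⟩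
      coeff r i - d * coeff B (suc i)
        ≈⟨ +-cong (r-below i n≤i) (-‿cong (*-congˡ (above t (suc i) (s≤s n≤i)))) ⟩
      0# - d * 0#                          ≈⟨ S.solve 1 (λ d → S.con (+ 0) S.:- d S.:* S.con (+ 0)
          S.:= S.con (+ 0)) refl d ⟩
      0#                                   ∎
      where open Relation.Binary.Reasoning.Setoid setoid
    below _ _ | inj₂ ≡.refl = begin
      coeff ((a ∷ r) ⊕ ⊖ (d ⊙ B)) n        ≈⟨ coeff-r′ n ⟩
      x - x * b⁻¹ * coeff B n              ≈⟨ +-congˡ (-‿cong (*-congˡ (top t))) ⟩
      x - x * b⁻¹ * b                      ≈⟨ S.solve 3 (λ x b b⁻¹ → x S.:- x S.:* b⁻¹ S.:* b
          S.:= x S.:- x S.:* (b S.:* b⁻¹)) refl x b b⁻¹ ⟩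
      x - x * (b * b⁻¹)                    ≈⟨ +-congˡ (-‿cong (*-congˡ bb⁻¹≈1)) ⟩
      x - x * 1#                           ≈⟨ S.solve 1 (λ x → x S.:- x S.:* S.con (+ 1)
          S.:= S.con (+ 0)) refl x ⟩
      0#                                   ∎
      where
      open Relation.Binary.Reasoning.Setoid setoid
      x : Carrier
      x = coeff (a ∷ r) n

  record Bézout (A B : Poly) : Set (c ⊔ ℓ₁) where
    field
      g s t k l : Poly
      combination : g ≃ s ⊛ A ⊕ t ⊛ B
      g∣A : A ≃ g ⊛ k
      g∣B : B ≃ g ⊛ l

  -- Euclid's algorithm. The bound n makes it terminate: B has degree m ≤ n when it is
  -- `Below (suc n)`, and the remainder of A by B is `Below m`.
  bézout : ∀ n A B → Below n B → Bézout A B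
  bézout n A B B-below with degree B
  ... | inj₁ B≃[] = record
    { g = A ; s = 1# ∷ [] ; t = [] ; k = 1# ∷ [] ; l = []
    ; combination = PS.solve 1 (λ A → A PS.:= PS.con (+ 1) PS.:* A PS.:+ PS.con (+ 0)) P.refl A
    ; g∣A = P.sym (P.*-identityʳ A)
    ; g∣B = P.trans B≃[] (P.sym (⊛-zeroʳ A)) }
  bézout zero A B B-below | inj₂ (m , b , b≉0 , t) = ⊥-elim (b≉0 (trans (sym (top t)) (B-below m z≤n)))
  bézout (suc n) A B B-below | inj₂ (m , b , b≉0 , t) with divMod B b≉0 t A
  ... | q , r , A≃qB+r , r-below = record
    { g = g ; s = t′ ; t = s ⊕ ⊖ (t′ ⊛ q) ; k = q ⊛ k ⊕ l ; l = k
    ; combination = begin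
        g                                      ≈⟨ combination ⟩
        s ⊛ B ⊕ t′ ⊛ r                         ≈⟨ PS.solve 5 (λ s B t q r → s PS.:* B PS.:+ t PS.:* r
            PS.:= t PS.:* (q PS.:* B PS.:+ r) PS.:+ (s PS.:- t PS.:* q) PS.:* B) P.refl s B t′ q r ⟩
        t′ ⊛ (q ⊛ B ⊕ r) ⊕ (s ⊕ ⊖ (t′ ⊛ q)) ⊛ B ≈⟨ P.+-congʳ (P.*-congˡ {t′} (P.sym A≃qB+r)) ⟩
        t′ ⊛ A ⊕ (s ⊕ ⊖ (t′ ⊛ q)) ⊛ B ∎
    ; g∣A = begin
        A                        ≈⟨ A≃qB+r ⟩
        q ⊛ B ⊕ r                ≈⟨ ⊕-cong (⊛-cong {q} P.refl g∣A) g∣B ⟩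
        q ⊛ (g ⊛ k) ⊕ g ⊛ l      ≈⟨ PS.solve 4 (λ q g k l → q PS.:* (g PS.:* k) PS.:+ g PS.:* l
            PS.:= g PS.:* (q PS.:* k PS.:+ l)) P.refl q g k l ⟩
        g ⊛ (q ⊛ k ⊕ l)          ∎
    ; g∣B = g∣A }
    where
    open Relation.Binary.Reasoning.Setoid P.setoid
    m≤n : m ℕ.≤ n
    m≤n with m ℕ.≤? n
    ... | yes p = p
    ... | no ¬p = ⊥-elim (b≉0 (trans (sym (top t)) (B-below m (ℕ.≰⇒> ¬p))))
    open Bézout (bézout n B r (λ i n≤i → r-below i (ℕ.≤-trans m≤n n≤i))) renaming (t to t′)

  infix 4 _∣ₚ_
  _∣ₚ_ : Poly → Poly → Set (c ⊔ ℓ₁)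
  A ∣ₚ f = ∃[ k ] f ≃ A ⊛ k

  Atom : Poly → Set (c ⊔ ℓ₁)
  Atom A = ∀ {f g} → A ≃ f ⊛ g → Unit f ⊎ Unit g

  below-length : ∀ f → ∃[ n ] Below n f
  below-length []      = 0 , λ _ _ → refl
  below-length (a ∷ f) with below-length f
  ... | n , u = suc n , λ { (suc i) (s≤s n≤i) → u i n≤i }

  -- Let d be the greatest common divisor of A and f, with A = d k. If d is a unit, multiplying d =
  -- sA + tf by g exhibits g as a multiple of A. If k is a unit, A is associated to d, which divides
  -- f.
  atom⇒prime : ∀ {A} → Atom A → ∀ f g → A ∣ₚ f ⊛ g → A ∣ₚ f ⊎ A ∣ₚ g
  atom⇒prime {A} atom f g (h , fg≃Ah) with below-length f
  ... | n , f-below with bézout n A f f-below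
  ...   | record { g = d ; s = s ; t = t ; k = k ; l = l ; combination = comb ; g∣A = d∣A ; g∣B =
      d∣f } with atom d∣A
  ...     | inj₁ (d⁻¹ , e) = inj₂ (d⁻¹ ⊛ (s ⊛ g ⊕ t ⊛ h) , (begin
      g                                    ≈⟨ P.*-identityˡ g ⟨
      (1# ∷ []) ⊛ g                        ≈⟨ P.*-congʳ {g} e ⟨
      d⁻¹ ⊛ d ⊛ g                          ≈⟨ P.*-congʳ {g} (P.*-congˡ {d⁻¹} comb) ⟩
      d⁻¹ ⊛ (s ⊛ A ⊕ t ⊛ f) ⊛ g
        ≈⟨ PS.solve 6 (λ e s A t f g → e PS.:* (s PS.:* A PS.:+ t PS.:* f) PS.:* g
            PS.:= e PS.:* (s PS.:* A PS.:* g PS.:+ t PS.:* (f PS.:* g))) P.refl d⁻¹ s A t f g ⟩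
      d⁻¹ ⊛ (s ⊛ A ⊛ g ⊕ t ⊛ (f ⊛ g))      ≈⟨ P.*-congˡ {d⁻¹} (P.+-congˡ (P.*-congˡ {t} fg≃Ah)) ⟩
      d⁻¹ ⊛ (s ⊛ A ⊛ g ⊕ t ⊛ (A ⊛ h))
        ≈⟨ PS.solve 6 (λ e s A t h g → e PS.:* (s PS.:* A PS.:* g PS.:+ t PS.:* (A PS.:* h))
            PS.:= A PS.:* (e PS.:* (s PS.:* g PS.:+ t PS.:* h))) P.refl d⁻¹ s A t h g ⟩
      A ⊛ (d⁻¹ ⊛ (s ⊛ g ⊕ t ⊛ h))          ∎))
    where open Relation.Binary.Reasoning.Setoid P.setoid
  ...     | inj₂ (k⁻¹ , e) = inj₁ (k⁻¹ ⊛ l , (begin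
      f                           ≈⟨ d∣f ⟩
      d ⊛ l                       ≈⟨ P.*-identityˡ (d ⊛ l) ⟨
      (1# ∷ []) ⊛ (d ⊛ l)         ≈⟨ P.*-congʳ {d ⊛ l} e ⟨
      k⁻¹ ⊛ k ⊛ (d ⊛ l)           ≈⟨ PS.solve 4 (λ i k d l → i PS.:* k PS.:* (d PS.:* l)
          PS.:= d PS.:* k PS.:* (i PS.:* l)) P.refl k⁻¹ k d l ⟩
      d ⊛ k ⊛ (k⁻¹ ⊛ l)           ≈⟨ P.*-congʳ {k⁻¹ ⊛ l} d∣A ⟨
      A ⊛ (k⁻¹ ⊛ l)               ∎))
    where open Relation.Binary.Reasoning.Setoid P.setoid

-- The norm form of a pure cubic extension of rings

module CubicNorm {c ℓ : Level} (R : CommutativeRing c ℓ) where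

  open CommutativeRing R
  open IntegerCoefficients R

  -- The norm of a + b y + c y² from R[y]/(y³ − x) to R.
  cubicNorm : Carrier → Carrier → Carrier → Carrier → Carrier
  cubicNorm x a b c = a * a * a + x * (b * b * b) + x * x * (c * c * c) - (x * (a * b * c) + x *
      (a * b * c) + x * (a * b * c))

  cubicNorm-cong : ∀ {x a b c a′ b′ c′} → a ≈ a′ → b ≈ b′ → c ≈ c′ → cubicNorm x a b c ≈ cubicNorm x a′ b′
      c′
  cubicNorm-cong p q r = +-cong
    (+-cong (+-cong (*-cong (*-cong p p) p) (*-congˡ (*-cong (*-cong q q) q))) (*-congˡ (*-cong
        (*-cong r r) r)))
    (-‿cong (+-cong (+-cong t t) t))
    where t = *-congˡ (*-cong (*-cong p q) r)

  -- The arguments on the left are the coordinates of the product of a + b y + c y² and a′ + b′ y +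
  -- c′ y² under y³ = x.
  cubicNorm-* : ∀ x a b c a′ b′ c′ →
    cubicNorm x (a * a′ + x * (b * c′ + c * b′)) (a * b′ + b * a′ + x * (c * c′))
        (a * c′ + b * b′ + c * a′)
      ≈ cubicNorm x a b c * cubicNorm x a′ b′ c′
  cubicNorm-* = solve 7 (λ x a b c a′ b′ c′ →
    let N = λ a b c → a :* a :* a :+ x :* (b :* b :* b) :+ x :* x :* (c :* c :* c) :- (x :* (a :* b :* c) :+ x :* (a :* b :* c) :+ x :* (a :* b :* c))
    in N (a :* a′ :+ x :* (b :* c′ :+ c :* b′)) (a :* b′ :+ b :* a′ :+ x :* (c :* c′))
        (a :* c′ :+ b :* b′ :+ c :* a′)
         := N a b c :* N a′ b′ c′) refl

  -- The classical factorization of a³ + b³ + c³ - 3abc. The linear factor is the conjugate for y =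
  -- 1; the quadratic one is the product of the conjugates for the two other cube roots of 1.
  cubicNorm-factor : ∀ a b c → cubicNorm 1# a b c ≈ (a + b + c) * (a * a + b * b + c * c -
      (a * b + b * c + c * a))
  cubicNorm-factor = solve 3 (λ a b c →
    let x = con (+ 1)
        N = λ a b c → a :* a :* a :+ x :* (b :* b :* b) :+ x :* x :* (c :* c :* c) :- (x :*
            (a :* b :* c) :+ x :* (a :* b :* c) :+ x :* (a :* b :* c))
    in N a b c := (a :+ b :+ c) :* (a :* a :+ b :* b :+ c :* c :- (a :* b :+ b :* c :+ c :* a))) refl

  -- A cube root of x³ is x times a cube root of 1, so b absorbs a factor x and c a factor x².
  cubicNorm-scale : ∀ x a b c → cubicNorm (x * x * x) a b c ≈ cubicNorm 1# a (x * b) (x * (x * c))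
  cubicNorm-scale = solve 4 (λ x a b c →
    let N = λ x a b c → a :* a :* a :+ x :* (b :* b :* b) :+ x :* x :* (c :* c :* c) :- (x :* (a :* b :* c) :+ x :* (a :* b :* c) :+ x :* (a :* b :* c))
    in N (x :* x :* x) a b c := N (con (+ 1)) a (x :* b) (x :* (x :* c))) refl

-- The norm from K[y] to K[y³], its degree and its constant term

module CubicBinomials {κ ℓ₁ ℓ₂ : Level} (K : HeytingField κ ℓ₁ ℓ₂) (D : IsDiscreteField K) where

  open Field K
  open DiscretePolynomials K D
  private
    module P = CommutativeRing polyRing
    module S = IntegerCoefficients commutativeRing
    module PS = IntegerCoefficients polyRing
  open CubicNorm polyRing
  private module CN = CubicNorm commutativeRing

  X-⊛ : ∀ f → X ⊛ f ≃ 0# ∷ f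
  X-⊛ f = P.trans (0∷-⊛ (1# ∷ []) f) (∷-cong refl (⊛-identityˡ f))

  ∷-as-X : ∀ a f → a ∷ f ≃ (a ∷ []) ⊕ X ⊛ f
  ∷-as-X a f = P.trans (∷-as-⊕ a f) (P.+-congˡ {a ∷ []} (P.sym (X-⊛ f)))

  -- This is f(x³), the embedding of K[x] as the subring K[x³]. Norms have their values in that
  -- subring but are written in x instead of x³.
  spread : Poly → Poly
  spread []      = []
  spread (a ∷ f) = a ∷ 0# ∷ 0# ∷ spread f

  0∷0∷ : ∀ {f} → f ≃ [] → 0# ∷ f ≃ []
  0∷0∷ e = P.trans (∷-cong refl e) 0∷[]

  spread-[] : ∀ f → f ≃ [] → spread f ≃ []
  spread-[] []      e = P.refl
  spread-[] (a ∷ f) (ext e) =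
      P.trans (∷-cong (e 0) (0∷0∷ (0∷0∷ (spread-[] f (ext λ i → e (suc i)))))) 0∷[]

  spread-cong : ∀ {f g} → f ≃ g → spread f ≃ spread g
  spread-cong {[]}    {g}     e = P.sym (spread-[] g (P.sym e))
  spread-cong {a ∷ f} {[]}    e = spread-[] (a ∷ f) e
  spread-cong {a ∷ f} {b ∷ g} e with ∷-injective e
  ... | a≈b , f≃g = ∷-cong a≈b (∷-cong refl (∷-cong refl (spread-cong f≃g)))

  spread-⊕ : ∀ f g → spread (f ⊕ g) ≃ spread f ⊕ spread g
  spread-⊕ []      g       = P.refl
  spread-⊕ (a ∷ f) []      = P.refl
  spread-⊕ (a ∷ f) (b ∷ g) = ∷-cong
      refl (∷-cong (sym (+-identityˡ 0#)) (∷-cong (sym (+-identityˡ 0#)) (spread-⊕ f g)))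

  spread-⊙ : ∀ a f → spread (a ⊙ f) ≃ a ⊙ spread f
  spread-⊙ a []      = P.refl
  spread-⊙ a (b ∷ f) = ∷-cong refl (∷-cong (sym (zeroʳ a)) (∷-cong (sym (zeroʳ a)) (spread-⊙ a f)))

  spread-⊖ : ∀ f → spread (⊖ f) ≃ ⊖ spread f
  spread-⊖ []      = P.refl
  spread-⊖ (b ∷ f) = ∷-cong refl (∷-cong 0≈-0 (∷-cong 0≈-0 (spread-⊖ f)))
    where
    0≈-0 : 0# ≈ - 0#
    0≈-0 = S.solve 0 (S.con (+ 0) S.:= S.:- S.con (+ 0)) refl

  spread-⊛ : ∀ f g → spread (f ⊛ g) ≃ spread f ⊛ spread g
  spread-⊛ []      g = P.refl
  spread-⊛ (a ∷ f) g = P.trans (spread-⊕ (a ⊙ g) (0# ∷ f ⊛ g))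
    (⊕-cong (spread-⊙ a g)
      (∷-cong refl (P.sym (P.trans (0∷-⊛ (0# ∷ spread f) (spread g))
        (∷-cong refl (P.trans (0∷-⊛ (spread f) (spread g)) (∷-cong refl (P.sym (spread-⊛ f g)))))))))

  -- f = f₀(x³) + x f₁(x³) + x² f₂(x³)
  part₀ part₁ part₂ : Poly → Poly
  part₀ []      = []
  part₀ (a ∷ f) = a ∷ part₂ f
  part₁ []      = []
  part₁ (a ∷ f) = part₀ f
  part₂ []      = []
  part₂ (a ∷ f) = part₁ f

  part₀-[] : ∀ f → f ≃ [] → part₀ f ≃ []
  part₁-[] : ∀ f → f ≃ [] → part₁ f ≃ []
  part₂-[] : ∀ f → f ≃ [] → part₂ f ≃ []
  part₀-[] []      e = P.refl
  part₀-[] (a ∷ f) (ext e) = P.trans (∷-cong (e 0) (part₂-[] f (ext λ i → e (suc i)))) 0∷[]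
  part₁-[] []      e = P.refl
  part₁-[] (a ∷ f) (ext e) = part₀-[] f (ext λ i → e (suc i))
  part₂-[] []      e = P.refl
  part₂-[] (a ∷ f) (ext e) = part₁-[] f (ext λ i → e (suc i))

  part₀-cong : ∀ {f g} → f ≃ g → part₀ f ≃ part₀ g
  part₁-cong : ∀ {f g} → f ≃ g → part₁ f ≃ part₁ g
  part₂-cong : ∀ {f g} → f ≃ g → part₂ f ≃ part₂ g
  part₀-cong {[]}    {g}     e = P.sym (part₀-[] g (P.sym e))
  part₀-cong {a ∷ f} {[]}    e = part₀-[] (a ∷ f) e
  part₀-cong {a ∷ f} {b ∷ g} e = ∷-cong (proj₁ (∷-injective e)) (part₂-cong (proj₂ (∷-injective e)))
  part₁-cong {[]}    {g}     e = P.sym (part₁-[] g (P.sym e))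
  part₁-cong {a ∷ f} {[]}    e = part₁-[] (a ∷ f) e
  part₁-cong {a ∷ f} {b ∷ g} e = part₀-cong (proj₂ (∷-injective e))
  part₂-cong {[]}    {g}     e = P.sym (part₂-[] g (P.sym e))
  part₂-cong {a ∷ f} {[]}    e = part₂-[] (a ∷ f) e
  part₂-cong {a ∷ f} {b ∷ g} e = part₁-cong (proj₂ (∷-injective e))

  part₀-⊕ : ∀ f g → part₀ (f ⊕ g) ≃ part₀ f ⊕ part₀ g
  part₁-⊕ : ∀ f g → part₁ (f ⊕ g) ≃ part₁ f ⊕ part₁ g
  part₂-⊕ : ∀ f g → part₂ (f ⊕ g) ≃ part₂ f ⊕ part₂ g
  part₀-⊕ []      g       = P.refl
  part₀-⊕ (a ∷ f) []      = P.refl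
  part₀-⊕ (a ∷ f) (b ∷ g) = ∷-cong refl (part₂-⊕ f g)
  part₁-⊕ []      g       = P.refl
  part₁-⊕ (a ∷ f) []      = P.sym (⊕-identityʳ (part₀ f))
  part₁-⊕ (a ∷ f) (b ∷ g) = part₀-⊕ f g
  part₂-⊕ []      g       = P.refl
  part₂-⊕ (a ∷ f) []      = P.sym (⊕-identityʳ (part₁ f))
  part₂-⊕ (a ∷ f) (b ∷ g) = part₁-⊕ f g

  part₀-⊙ : ∀ a f → part₀ (a ⊙ f) ≃ (a ∷ []) ⊛ part₀ f
  part₁-⊙ : ∀ a f → part₁ (a ⊙ f) ≃ (a ∷ []) ⊛ part₁ f
  part₂-⊙ : ∀ a f → part₂ (a ⊙ f) ≃ (a ∷ []) ⊛ part₂ f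
  part₀-⊙ a []      = P.sym 0∷[]
  part₀-⊙ a (b ∷ f) = ∷-cong (sym (+-identityʳ _)) (P.trans (part₂-⊙ a f) (⊕-cong {a ⊙ part₂ f}
      P.refl 0∷[]))
  part₁-⊙ a []      = P.sym 0∷[]
  part₁-⊙ a (b ∷ f) = part₀-⊙ a f
  part₂-⊙ a []      = P.sym 0∷[]
  part₂-⊙ a (b ∷ f) = part₁-⊙ a f

  -- Products of parts whose indices sum to 3 or more wrap around modulo 3 and gain a factor `X`,
  -- which stands for x³. The three formulas are proved together because prepending a coefficient
  -- rotates the parts.
  part₀-⊛ : ∀ f g → part₀ (f ⊛ g) ≃ part₀ f ⊛ part₀ g ⊕ X ⊛ (part₁ f ⊛ part₂ g ⊕ part₂ f ⊛ part₁ g)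
  part₁-⊛ : ∀ f g → part₁ (f ⊛ g) ≃ part₀ f ⊛ part₁ g ⊕ part₁ f ⊛ part₀ g ⊕ X ⊛ (part₂ f ⊛ part₂ g)
  part₂-⊛ : ∀ f g → part₂ (f ⊛ g) ≃ part₀ f ⊛ part₂ g ⊕ part₁ f ⊛ part₁ g ⊕ part₂ f ⊛ part₀ g
  part₀-⊛ [] g = P.sym (⊛-zeroʳ X)
  part₀-⊛ (a ∷ f) g = begin
    part₀ (a ⊙ g ⊕ (0# ∷ f ⊛ g))              ≈⟨ part₀-⊕ (a ⊙ g) (0# ∷ f ⊛ g) ⟩
    part₀ (a ⊙ g) ⊕ (0# ∷ part₂ (f ⊛ g))
      ≈⟨ ⊕-cong (part₀-⊙ a g) (P.trans (P.sym (X-⊛ (part₂ (f ⊛ g)))) (P.*-congˡ {X} (part₂-⊛ f g))) ⟩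
    A ⊛ g₀ ⊕ X ⊛ (f₀ ⊛ g₂ ⊕ f₁ ⊛ g₁ ⊕ f₂ ⊛ g₀)
      ≈⟨ PS.solve 8 (λ A X f₀ f₁ f₂ g₀ g₁ g₂ → A PS.:* g₀ PS.:+ X PS.:*
          (f₀ PS.:* g₂ PS.:+ f₁ PS.:* g₁ PS.:+ f₂ PS.:* g₀)
           PS.:= (A PS.:+ X PS.:* f₂) PS.:* g₀ PS.:+ X PS.:* (f₀ PS.:* g₂ PS.:+ f₁ PS.:* g₁))
               P.refl A X f₀ f₁ f₂ g₀ g₁ g₂ ⟩
    (A ⊕ X ⊛ f₂) ⊛ g₀ ⊕ X ⊛ (f₀ ⊛ g₂ ⊕ f₁ ⊛ g₁) ≈⟨ P.+-congʳ (P.*-congʳ {g₀} (∷-as-X a f₂)) ⟨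
    (a ∷ f₂) ⊛ g₀ ⊕ X ⊛ (f₀ ⊛ g₂ ⊕ f₁ ⊛ g₁)   ∎
    where
    open Relation.Binary.Reasoning.Setoid P.setoid
    A  = a ∷ []
    f₀ = part₀ f
    f₁ = part₁ f
    f₂ = part₂ f
    g₀ = part₀ g
    g₁ = part₁ g
    g₂ = part₂ g
  part₁-⊛ [] g = P.sym (⊛-zeroʳ X)
  part₁-⊛ (a ∷ f) g = begin
    part₁ (a ⊙ g ⊕ (0# ∷ f ⊛ g))              ≈⟨ part₁-⊕ (a ⊙ g) (0# ∷ f ⊛ g) ⟩
    part₁ (a ⊙ g) ⊕ part₀ (f ⊛ g)             ≈⟨ ⊕-cong (part₁-⊙ a g) (part₀-⊛ f g) ⟩
    A ⊛ g₁ ⊕ (f₀ ⊛ g₀ ⊕ X ⊛ (f₁ ⊛ g₂ ⊕ f₂ ⊛ g₁))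
      ≈⟨ PS.solve 8 (λ A X f₀ f₁ f₂ g₀ g₁ g₂ → A PS.:* g₁ PS.:+ (f₀ PS.:* g₀ PS.:+ X PS.:*
          (f₁ PS.:* g₂ PS.:+ f₂ PS.:* g₁))
           PS.:= (A PS.:+ X PS.:* f₂) PS.:* g₁ PS.:+ f₀ PS.:* g₀ PS.:+ X PS.:* (f₁ PS.:* g₂))
               P.refl A X f₀ f₁ f₂ g₀ g₁ g₂ ⟩
    (A ⊕ X ⊛ f₂) ⊛ g₁ ⊕ f₀ ⊛ g₀ ⊕ X ⊛ (f₁ ⊛ g₂) ≈⟨ P.+-congʳ (P.+-congʳ (P.*-congʳ {g₁} (∷-as-X a f₂))) ⟨
    (a ∷ f₂) ⊛ g₁ ⊕ f₀ ⊛ g₀ ⊕ X ⊛ (f₁ ⊛ g₂)   ∎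
    where
    open Relation.Binary.Reasoning.Setoid P.setoid
    A  = a ∷ []
    f₀ = part₀ f
    f₁ = part₁ f
    f₂ = part₂ f
    g₀ = part₀ g
    g₁ = part₁ g
    g₂ = part₂ g
  part₂-⊛ [] g = P.refl
  part₂-⊛ (a ∷ f) g = begin
    part₂ (a ⊙ g ⊕ (0# ∷ f ⊛ g))              ≈⟨ part₂-⊕ (a ⊙ g) (0# ∷ f ⊛ g) ⟩
    part₂ (a ⊙ g) ⊕ part₁ (f ⊛ g)             ≈⟨ ⊕-cong (part₂-⊙ a g) (part₁-⊛ f g) ⟩
    A ⊛ g₂ ⊕ (f₀ ⊛ g₁ ⊕ f₁ ⊛ g₀ ⊕ X ⊛ (f₂ ⊛ g₂))
      ≈⟨ PS.solve 8 (λ A X f₀ f₁ f₂ g₀ g₁ g₂ → A PS.:* g₂ PS.:+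
          (f₀ PS.:* g₁ PS.:+ f₁ PS.:* g₀ PS.:+ X PS.:* (f₂ PS.:* g₂))
           PS.:= (A PS.:+ X PS.:* f₂) PS.:* g₂ PS.:+ f₀ PS.:* g₁ PS.:+ f₁ PS.:* g₀)
               P.refl A X f₀ f₁ f₂ g₀ g₁ g₂ ⟩
    (A ⊕ X ⊛ f₂) ⊛ g₂ ⊕ f₀ ⊛ g₁ ⊕ f₁ ⊛ g₀     ≈⟨ P.+-congʳ (P.+-congʳ (P.*-congʳ {g₂} (∷-as-X a f₂))) ⟨
    (a ∷ f₂) ⊛ g₂ ⊕ f₀ ⊛ g₁ ⊕ f₁ ⊛ g₀         ∎
    where
    open Relation.Binary.Reasoning.Setoid P.setoid
    A  = a ∷ []
    f₀ = part₀ f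
    f₁ = part₁ f
    f₂ = part₂ f
    g₀ = part₀ g
    g₁ = part₁ g
    g₂ = part₂ g

  part₀-spread : ∀ f → part₀ (spread f) ≡ f
  part₀-spread []      = ≡.refl
  part₀-spread (a ∷ f) = ≡.cong (a ∷_) (part₀-spread f)

  part₁-spread : ∀ f → part₁ (spread f) ≃ []
  part₂-spread : ∀ f → part₂ (spread f) ≃ []
  part₁-spread []      = P.refl
  part₁-spread (a ∷ f) = 0∷0∷ (part₁-spread f)
  part₂-spread []      = P.refl
  part₂-spread (a ∷ f) = 0∷0∷ (part₂-spread f)

  -- The determinant of multiplication by f on K[y], viewed as a free module with basis 1, y, y²
  -- over K[y³].
  norm : Poly → Poly
  norm f = cubicNorm X (part₀ f) (part₁ f) (part₂ f)

  norm-cong : ∀ {f g} → f ≃ g → norm f ≃ norm g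
  norm-cong e = cubicNorm-cong {X} (part₀-cong e) (part₁-cong e) (part₂-cong e)

  norm-⊛ : ∀ f g → norm (f ⊛ g) ≃ norm f ⊛ norm g
  norm-⊛ f g = P.trans (cubicNorm-cong {X} (part₀-⊛ f g) (part₁-⊛ f g) (part₂-⊛ f g))
    (cubicNorm-* X (part₀ f) (part₁ f) (part₂ f) (part₀ g) (part₁ g) (part₂ g))

  norm-spread : ∀ f → norm (spread f) ≃ f ⊛ f ⊛ f
  norm-spread f = P.trans
    (cubicNorm-cong {X} (P.reflexive (part₀-spread f)) (part₁-spread f) (part₂-spread f))
    (PS.solve 2 (λ X f → let z = PS.con (+ 0) in f PS.:* f PS.:* f PS.:+ X PS.:*
        (z PS.:* z PS.:* z) PS.:+ X PS.:* X PS.:* (z PS.:* z PS.:* z)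
       PS.:- (X PS.:* (f PS.:* z PS.:* z) PS.:+ X PS.:* (f PS.:* z PS.:* z) PS.:+ X PS.:*
           (f PS.:* z PS.:* z)) PS.:= f PS.:* f PS.:* f) P.refl X f)

  reassemble : ∀ f → f ≃ spread (part₀ f) ⊕ (0# ∷ spread (part₁ f)) ⊕ (0# ∷ 0# ∷ spread (part₂ f))
  reassemble []      = P.sym (P.trans (∷-cong (+-identityˡ 0#) (0∷0∷ P.refl)) 0∷[])
  reassemble (a ∷ f) = ∷-cong (S.solve 1 (λ a → a S.:= a S.:+ S.con (+ 0) S.:+ S.con (+ 0)) refl a)
    (P.trans (reassemble f) (PS.solve 3 (λ A B C → A PS.:+ B PS.:+ C PS.:= C PS.:+ A PS.:+ B) P.refl
      (spread (part₀ f)) (0# ∷ spread (part₁ f)) (0# ∷ 0# ∷ spread (part₂ f))))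

  X³ : Poly
  X³ = X ⊛ X ⊛ X

  spread-X : spread X ≃ X³
  spread-X = P.sym (begin
    X ⊛ X ⊛ X              ≈⟨ P.*-assoc X X X ⟩
    X ⊛ (X ⊛ X)            ≈⟨ X-⊛ (X ⊛ X) ⟩
    0# ∷ X ⊛ X             ≈⟨ ∷-cong refl (X-⊛ X) ⟩
    0# ∷ 0# ∷ 0# ∷ 1# ∷ [] ≈⟨ ∷-cong refl (∷-cong refl (∷-cong refl (∷-cong refl (P.sym (0∷0∷ 0∷[]))))) ⟩
    spread X               ∎)
    where open Relation.Binary.Reasoning.Setoid P.setoid

  spread-cubicNorm : ∀ x a b c → spread (cubicNorm x a b c) ≃ cubicNorm (spread x) (spread a) (spread b)
      (spread c)
  spread-cubicNorm x a b c =
    plus (a³ ⊕ xb³ ⊕ x²c³) (⊖ (t ⊕ t ⊕ t))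
      (plus (a³ ⊕ xb³) x²c³
        (plus a³ xb³ (cube a) (times x (b ⊛ b ⊛ b) P.refl (cube b)))
        (times (x ⊛ x) (c ⊛ c ⊛ c) (spread-⊛ x x) (cube c)))
      (P.trans (spread-⊖ (t ⊕ t ⊕ t)) (⊖-cong (plus (t ⊕ t) t (plus t t e e) e)))
    where
    a³ = a ⊛ a ⊛ a
    xb³ = x ⊛ (b ⊛ b ⊛ b)
    x²c³ = x ⊛ x ⊛ (c ⊛ c ⊛ c)
    t = x ⊛ (a ⊛ b ⊛ c)
    plus : ∀ f g {f′ g′} → spread f ≃ f′ → spread g ≃ g′ → spread (f ⊕ g) ≃ f′ ⊕ g′
    plus f g p q = P.trans (spread-⊕ f g) (⊕-cong p q)
    times : ∀ f g {f′ g′} → spread f ≃ f′ → spread g ≃ g′ → spread (f ⊛ g) ≃ f′ ⊛ g′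
    times f g p q = P.trans (spread-⊛ f g) (⊛-cong p q)
    cube : ∀ f → spread (f ⊛ f ⊛ f) ≃ spread f ⊛ spread f ⊛ spread f
    cube f = times (f ⊛ f) f (spread-⊛ f f) P.refl
    e : spread t ≃ spread x ⊛ (spread a ⊛ spread b ⊛ spread c)
    e = times x (a ⊛ b ⊛ c) P.refl (times (a ⊛ b) c (spread-⊛ a b) P.refl)

  -- Substituting x³ turns the parameter `X` into the cube `X³`. Scaling then moves powers of `X`
  -- into the arguments, which become the three summands of `reassemble`; by `cubicNorm-factor`
  -- their sum f divides the result.
  spread-norm : ∀ f → spread (norm f) ≃
    cubicNorm (1# ∷ []) (spread (part₀ f)) (0# ∷ spread (part₁ f)) (0# ∷ 0# ∷ spread (part₂ f))
  spread-norm f = begin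
    spread (norm f)                                     ≈⟨ spread-cubicNorm X (part₀ f) (part₁ f)
        (part₂ f) ⟩
    cubicNorm (spread X) a b c                          ≈⟨ change-x ⟩
    cubicNorm X³ a b c                                  ≈⟨ cubicNorm-scale X a b c ⟩
    cubicNorm (1# ∷ []) a (X ⊛ b) (X ⊛ (X ⊛ c))
      ≈⟨ cubicNorm-cong {1# ∷ []} {a} P.refl (X-⊛ b) (P.trans (X-⊛ (X ⊛ c)) (∷-cong refl (X-⊛ c))) ⟩
    cubicNorm (1# ∷ []) a (0# ∷ b) (0# ∷ 0# ∷ c)        ∎
    where
    open Relation.Binary.Reasoning.Setoid P.setoid
    a = spread (part₀ f)
    b = spread (part₁ f)
    c = spread (part₂ f)
    change-x : cubicNorm (spread X) a b c ≃ cubicNorm X³ a b c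
    change-x = ⊕-cong (⊕-cong (P.+-congˡ {a ⊛ a ⊛ a} (P.*-congʳ {b ⊛ b ⊛ b} e)) (P.*-congʳ {c ⊛ c ⊛ c}
        (⊛-cong e e)))
                      (⊖-cong (⊕-cong (⊕-cong t t) t))
      where
      e = spread-X
      t = P.*-congʳ {a ⊛ b ⊛ c} e

  -- A polynomial divides its norm, evaluated at x³.
  norm-Unit : ∀ f → Unit (norm f) → Unit f
  norm-Unit f (k , e) = Unit-∣ (spread k , (begin
    spread k ⊛ (f ⊛ f*)               ≈⟨ P.*-congˡ {spread k} (P.*-congʳ {f*} (reassemble f)) ⟩
    spread k ⊛ ((a ⊕ b ⊕ c) ⊛ f*)
      ≈⟨ P.*-congˡ {spread k} (P.sym (P.trans (spread-norm f) (cubicNorm-factor a b c))) ⟩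
    spread k ⊛ spread (norm f)        ≈⟨ spread-⊛ k (norm f) ⟨
    spread (k ⊛ norm f)               ≈⟨ spread-cong e ⟩
    1# ∷ 0# ∷ 0# ∷ []                 ≈⟨ ∷-cong refl (0∷0∷ 0∷[]) ⟩
    1# ∷ []                           ∎))
    where
    open Relation.Binary.Reasoning.Setoid P.setoid
    a = spread (part₀ f)
    b = 0# ∷ spread (part₁ f)
    c = 0# ∷ 0# ∷ spread (part₂ f)
    f* = a ⊛ a ⊕ b ⊛ b ⊕ c ⊛ c ⊕ ⊖ (a ⊛ b ⊕ b ⊛ c ⊕ c ⊛ a)

  -- Only the summand whose exponents are congruent to n modulo 3 can contribute in degree n, so at
  -- most one of a₀, a₁, a₂ is nonzero and it equals a. Recording just the norm a³ avoids tracking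
  -- the residue of n.
  Top-spread-parts : ∀ {n a} f → Top n f a → ∃[ a₀ ] ∃[ a₁ ] ∃[ a₂ ]
    (CN.cubicNorm 1# a₀ a₁ a₂ ≈ a * a * a × Top n (spread (part₀ f)) a₀
      × Top n (0# ∷ spread (part₁ f)) a₁ × Top n (0# ∷ 0# ∷ spread (part₂ f)) a₂)
  Top-spread-parts {n} {a} [] (mkTop u t) = 0# , 0# , 0# ,
    trans (CN.cubicNorm-cong t t t) (trans (CN.cubicNorm-factor a a a) (trans e (*-cong
        (*-cong t t) t))) ,
    Top-[] , Top-resp (P.sym 0∷[]) refl Top-[] , Top-resp (P.sym (0∷0∷ 0∷[])) refl Top-[]
    where
    e : (a + a + a) * (a * a + a * a + a * a - (a * a + a * a + a * a)) ≈ 0# * 0# * 0#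
    e = S.solve 1 (λ a → (a S.:+ a S.:+ a) S.:* (a S.:* a S.:+ a S.:* a S.:+ a S.:* a S.:-
        (a S.:* a S.:+ a S.:* a S.:+ a S.:* a))
          S.:= S.con (+ 0) S.:* S.con (+ 0) S.:* S.con (+ 0)) refl a
  Top-spread-parts {zero} {a} (b ∷ f) (mkTop u t) = b , 0# , 0# ,
    trans (CN.cubicNorm-factor b 0# 0#) (trans e (*-cong (*-cong t t) t)) ,
    Top-resp (P.sym (∷-cong refl (0∷0∷ (0∷0∷ (spread-[] _ (part₂-[] f f≃[])))))) refl (Top-const b) ,
    Top-resp (P.sym (0∷0∷ (spread-[] _ (part₀-[] f f≃[])))) refl Top-[] ,
    Top-resp (P.sym (0∷0∷ (0∷0∷ (spread-[] _ (part₁-[] f f≃[]))))) refl Top-[]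
    where
    f≃[] : f ≃ []
    f≃[] = ext λ i → u (suc i) (s≤s z≤n)
    e : (b + 0# + 0#) * (b * b + 0# * 0# + 0# * 0# - (b * 0# + 0# * 0# + 0# * b)) ≈ b * b * b
    e = S.solve 1 (λ b → let o = S.con (+ 0) in (b S.:+ o S.:+ o) S.:*
        (b S.:* b S.:+ o S.:* o S.:+ o S.:* o S.:- (b S.:* o S.:+ o S.:* o S.:+ o S.:* b))
          S.:= b S.:* b S.:* b) refl b
  Top-spread-parts {suc n} {a} (b ∷ f) t with Top-spread-parts f (Top-tail t)
  -- Prepending b rotates the summands, and the norm form with parameter 1 is invariant under cyclic
  -- permutations.
  ... | a₀ , a₁ , a₂ , e , t₀ , t₁ , t₂ = a₂ , a₀ , a₁ ,
    trans (S.solve 3 (λ a b c →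
      let N = λ a b c → a S.:* a S.:* a S.:+ S.con (+ 1) S.:* (b S.:* b S.:* b) S.:+ S.con (+ 1) S.:* S.con (+ 1) S.:* (c S.:* c S.:* c) S.:-
                (S.con (+ 1) S.:* (a S.:* b S.:* c) S.:+ S.con (+ 1) S.:* (a S.:* b S.:* c) S.:+ S.con
                    (+ 1) S.:* (a S.:* b S.:* c))
      in N c a b S.:= N a b c) refl a₀ a₁ a₂) e ,
    Top-∷ b t₂ , Top-∷ 0# t₀ , Top-∷ 0# t₁

  -- Stated after substituting x³, because there the three summands of f share the bound n, whereas
  -- the bounds of the parts themselves depend on n modulo 3.
  Top-norm : ∀ {n a} f → Top n f a → Top (n ℕ.+ n ℕ.+ n) (spread (norm f)) (a * a * a)
  Top-norm {n} f t with Top-spread-parts f t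
  ... | a₀ , a₁ , a₂ , e , t₀ , t₁ , t₂ = Top-resp (P.sym (spread-norm f)) e
    (Top-⊕ (Top-⊕ (Top-⊕ (t-³ t₀) (t-1 (t-³ t₁))) (t-⊛ (t-1 (Top-const 1#)) (t-³ t₂)))
           (Top-⊖ (Top-⊕ (Top-⊕ t-abc t-abc) t-abc)))
    where
    t-⊛ : ∀ {m n a b f g} → Top m f a → Top n g b → Top (m ℕ.+ n) (f ⊛ g) (a * b)
    t-⊛ {f = f} {g} = Top-⊛ f g
    t-1 : ∀ {n a f} → Top n f a → Top n ((1# ∷ []) ⊛ f) (1# * a)
    t-1 {f = f} = Top-⊛ (1# ∷ []) f (Top-const 1#)
    t-³ : ∀ {n a f} → Top n f a → Top (n ℕ.+ n ℕ.+ n) (f ⊛ f ⊛ f) (a * a * a)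
    t-³ {f = f} t = Top-⊛ (f ⊛ f) f (Top-⊛ f f t t) t
    t-abc : Top (n ℕ.+ n ℕ.+ n) ((1# ∷ []) ⊛ (spread (part₀ f) ⊛ (0# ∷ spread (part₁ f)) ⊛
        (0# ∷ 0# ∷ spread (part₂ f)))) (1# * (a₀ * a₁ * a₂))
    t-abc = t-1 (t-⊛ (t-⊛ t₀ t₁) t₂)

  coeff₀-⊛ : ∀ f g → coeff (f ⊛ g) 0 ≈ coeff f 0 * coeff g 0
  coeff₀-⊛ []      g = sym (zeroˡ _)
  coeff₀-⊛ (a ∷ f) g = trans (coeff-⊕ (a ⊙ g) (0# ∷ f ⊛ g) 0) (trans (+-identityʳ _) (coeff-⊙ a g 0))

  coeff₀-part₀ : ∀ f → coeff (part₀ f) 0 ≈ coeff f 0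
  coeff₀-part₀ []      = refl
  coeff₀-part₀ (a ∷ f) = refl

  coeff₀-spread : ∀ f → coeff (spread f) 0 ≈ coeff f 0
  coeff₀-spread []      = refl
  coeff₀-spread (a ∷ f) = refl

  -- All terms of the norm form except the cube of `part₀ f` carry a factor `X`.
  coeff₀-norm : ∀ f → coeff (norm f) 0 ≈ coeff f 0 * coeff f 0 * coeff f 0
  coeff₀-norm f = begin
    coeff (norm f) 0                      ≈⟨ _≃_.at rearranged 0 ⟩
    coeff (f₀ ⊛ f₀ ⊛ f₀ ⊕ X ⊛ h) 0        ≈⟨ coeff-⊕ (f₀ ⊛ f₀ ⊛ f₀) (X ⊛ h) 0 ⟩
    coeff (f₀ ⊛ f₀ ⊛ f₀) 0 + coeff (X ⊛ h) 0
      ≈⟨ +-cong (trans (coeff₀-⊛ (f₀ ⊛ f₀) f₀) (*-congʳ (coeff₀-⊛ f₀ f₀))) (trans (coeff₀-⊛ X h)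
          (zeroˡ _)) ⟩
    coeff f₀ 0 * coeff f₀ 0 * coeff f₀ 0 + 0#  ≈⟨ +-identityʳ _ ⟩
    coeff f₀ 0 * coeff f₀ 0 * coeff f₀ 0       ≈⟨ *-cong (*-cong e e) e ⟩
    coeff f 0 * coeff f 0 * coeff f 0          ∎
    where
    open Relation.Binary.Reasoning.Setoid setoid
    e = coeff₀-part₀ f
    f₀ = part₀ f
    f₁ = part₁ f
    f₂ = part₂ f
    h = f₁ ⊛ f₁ ⊛ f₁ ⊕ X ⊛ (f₂ ⊛ f₂ ⊛ f₂) ⊕ ⊖ (f₀ ⊛ f₁ ⊛ f₂ ⊕ f₀ ⊛ f₁ ⊛ f₂ ⊕ f₀ ⊛ f₁ ⊛ f₂)
    rearranged : norm f ≃ f₀ ⊛ f₀ ⊛ f₀ ⊕ X ⊛ h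
    rearranged = PS.solve 4 (λ x a b c → a PS.:* a PS.:* a PS.:+ x PS.:*
        (b PS.:* b PS.:* b) PS.:+ x PS.:* x PS.:* (c PS.:* c PS.:* c)
        PS.:- (x PS.:* (a PS.:* b PS.:* c) PS.:+ x PS.:* (a PS.:* b PS.:* c) PS.:+ x PS.:*
            (a PS.:* b PS.:* c))
      PS.:= a PS.:* a PS.:* a PS.:+ x PS.:* (b PS.:* b PS.:* b PS.:+ x PS.:* (c PS.:* c PS.:* c) PS.:-
          (a PS.:* b PS.:* c PS.:+ a PS.:* b PS.:* c PS.:+ a PS.:* b PS.:* c)))
      P.refl X f₀ f₁ f₂

-- Irreducibility of x^(3ⁿ) - u when u is not a cube

module CubicAtoms {κ ℓ₁ ℓ₂ : Level} (K : HeytingField κ ℓ₁ ℓ₂) (D : IsDiscreteField K) where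

  open Field K
  open DiscretePolynomials K D
  open CubicBinomials K D
  private
    module P = CommutativeRing polyRing
    module S = IntegerCoefficients commutativeRing
    module PS = IntegerCoefficients polyRing
  open Algebra.Definitions.RawSemiring polyRawSemiring using () renaming (_^_ to _^ₚ_)

  infix 4 _~_
  record _~_ (f g : Poly) : Set (κ ⊔ ℓ₁) where
    constructor assoc~
    field
      factor      : Poly
      factor-Unit : Unit factor
      equality    : f ≃ factor ⊛ g

  Unit⇒~1 : ∀ {f} → Unit f → f ~ 1# ∷ []
  Unit⇒~1 {f} U = assoc~ f U (P.sym (P.*-identityʳ f))

  ~-⊛ : ∀ {A f f′ g} → f ≃ A ⊛ f′ → f′ ~ g → f ~ A ⊛ g
  ~-⊛ {A} {f} {f′} {g} p (assoc~ e U q) = assoc~ e U (P.trans p (P.trans (P.*-congˡ {A} q)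
    (PS.solve 3 (λ A e g → A PS.:* (e PS.:* g) PS.:= e PS.:* (A PS.:* g)) P.refl A e g)))

  cancel-factor : ∀ {A f f′} g B → ¬ A ≃ [] → f ≃ A ⊛ f′ → f ⊛ g ≃ A ⊛ B → f′ ⊛ g ≃ B
  cancel-factor {A} {f} {f′} g B A≄[] p e = ⊛-cancelˡ A≄[] (begin
    A ⊛ (f′ ⊛ g)    ≈⟨ ⊛-assoc A f′ g ⟨
    A ⊛ f′ ⊛ g      ≈⟨ P.*-congʳ {g} p ⟨
    f ⊛ g           ≈⟨ e ⟩
    A ⊛ B           ∎)
    where open Relation.Binary.Reasoning.Setoid P.setoid

  PowerFactors : Poly → ℕ → Poly → Poly → Set (κ ⊔ ℓ₁)
  PowerFactors A k f g = ∃[ i ] ∃[ j ] (i ℕ.+ j ≡ k × f ~ A ^ₚ i × g ~ A ^ₚ j)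

  PowerFactors-step : ∀ {A k f f′ g} → f ≃ A ⊛ f′ → PowerFactors A k f′ g → PowerFactors A (suc k) f g
  PowerFactors-step {A} p (i , j , q , f′~ , g~) = suc i , j , ≡.cong suc q , ~-⊛ {A} p f′~ , g~

  PowerFactors-swap : ∀ {A k f g} → PowerFactors A k f g → PowerFactors A k g f
  PowerFactors-swap (i , j , q , f~ , g~) = j , i , ≡.trans (ℕ.+-comm j i) q , g~ , f~

  -- The case of unique factorization to which the norm argument leads: the prime A divides one of
  -- the two factors, and cancelling it there lowers the exponent.
  factors-of-power : ∀ {A} → Atom A → ¬ A ≃ [] → ∀ k f g → f ⊛ g ≃ A ^ₚ k → PowerFactors A k f g
  factors-of-power atom A≄[] zero f g e =
    0 , 0 , ≡.refl , Unit⇒~1 (g , P.trans (⊛-comm g f) e) , Unit⇒~1 (f , e)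
  factors-of-power {A} atom A≄[] (suc k) f g e = [ A∣f , A∣g ]′ (atom⇒prime atom f g (A ^ₚ k , e))
    where
    A∣f : A ∣ₚ f → PowerFactors A (suc k) f g
    A∣f (f′ , p) = PowerFactors-step {A} {k} {f} {f′} {g} p
      (factors-of-power atom A≄[] k f′ g (cancel-factor g (A ^ₚ k) A≄[] p e))
    A∣g : A ∣ₚ g → PowerFactors A (suc k) f g
    A∣g (g′ , p) = PowerFactors-swap {A} {suc k} {g} {f} (PowerFactors-step {A} {k} {g} {g′} {f} p
      (factors-of-power atom A≄[] k g′ f (cancel-factor f (A ^ₚ k) A≄[] p (P.trans (⊛-comm g f) e))))

  -- x^(3ⁿ) − u
  cubicBinomial : ℕ → Carrier → Poly
  cubicBinomial zero    u = - u ∷ 1# ∷ []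
  cubicBinomial (suc n) u = spread (cubicBinomial n u)

  Top-spread : ∀ {n a} f → Top n f a → Top (3 ℕ.* n) (spread f) a
  Top-spread [] (mkTop u t) = mkTop (λ _ _ → refl) t
  Top-spread {zero} (b ∷ f) (mkTop u t) =
    Top-resp (P.sym (∷-cong
        refl (0∷0∷ (0∷0∷ (spread-[] f (ext λ i → u (suc i) (s≤s z≤n))))))) t (Top-const b)
  Top-spread {suc n} {a} (b ∷ f) t =
      ≡.subst (λ k → Top k (b ∷ 0# ∷ 0# ∷ spread f) a) (≡.sym (ℕ.*-suc 3 n))
    (Top-∷ b (Top-∷ 0# (Top-∷ 0# (Top-spread f (Top-tail t)))))

  Top-cubicBinomial : ∀ n u → Top (3 ℕ.^ n) (cubicBinomial n u) 1#
  Top-cubicBinomial zero    u = Top-∷ (- u) (Top-const 1#)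
  Top-cubicBinomial (suc n) u = Top-spread (cubicBinomial n u) (Top-cubicBinomial n u)

  coeff₀-cubicBinomial : ∀ n u → coeff (cubicBinomial n u) 0 ≈ - u
  coeff₀-cubicBinomial zero    u = refl
  coeff₀-cubicBinomial (suc n) u = trans (coeff₀-spread (cubicBinomial n u)) (coeff₀-cubicBinomial n u)

  -- If N(f) is associated to x^(3ⁿ) − u, then comparing the leading and the
  -- constant coefficients of f and N(f) shows that u is a cube.
  norm-~⇒cube : ∀ n u f → norm f ~ cubicBinomial n u → ∃[ v ] v ^ 3 ≈ u
  norm-~⇒cube n u f (assoc~ e U N≃eA) with Unit-const U
  ... | e₀ , e₀≉0 , e-top with degree f
  ...   | inj₁ f≃[] = ⊥-elim (Top⇒≄[] eA≉0 eA-top (P.trans (P.sym N≃eA) (P.trans (norm-cong f≃[])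
      (norm-spread []))))
    where
    eA≉0 = *-≉0 e₀≉0 1≉0
    eA-top = Top-⊛ e (cubicBinomial n u) e-top (Top-cubicBinomial n u)
  ...   | inj₂ (d , a , a≉0 , f-top) with inverse a≉0
  ...     | b , ab≈1 = v , (begin
    v ^ 3                                     ≈⟨ S.solve 2 (λ t b → (S.:- (t S.:* b)) S.:^ 3
        S.:= S.:- (t S.:* t S.:* t S.:* (b S.:* b S.:* b))) refl t b ⟩
    - (t * t * t * (b * b * b))               ≈⟨ -‿cong (*-congʳ t³) ⟩
    - (a * a * a * - u * (b * b * b))
      ≈⟨ S.solve 3 (λ a b u → S.:- (a S.:* a S.:* a S.:* (S.:- u) S.:* (b S.:* b S.:* b))
          S.:= (a S.:* b) S.:* (a S.:* b) S.:* (a S.:* b) S.:* u) refl a b u ⟩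
    (a * b) * (a * b) * (a * b) * u           ≈⟨ *-congʳ (*-cong (*-cong ab≈1 ab≈1) ab≈1) ⟩
    1# * 1# * 1# * u                          ≈⟨ S.solve 1 (λ u → S.con (+ 1) S.:* S.con (+ 1) S.:* S.con
        (+ 1) S.:* u S.:= u) refl u ⟩
    u                                         ∎)
    where
    open Relation.Binary.Reasoning.Setoid setoid
    t = coeff f 0
    -- Here b = 1/a. Constant terms give t³ = -e₀ u and leading terms give e₀ = a³, so (-t/a)³ = u.
    v = - (t * b)
    A = cubicBinomial n u
    -- The leading coefficient of N(f)(x³) is e₀ because the binomial is monic, and it is a³ by
    -- `Top-norm`. This determines the unit left open by association.
    norm-top : Top (3 ℕ.^ suc n) (spread (norm f)) e₀
    norm-top = Top-resp (P.sym (P.trans (spread-cong N≃eA) (spread-⊛ e A))) (*-identityʳ e₀)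
      (Top-⊛ (spread e) (spread A) (Top-spread e e-top) (Top-cubicBinomial (suc n) u))
    a³≈e₀ : a * a * a ≈ e₀
    a³≈e₀ = proj₂ (Top-unique (*-≉0 (*-≉0 a≉0 a≉0) a≉0) e₀≉0 (Top-norm f f-top) norm-top)
    t³ : t * t * t ≈ a * a * a * - u
    t³ = begin
      t * t * t                    ≈⟨ coeff₀-norm f ⟨
      coeff (norm f) 0             ≈⟨ at N≃eA 0 ⟩
      coeff (e ⊛ A) 0              ≈⟨ coeff₀-⊛ e A ⟩
      coeff e 0 * coeff A 0        ≈⟨ *-cong (top e-top) (coeff₀-cubicBinomial n u) ⟩
      e₀ * - u                     ≈⟨ *-congʳ a³≈e₀ ⟨
      a * a * a * - u              ∎

  ~1⇒Unit : ∀ {f} → f ~ 1# ∷ [] → Unit f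
  ~1⇒Unit {f} (assoc~ e U p) = Unit-resp (P.sym (P.trans p (P.*-identityʳ e))) U

  cubicBinomial-≄[] : ∀ n u → ¬ cubicBinomial n u ≃ []
  cubicBinomial-≄[] n u = Top⇒≄[] 1≉0 (Top-cubicBinomial n u)

  linear-atom : ∀ b → Atom (b ∷ 1# ∷ [])
  linear-atom b {f} {g} e with degree f | degree g
  ... | inj₁ f≃[] | _ = ⊥-elim (Top⇒≄[] 1≉0 (Top-∷ b (Top-const 1#)) (P.trans e (P.*-congʳ {g} f≃[])))
  ... | _ | inj₁ g≃[] =
      ⊥-elim (Top⇒≄[] 1≉0 (Top-∷ b (Top-const 1#)) (P.trans e (P.trans (P.*-congˡ {f} g≃[]) (⊛-zeroʳ f))))
  ... | inj₂ (m , x , x≉0 , t) | inj₂ (n , y , y≉0 , s)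
    with m | t | n | s | proj₁ (Top-unique (*-≉0 x≉0 y≉0) 1≉0 (Top-⊛ f g t s) (Top-resp e
        refl (Top-∷ b (Top-const 1#))))
  ...   | zero | t | _ | _ | _ = inj₁ (const-Unit x≉0 t)
  ...   | suc m | _ | zero | s | _ = inj₂ (const-Unit y≉0 s)
  ...   | suc zero | _ | suc _ | _ | ()
  ...   | suc (suc _) | _ | suc _ | _ | ()

  ~^1 : ∀ {f A} → f ~ A ^ₚ 1 → f ~ A
  ~^1 {f} {A} (assoc~ e U p) = assoc~ e U (P.trans p (P.*-congˡ {e} (P.*-identityʳ A)))

  -- In every splitting of 3 into two exponents, one of them is 0 or 1.
  PowerFactors-3 : ∀ {A f g} → PowerFactors A 3 f g → (Unit f ⊎ Unit g) ⊎ (f ~ A ⊎ g ~ A)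
  PowerFactors-3 (0 , 3 , _ , f~ , _)            = inj₁ (inj₁ (~1⇒Unit f~))
  PowerFactors-3 (1 , 2 , _ , f~ , _)            = inj₂ (inj₁ (~^1 f~))
  PowerFactors-3 (2 , 1 , _ , _ , g~)            = inj₂ (inj₂ (~^1 g~))
  PowerFactors-3 (3 , 0 , _ , _ , g~)            = inj₁ (inj₂ (~1⇒Unit g~))
  PowerFactors-3 (0 , 0 , () , _)
  PowerFactors-3 (0 , 1 , () , _)
  PowerFactors-3 (0 , 2 , () , _)
  PowerFactors-3 (0 , suc (suc (suc (suc _))) , () , _)
  PowerFactors-3 (1 , 0 , () , _)
  PowerFactors-3 (1 , 1 , () , _)
  PowerFactors-3 (1 , suc (suc (suc _)) , () , _)
  PowerFactors-3 (2 , 0 , () , _)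
  PowerFactors-3 (2 , suc (suc _) , () , _)
  PowerFactors-3 (3 , suc _ , () , _)
  PowerFactors-3 (suc (suc (suc (suc _))) , _ , () , _)

  cubicBinomial-atom : ∀ {u} → (∀ v → ¬ v ^ 3 ≈ u) → ∀ n → Atom (cubicBinomial n u)
  cubicBinomial-atom {u} noncube zero = linear-atom (- u)
  cubicBinomial-atom {u} noncube (suc n) {f} {g} e =
    [ Sum.map (norm-Unit f) (norm-Unit g) , [ absurd f ,
        absurd g ]′ ]′ (PowerFactors-3 {A} {norm f} {norm g}
      (factors-of-power (cubicBinomial-atom noncube n) (cubicBinomial-≄[] n u) 3 (norm f) (norm g) N≃A³))
    where
    open Relation.Binary.Reasoning.Setoid P.setoid
    A = cubicBinomial n u
    absurd : ∀ h {B : Set (κ ⊔ ℓ₁)} → norm h ~ A → B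
    absurd h N~A = ⊥-elim (noncube _ (proj₂ (norm-~⇒cube n u h N~A)))
    N≃A³ : norm f ⊛ norm g ≃ A ^ₚ 3
    N≃A³ = begin
      norm f ⊛ norm g        ≈⟨ norm-⊛ f g ⟨
      norm (f ⊛ g)           ≈⟨ norm-cong e ⟨
      norm (spread A)        ≈⟨ norm-spread A ⟩
      A ⊛ A ⊛ A              ≈⟨ PS.solve 1 (λ A → A PS.:* A PS.:* A PS.:= A PS.:^ 3) P.refl A ⟩
      A ^ₚ 3                 ∎

-- Homogenizing a polynomial at a fraction Z/Y

module Homogenization {a ℓ₁ ℓ₂ r ℓ : Level} (F : HeytingField a ℓ₁ ℓ₂) (D : IsDiscreteField F) (R : CommutativeRing r ℓ)
  (φ : HeytingField.Carrier F → CommutativeRing.Carrier R)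
  (φ-hom : RingMorphisms.IsRingHomomorphism (Field.rawRing F) (CommutativeRing.rawRing R) φ)
  (Z Y : CommutativeRing.Carrier R) where

  open DiscretePolynomials F D
  open CommutativeRing R
  open RingMorphisms.IsRingHomomorphism φ-hom
  open Algebra.Properties.Semiring.Exp semiring using (_^_)
  open Relation.Binary.Reasoning.Setoid setoid
  private
    module F = Field F
    module P = CommutativeRing polyRing
    module S = IntegerCoefficients R

  -- For f of degree at most d this is Σ fᵢ Zⁱ Y^(d−i).
  homogenize : ℕ → Poly → Carrier
  homogenize d       []      = 0#
  homogenize zero    (a ∷ f) = φ a
  homogenize (suc d) (a ∷ f) = φ a * Y ^ suc d + Z * homogenize d f

  homogenize-[] : ∀ d f → f ≃ [] → homogenize d f ≈ 0#
  homogenize-[] d       []      e       = refl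
  homogenize-[] zero    (a ∷ f) (ext e) = trans (⟦⟧-cong (e 0)) 0#-homo
  homogenize-[] (suc d) (a ∷ f) (ext e) = begin
    φ a * Y ^ suc d + Z * homogenize d f
      ≈⟨ +-cong (*-congʳ (trans (⟦⟧-cong (e 0)) 0#-homo)) (*-congˡ (homogenize-[] d f (ext λ i → e
          (suc i)))) ⟩
    0# * Y ^ suc d + Z * 0#
      ≈⟨ S.solve 2 (λ y z → S.con (+ 0) S.:* y S.:+ z S.:* S.con (+ 0)
          S.:= S.con (+ 0)) refl (Y ^ suc d) Z ⟩
    0#                                   ∎

  homogenize-cong : ∀ d {f g} → f ≃ g → homogenize d f ≈ homogenize d g
  homogenize-cong d       {[]}    {g}     e = sym (homogenize-[] d g (P.sym e))
  homogenize-cong d       {a ∷ f} {[]}    e = homogenize-[] d (a ∷ f) e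
  homogenize-cong zero    {a ∷ f} {b ∷ g} e = ⟦⟧-cong (proj₁ (∷-injective e))
  homogenize-cong (suc d) {a ∷ f} {b ∷ g} e =
    +-cong (*-congʳ (⟦⟧-cong (proj₁ (∷-injective e)))) (*-congˡ (homogenize-cong d (proj₂
        (∷-injective e))))

  homogenize-⊕ : ∀ d f g → homogenize d (f ⊕ g) ≈ homogenize d f + homogenize d g
  homogenize-⊕ d       []      g       = sym (+-identityˡ _)
  homogenize-⊕ d       (a ∷ f) []      = sym (+-identityʳ _)
  homogenize-⊕ zero    (a ∷ f) (b ∷ g) = +-homo a b
  homogenize-⊕ (suc d) (a ∷ f) (b ∷ g) = begin
    φ (a F.+ b) * y + Z * homogenize d (f ⊕ g)
      ≈⟨ +-cong (*-congʳ (+-homo a b)) (*-congˡ (homogenize-⊕ d f g)) ⟩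
    (φ a + φ b) * y + Z * (hf + hg)
      ≈⟨ S.solve 6 (λ a b y z f g → (a S.:+ b) S.:* y S.:+ z S.:* (f S.:+ g)
          S.:= (a S.:* y S.:+ z S.:* f) S.:+ (b S.:* y S.:+ z S.:* g)) refl (φ a) (φ b) y Z hf hg ⟩
    (φ a * y + Z * hf) + (φ b * y + Z * hg)         ∎
    where
    y = Y ^ suc d
    hf = homogenize d f
    hg = homogenize d g

  homogenize-⊙ : ∀ d a f → homogenize d (a ⊙ f) ≈ φ a * homogenize d f
  homogenize-⊙ d       a []      = sym (zeroʳ _)
  homogenize-⊙ zero    a (b ∷ f) = *-homo a b
  homogenize-⊙ (suc d) a (b ∷ f) = begin
    φ (a F.* b) * y + Z * homogenize d (a ⊙ f)
      ≈⟨ +-cong (*-congʳ (*-homo a b)) (*-congˡ (homogenize-⊙ d a f)) ⟩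
    φ a * φ b * y + Z * (φ a * hf)
      ≈⟨ S.solve 5 (λ a b y z f → a S.:* b S.:* y S.:+ z S.:* (a S.:* f)
          S.:= a S.:* (b S.:* y S.:+ z S.:* f)) refl (φ a) (φ b) y Z hf ⟩
    φ a * (φ b * y + Z * hf)                        ∎
    where
    y = Y ^ suc d
    hf = homogenize d f

  -- The term of degree i carries Y^(d - i); as long as all terms lie within degree d, one more unit
  -- of formal degree is one more factor Y.
  homogenize-suc : ∀ {d a} f → Top d f a → homogenize (suc d) f ≈ Y * homogenize d f
  homogenize-suc [] t = sym (zeroʳ Y)
  homogenize-suc {zero} (a ∷ f) (mkTop u _) = begin
    φ a * (Y * 1#) + Z * homogenize 0 f
      ≈⟨ +-congˡ (*-congˡ (homogenize-[] 0 f (ext λ i → u (suc i) (s≤s z≤n)))) ⟩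
    φ a * (Y * 1#) + Z * 0#
      ≈⟨ S.solve 3 (λ a y z → a S.:* (y S.:* S.con (+ 1)) S.:+ z S.:* S.con (+ 0)
          S.:= y S.:* a) refl (φ a) Y Z ⟩
    Y * φ a                                ∎
  homogenize-suc {suc d} (a ∷ f) t = begin
    φ a * (Y * y) + Z * homogenize (suc d) f   ≈⟨ +-congˡ (*-congˡ (homogenize-suc f (Top-tail t))) ⟩
    φ a * (Y * y) + Z * (Y * hf)
      ≈⟨ S.solve 5 (λ a Y y z f → a S.:* (Y S.:* y) S.:+ z S.:* (Y S.:* f)
          S.:= Y S.:* (a S.:* y S.:+ z S.:* f)) refl (φ a) Y y Z hf ⟩
    Y * (φ a * y + Z * hf)                     ∎
    where
    y = Y ^ suc d
    hf = homogenize d f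

  homogenize-+ : ∀ {d a} k f → Top d f a → homogenize (k ℕ.+ d) f ≈ Y ^ k * homogenize d f
  homogenize-+ zero f t = sym (*-identityˡ _)
  -- `Top-raise` needs a strictly larger bound, so the first increment is handled separately with t
  -- itself.
  homogenize-+ {d} (suc zero) f t = trans (homogenize-suc f t) (*-congʳ (sym (*-identityʳ Y)))
  homogenize-+ {d} (suc (suc k)) f t = begin
    homogenize (suc (suc k ℕ.+ d)) f     ≈⟨ homogenize-suc f (Top-raise (s≤s (ℕ.m≤n+m d k)) t) ⟩
    Y * homogenize (suc k ℕ.+ d) f       ≈⟨ *-congˡ (homogenize-+ (suc k) f t) ⟩
    Y * (Y ^ suc k * homogenize d f)     ≈⟨ *-assoc _ _ _ ⟨
    Y ^ suc (suc k) * homogenize d f     ∎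

  -- Formal degrees add. In the recursive step the multiple of g by c has formal degree suc d + e,
  -- and the excess over e contributes exactly the power of Y that belongs to c.
  homogenize-⊛ : ∀ {d e a b} f g → Top d f a → Top e g b → homogenize (d ℕ.+ e)
      (f ⊛ g) ≈ homogenize d f * homogenize e g
  homogenize-⊛ [] g t s = sym (zeroˡ _)
  homogenize-⊛ {zero} {e} (c ∷ f) g (mkTop u _) s =
    trans (homogenize-cong e (P.trans (P.sym (P.*-congʳ {g} {c ∷ []} {c ∷ f} (∷-cong
        F.refl (ext λ i → F.sym (u (suc i) (s≤s z≤n)))))) (const-⊛ c g)))
          (homogenize-⊙ e c g)
  homogenize-⊛ {suc d} {e} (c ∷ f) g t s = begin
    homogenize (suc d ℕ.+ e) (c ⊙ g ⊕ (0F ∷ f ⊛ g))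
      ≈⟨ homogenize-⊕ (suc d ℕ.+ e) (c ⊙ g) (0F ∷ f ⊛ g) ⟩
    homogenize (suc d ℕ.+ e) (c ⊙ g) + (φ 0F * y + Z * homogenize (d ℕ.+ e) (f ⊛ g))
      ≈⟨ +-cong (trans (homogenize-⊙ (suc d ℕ.+ e) c g) (*-congˡ (homogenize-+ (suc d) g s)))
                (+-cong (*-congʳ 0#-homo) (*-congˡ (homogenize-⊛ f g (Top-tail t) s))) ⟩
    φ c * (Y ^ suc d * hg) + (0# * y + Z * (hf * hg))
      ≈⟨ S.solve 6 (λ c w g y z f → c S.:* (w S.:* g) S.:+ (S.con (+ 0) S.:* y S.:+ z S.:* (f S.:* g))
          S.:= (c S.:* w S.:+ z S.:* f) S.:* g) refl
           (φ c) (Y ^ suc d) hg y Z hf ⟩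
    (φ c * Y ^ suc d + Z * hf) * hg                                        ∎
    where
    0F = F.0#
    y = Y ^ suc (d ℕ.+ e)
    hf = homogenize d f
    hg = homogenize e g

  homogenize-const : ∀ d a → homogenize d (a ∷ []) ≈ φ a * Y ^ d
  homogenize-const zero    a = sym (*-identityʳ _)
  homogenize-const (suc d) a = trans (+-congˡ (zeroʳ Z)) (+-identityʳ _)

  -- Horner's scheme adds a constant to g times the rest; the condition on m keeps this constant
  -- below the recorded degree.
  Top-⊚ : ∀ {m d a b} f g → 1 ℕ.≤ m → Top m g a → Top d f b → Top (d ℕ.* m) (f ⊚ g) (b F.* a F.^ d)
  Top-⊚ [] g 1≤m s (mkTop _ t) = Top-resp P.refl (F.trans (F.sym (F.zeroˡ _)) (F.*-congʳ t)) Top-[]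
  Top-⊚ {d = zero} (c ∷ f) g 1≤m s (mkTop u t) = Top-resp
    (P.trans (P.sym (⊕-identityʳ (c ∷ []))) (P.+-congˡ {c ∷ []} (P.sym (P.trans (P.*-congˡ {g} (⊚-[] f
        (ext λ i → u (suc i) (s≤s z≤n)))) (⊛-zeroʳ g)))))
    (F.trans t (F.sym (F.*-identityʳ _))) (Top-const c)
    where
    ⊚-[] : ∀ f → f ≃ [] → f ⊚ g ≃ []
    ⊚-[] []      e = P.refl
    ⊚-[] (a ∷ f) (ext e) = P.trans (⊕-cong {a ∷ []} {[]} (P.trans (∷-cong (e 0) P.refl) 0∷[])
      (P.trans (P.*-congˡ {g} (⊚-[] f (ext λ i → e (suc i)))) (⊛-zeroʳ g))) P.refl
  Top-⊚ {m} {suc d} {a} {b} (c ∷ f) g 1≤m s t = Top-resp P.refl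
    (F.trans (F.+-identityˡ _) (S′.solve 3 (λ a b c → a S′.:* (b S′.:* c) S′.:= b S′.:* (a S′.:* c))
        F.refl a b (a F.^ d)))
    (Top-⊕ (Top-raise (ℕ.≤-trans 1≤m (ℕ.m≤m+n m _)) (Top-const c)) (Top-⊛ g (f ⊚ g) s (Top-⊚ f g 1≤m s
        (Top-tail t))))
    where module S′ = IntegerCoefficients F.commutativeRing

-- The cubic and the irreducibility of its iterates over F

module CubicPolynomial {c ℓ₁ ℓ₂ : Level} (F : HeytingField c ℓ₁ ℓ₂) where
  open Field F
  open Polynomial F using (Poly)

  -- D(x + α) − α for the Dickson polynomial D(z) = z³ − 3z.
  cubic : Carrier → Poly
  cubic α = (α ^ 3 - 4 · α) ∷ (3 · α ^ 2 - 3 · 1#) ∷ (3 · α) ∷ 1# ∷ []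

module IrreducibleIterates {c ℓ₁ ℓ₂ c′ ℓ₁′ ℓ₂′ : Level}
  (F : HeytingField c ℓ₁ ℓ₂) (FD : IsDiscreteField F) (K : HeytingField c′ ℓ₁′ ℓ₂′)
      (KD : IsDiscreteField K)
  (ι : HeytingField.Carrier F → HeytingField.Carrier K)
  (ι-hom : RingMorphisms.IsRingHomomorphism (Field.rawRing F) (Field.rawRing K) ι)
  (α : HeytingField.Carrier F) (u u′ : HeytingField.Carrier K) where

  private
    module F = Field F
    module K = Field K
    module PF = DiscretePolynomials F FD
    module PK = DiscretePolynomials K KD
    module RF = CommutativeRing PF.polyRing
    module P = CommutativeRing PK.polyRing
    module SF = IntegerCoefficients F.commutativeRing
    module SK = IntegerCoefficients K.commutativeRing
    module S = IntegerCoefficients PK.polyRing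
    module ι = RingMorphisms.IsRingHomomorphism ι-hom
    module B = CubicBinomials K KD
    module A = CubicAtoms K KD
  open PK using (_≃_; _⊛_; _⊕_; ⊖_; ext; X; ∷-cong; 0∷[]; Top; mkTop; Top-⊛; Top-⊕; Top-const; Top-∷;
      Top-resp; Top-raise; Top-unique)
  open Algebra.Properties.Semiring.Exp P.semiring using (^-homo-*) renaming (_^_ to _^ₚ_)
  open CubicPolynomial F

  const : F.Carrier → PK.Poly
  const a = ι a ∷ []

  const-hom : RingMorphisms.IsRingHomomorphism F.rawRing P.rawRing const
  const-hom = record
    { isSemiringHomomorphism = record
      { isNearSemiringHomomorphism = record
        { +-isMonoidHomomorphism = record
          { isMagmaHomomorphism = record
            { isRelHomomorphism = record { cong = λ e → ∷-cong (ι.⟦⟧-cong e) P.refl }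
            ; homo = λ a b → ∷-cong (ι.+-homo a b) P.refl }
          ; ε-homo = P.trans (∷-cong ι.0#-homo P.refl) 0∷[] }
        ; *-homo = λ a b → ∷-cong (K.trans (ι.*-homo a b) (K.sym (K.+-identityʳ _))) P.refl }
      ; 1#-homo = ∷-cong ι.1#-homo P.refl }
    ; -‿homo = λ a → ∷-cong (ι.-‿homo a) P.refl }

  private module const = RingMorphisms.IsRingHomomorphism const-hom

  -- The substitution x = y + 1/y − α turns D(x + α) − α into y³ + 1/y³ − α.
  Z : PK.Poly
  Z = X ⊛ X ⊕ ⊖ (const α ⊛ X) ⊕ (K.1# ∷ [])

  open Homogenization F FD PK.polyRing const const-hom Z X

  Top-Z : Top 2 Z K.1#
  Top-Z = Top-resp P.refl (SK.solve 1 (λ a → SK.con (+ 1) SK.:* SK.con (+ 1) SK.:- SK.con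
      (+ 0) SK.:+ SK.con (+ 0) SK.:= SK.con (+ 1)) K.refl (ι α))
    (Top-⊕ (Top-⊕ (Top-⊛ X X Top-X Top-X)
      (PK.Top-⊖ (Top-raise (s≤s (s≤s z≤n)) (Top-⊛ (const α) X (Top-const _) Top-X))))
      (Top-raise (s≤s z≤n) (Top-const K.1#)))
    where
    Top-X : Top 1 X K.1#
    Top-X = Top-∷ K.0# (Top-const K.1#)

  Top-X^ : ∀ n → Top n (X ^ₚ n) K.1#
  Top-X^ zero    = Top-const K.1#
  Top-X^ (suc n) = Top-resp
      P.refl (K.*-identityˡ _) (Top-⊛ X (X ^ₚ n) (Top-∷ K.0# (Top-const K.1#)) (Top-X^ n))

  -- `Z` is monic of degree 2, so the term of degree i has degree d + i after homogenization, and
  -- the last one dominates. The resulting even degree feeds the parity argument.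
  Top-homogenize : ∀ {d a} f → PF.Top d f a → Top (d ℕ.+ d) (homogenize d f) (ι a)
  Top-homogenize [] (PF.mkTop _ t) = mkTop (λ _ _ → K.refl) (K.trans (K.sym ι.0#-homo) (ι.⟦⟧-cong t))
  Top-homogenize {zero} (b ∷ f) (PF.mkTop _ t) = Top-resp P.refl (ι.⟦⟧-cong t) (Top-const (ι b))
  Top-homogenize {suc d} {a} (b ∷ f) t = Top-resp P.refl (K.trans (K.+-identityˡ _) (K.*-identityˡ _))
    (Top-⊕ (Top-raise (s≤s (ℕ.m≤n+m (suc d) d)) (Top-⊛ (const b) (X ^ₚ suc d) (Top-const _) (Top-X^
        (suc d))))
      (≡.subst (λ k → Top k (Z ⊛ homogenize d f) (K.1# K.* ι a)) (≡.cong suc (≡.sym (ℕ.+-suc d d)))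
        (Top-⊛ Z (homogenize d f) Top-Z (Top-homogenize f (PF.Top-tail t)))))

  cubic-⊚ : ∀ g → cubic α PF.⊚ g PF.≃
    ((α F.^ 3 F.- 4 F.· α) ∷ []) PF.⊕ g PF.⊛ (((3 F.· α F.^ 2 F.- 3 F.· F.1#) ∷ []) PF.⊕ g PF.⊛
        (((3 F.· α) ∷ []) PF.⊕ g))
  cubic-⊚ g = RF.+-congˡ {_ ∷ []} (RF.*-congˡ {g} (RF.+-congˡ {_ ∷ []} (RF.*-congˡ {g}
      (RF.+-congˡ {_ ∷ []}
    (RF.trans (RF.*-congˡ {g} (RF.trans (RF.+-congˡ {F.1# ∷ []} (PF.⊛-zeroʳ g)) (RF.+-identityʳ _)))
        (RF.*-identityʳ g))))))

  iterate : ℕ → PF.Poly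
  iterate n = cubic α PF.^∘ n

  1≤3^ : ∀ n → 1 ℕ.≤ 3 ℕ.^ n
  1≤3^ n = ℕ.m^n>0 3 n

  Top-iterate : ∀ n → PF.Top (3 ℕ.^ n) (iterate n) F.1#
  Top-iterate zero    = PF.Top-∷ F.0# (PF.Top-const F.1#)
  Top-iterate (suc n) = PF.Top-resp RF.refl (SF.solve 0 (SF.con (+ 1) SF.:* SF.con (+ 1) SF.:^ 3
      SF.:= SF.con (+ 1)) F.refl)
    (Top-⊚ (cubic α) (iterate n) (1≤3^ n) (Top-iterate n) (PF.Top-∷ _ (PF.Top-∷ _ (PF.Top-∷ _
        (PF.Top-const F.1#)))))

  -- Formally w (w + 1/w - α): the substitution taken at y = w, with its denominator cleared.
  trinomial : PK.Poly → PK.Poly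
  trinomial w = w ⊛ w ⊕ ⊖ (const α ⊛ w) ⊕ (K.1# ∷ [])

  const-· : ∀ n a {f} → const a ≃ f → const (n F.· a) ≃
      (Algebra.Definitions.RawSemiring._×_ PK.polyRawSemiring n f)
  const-· zero    a e = const.0#-homo
  const-· (suc n) a e = P.trans (const.+-homo a (n F.· a)) (PK.⊕-cong e (const-· n a e))

  const-^ : ∀ n a → const (a F.^ n) ≃ const a ^ₚ n
  const-^ zero    a = const.1#-homo
  const-^ (suc n) a = P.trans (const.*-homo a (a F.^ n)) (P.*-congˡ {const a} (const-^ n a))

  const-minus : ∀ {a b f g} → const a ≃ f → const b ≃ g → const (a F.- b) ≃ f ⊕ ⊖ g
  const-minus {a} {b} p q =
      P.trans (const.+-homo a (F.- b)) (PK.⊕-cong p (P.trans (const.-‿homo b) (PK.⊖-cong q)))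

  -- The hypotheses say that g takes the value w + 1/w - α at Z/X, so f ∘ g takes the value w³ +
  -- 1/w³ - α. Clearing denominators leaves a polynomial identity in w and α for the solver.
  homogenize-cubic-⊚ : ∀ {m} g w → PF.Top m g F.1# → X ^ₚ m ≃ w → homogenize m g ≃ trinomial w →
    homogenize (3 ℕ.* m) (cubic α PF.⊚ g) ≃ trinomial (w ⊛ w ⊛ w)
  homogenize-cubic-⊚ {m} g w t X^m≃w hg≃ =
      ≡.subst (λ k → homogenize k (cubic α PF.⊚ g) ≃ trinomial (w ⊛ w ⊛ w))
    (≡.cong (λ k → m ℕ.+ (m ℕ.+ k)) (≡.sym (ℕ.+-identityʳ m))) (begin
      homogenize (m ℕ.+ (m ℕ.+ m)) (cubic α PF.⊚ g)
        ≈⟨ homogenize-cong (m ℕ.+ (m ℕ.+ m)) (cubic-⊚ g) ⟩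
      homogenize (m ℕ.+ (m ℕ.+ m)) ((a₀ ∷ []) PF.⊕ g PF.⊛ g₁)
        ≈⟨ homogenize-⊕ (m ℕ.+ (m ℕ.+ m)) (a₀ ∷ []) (g PF.⊛ g₁) ⟩
      homogenize (m ℕ.+ (m ℕ.+ m)) (a₀ ∷ []) ⊕ homogenize (m ℕ.+ (m ℕ.+ m)) (g PF.⊛ g₁)
        ≈⟨ PK.⊕-cong (homogenize-const (m ℕ.+ (m ℕ.+ m)) a₀) (homogenize-⊛ g g₁ t t₁) ⟩
      const a₀ ⊛ X ^ₚ (m ℕ.+ (m ℕ.+ m)) ⊕ homogenize m g ⊛ homogenize (m ℕ.+ m) g₁
        ≈⟨ PK.⊕-cong (PK.⊛-cong c₀ w³) (PK.⊛-cong hg≃ h₁) ⟩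
      (A ^ₚ 3 ⊕ ⊖ (4 ×ₚ A)) ⊛ (w ⊛ (w ⊛ w)) ⊕ T ⊛ ((3 ×ₚ (A ^ₚ 2) ⊕ ⊖ (3 ×ₚ (K.1# ∷ []))) ⊛ (w ⊛ w) ⊕ T ⊛
          (3 ×ₚ A ⊛ w ⊕ T))
        ≈⟨ S.solve 2 (λ A w → let T = λ w → w S.:* w S.:- A S.:* w S.:+ S.con (+ 1) in
             (A S.:^ 3 S.:- 4 S.:× A) S.:* (w S.:* (w S.:* w)) S.:+ T w S.:* ((3 S.:×
                 (A S.:^ 2) S.:- 3 S.:× S.con (+ 1)) S.:* (w S.:* w) S.:+ T w S.:*
                 ((3 S.:× A) S.:* w S.:+ T w))
             S.:= T (w S.:* w S.:* w)) P.refl A w ⟩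
      trinomial (w ⊛ w ⊛ w) ∎)
    where
    open Relation.Binary.Reasoning.Setoid P.setoid
    open Algebra.Definitions.RawSemiring PK.polyRawSemiring using () renaming (_×_ to infixr 8 _×ₚ_)
    A = const α
    T = trinomial w
    a₀ = α F.^ 3 F.- 4 F.· α
    a₁ = 3 F.· α F.^ 2 F.- 3 F.· F.1#
    a₂ = 3 F.· α
    g₂ = (a₂ ∷ []) PF.⊕ g
    g₁ = (a₁ ∷ []) PF.⊕ g PF.⊛ g₂
    c₀ : const a₀ ≃ A ^ₚ 3 ⊕ ⊖ (4 ×ₚ A)
    c₀ = const-minus (const-^ 3 α) (const-· 4 α P.refl)
    c₁ : const a₁ ≃ 3 ×ₚ (A ^ₚ 2) ⊕ ⊖ (3 ×ₚ (K.1# ∷ []))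
    c₁ = const-minus (const-· 3 (α F.^ 2) (const-^ 2 α)) (const-· 3 F.1# const.1#-homo)
    c₂ : const a₂ ≃ 3 ×ₚ A
    c₂ = const-· 3 α P.refl
    -- Adding a constant keeps the bound m but changes the recorded coefficient when m = 0, hence
    -- the existential.
    raise : ∀ {m} a {f b} → PF.Top m f b → ∃[ b′ ] PF.Top m ((a ∷ []) PF.⊕ f) b′
    raise {zero}  a t = _ , PF.Top-⊕ (PF.Top-const a) t
    raise {suc m} a t = _ , PF.Top-⊕ (PF.Top-raise (s≤s z≤n) (PF.Top-const a)) t
    t₂ = proj₂ (raise a₂ t)
    t₁ = proj₂ (raise a₁ (PF.Top-⊛ g g₂ t t₂))
    w² : X ^ₚ (m ℕ.+ m) ≃ w ⊛ w
    w² = P.trans (^-homo-* X m m) (PK.⊛-cong X^m≃w X^m≃w)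
    w³ : X ^ₚ (m ℕ.+ (m ℕ.+ m)) ≃ w ⊛ (w ⊛ w)
    w³ = P.trans (^-homo-* X m (m ℕ.+ m)) (PK.⊛-cong X^m≃w w²)
    h₂ : homogenize m g₂ ≃ 3 ×ₚ A ⊛ w ⊕ T
    h₂ = P.trans (homogenize-⊕ m (a₂ ∷ []) g) (PK.⊕-cong (P.trans (homogenize-const m a₂)
        (PK.⊛-cong c₂ X^m≃w)) hg≃)
    h₁ : homogenize (m ℕ.+ m) g₁ ≃ (3 ×ₚ (A ^ₚ 2) ⊕ ⊖ (3 ×ₚ (K.1# ∷ []))) ⊛ (w ⊛ w) ⊕ T ⊛ (3 ×ₚ A ⊛ w ⊕ T)
    h₁ = P.trans (homogenize-⊕ (m ℕ.+ m) (a₁ ∷ []) (g PF.⊛ g₂))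
      (PK.⊕-cong (P.trans (homogenize-const (m ℕ.+ m) a₁) (PK.⊛-cong c₁ w²))
                 (P.trans (homogenize-⊛ g g₂ t t₂) (PK.⊛-cong hg≃ h₂)))

  -- x^(3ⁿ) by repeated cubing, the shape in which both `homogenize-cubic-⊚` and `spread` produce
  -- it.
  w^ : ℕ → PK.Poly
  w^ zero    = X
  w^ (suc n) = w^ n ⊛ w^ n ⊛ w^ n

  X^3^ : ∀ n → X ^ₚ (3 ℕ.^ n) ≃ w^ n
  X^3^ zero    = P.*-identityʳ X
  X^3^ (suc n) = begin
    X ^ₚ (m ℕ.+ (m ℕ.+ (m ℕ.+ 0)))             ≈⟨ ^-homo-* X m _ ⟩
    X ^ₚ m ⊛ X ^ₚ (m ℕ.+ (m ℕ.+ 0))            ≈⟨ P.*-congˡ {X ^ₚ m} (^-homo-* X m _) ⟩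
    X ^ₚ m ⊛ (X ^ₚ m ⊛ X ^ₚ (m ℕ.+ 0))
      ≈⟨ P.*-congˡ {X ^ₚ m} (P.*-congˡ {X ^ₚ m} (P.reflexive (≡.cong (X ^ₚ_) (ℕ.+-identityʳ m)))) ⟩
    X ^ₚ m ⊛ (X ^ₚ m ⊛ X ^ₚ m)                 ≈⟨ P.*-assoc (X ^ₚ m) (X ^ₚ m) (X ^ₚ m) ⟨
    X ^ₚ m ⊛ X ^ₚ m ⊛ X ^ₚ m                   ≈⟨ PK.⊛-cong (PK.⊛-cong (X^3^ n) (X^3^ n)) (X^3^ n) ⟩
    w^ n ⊛ w^ n ⊛ w^ n                         ∎
    where
    open Relation.Binary.Reasoning.Setoid P.setoid
    m = 3 ℕ.^ n

  homogenize-iterate : ∀ n → homogenize (3 ℕ.^ n) (iterate n) ≃ trinomial (w^ n)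
  homogenize-iterate zero = begin
    const F.0# ⊛ X ^ₚ 1 ⊕ Z ⊛ const F.1#
      ≈⟨ PK.⊕-cong (P.*-congʳ {X ^ₚ 1} const.0#-homo) (P.*-congˡ {Z} const.1#-homo) ⟩
    Z ⊛ (K.1# ∷ [])                          ≈⟨ P.*-identityʳ Z ⟩
    Z                                        ∎
    where open Relation.Binary.Reasoning.Setoid P.setoid
  homogenize-iterate (suc n) =
    homogenize-cubic-⊚ (iterate n) (w^ n) (Top-iterate n) (X^3^ n) (homogenize-iterate n)

  cubicBinomial-w^ : ∀ n v → A.cubicBinomial n v ≃ w^ n ⊕ ⊖ (v ∷ [])
  cubicBinomial-w^ zero    v = ∷-cong (K.sym (K.+-identityˡ _)) P.refl
  cubicBinomial-w^ (suc n) v = begin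
    B.spread (A.cubicBinomial n v)            ≈⟨ B.spread-cong (cubicBinomial-w^ n v) ⟩
    B.spread (w^ n ⊕ ⊖ (v ∷ []))              ≈⟨ B.spread-⊕ (w^ n) (⊖ (v ∷ [])) ⟩
    B.spread (w^ n) ⊕ (K.- v ∷ K.0# ∷ K.0# ∷ [])
      ≈⟨ PK.⊕-cong (spread-w^ n) (∷-cong K.refl (B.0∷0∷ 0∷[])) ⟩
    w^ (suc n) ⊕ ⊖ (v ∷ [])                   ∎
    where
    open Relation.Binary.Reasoning.Setoid P.setoid
    spread-w^ : ∀ n → B.spread (w^ n) ≃ w^ (suc n)
    spread-w^ zero    = B.spread-X
    spread-w^ (suc n) = P.trans (B.spread-⊛ (w^ n ⊛ w^ n) (w^ n))
      (PK.⊛-cong (P.trans (B.spread-⊛ (w^ n) (w^ n)) (PK.⊛-cong (spread-w^ n) (spread-w^ n)))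
          (spread-w^ n))

  odd-3^ : ∀ n → ∃[ k ] 3 ℕ.^ n ≡ suc (2 ℕ.* k)
  odd-3^ zero    = 0 , ≡.refl
  odd-3^ (suc n) with odd-3^ n
  ... | k , e = suc (3 ℕ.* k) , ≡.trans (≡.cong (3 ℕ.*_) e)
    (ℕS.solve 1 (λ k → ℕS.con 3 ℕS.:* (ℕS.con 1 ℕS.:+ ℕS.con 2 ℕS.:* k)
      ℕS.:= ℕS.con 1 ℕS.:+ ℕS.con 2 ℕS.:* (ℕS.con 1 ℕS.:+ ℕS.con 3 ℕS.:* k)) ≡.refl k)
    where module ℕS = Data.Nat.Solver.+-*-Solver

  d+d≢3^ : ∀ n d → ¬ d ℕ.+ d ≡ 3 ℕ.^ n
  d+d≢3^ n d e = ℕ.even≢odd d (proj₁ (odd-3^ n))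
    (≡.trans (≡.cong (d ℕ.+_) (ℕ.+-identityʳ d)) (≡.trans e (proj₂ (odd-3^ n))))

  ι-≉0 : ∀ {a} → a F.≉ F.0# → ι a K.≉ K.0#
  ι-≉0 a≉0 with PF.inverse a≉0
  ... | b , ab≈1 = PK.invertible⇒≉0 (K.trans (K.sym (ι.*-homo _ b)) (K.trans (ι.⟦⟧-cong ab≈1) ι.1#-homo))

  homogenize-Unit : ∀ {d a} g → a F.≉ F.0# → PF.Top d g a → PK.Unit (homogenize d g) → PF.Unit g
  homogenize-Unit {d} {a} g a≉0 t U with PK.Unit-const U
  ... | b , b≉0 , s = PF.const-Unit a≉0 (≡.subst (λ k → PF.Top k g a)
    (ℕ.m+n≡0⇒m≡0 d (proj₁ (Top-unique (ι-≉0 a≉0) b≉0 (Top-homogenize g t) s))) t)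

  module _ (u+u′≈α : u K.+ u′ K.≈ ι α) (uu′≈1 : u K.* u′ K.≈ K.1#)
           (u-noncube : ∀ v → ¬ v K.^ 3 K.≈ u) (u′-noncube : ∀ v → ¬ v K.^ 3 K.≈ u′) where

    trinomial-factor : ∀ n → trinomial (w^ n) ≃ A.cubicBinomial n u ⊛ A.cubicBinomial n u′
    trinomial-factor n = begin
      w ⊛ w ⊕ ⊖ (const α ⊛ w) ⊕ (K.1# ∷ [])
        ≈⟨ PK.⊕-cong (P.+-congˡ {w ⊛ w} (PK.⊖-cong (P.*-congʳ {w} {const α} {U ⊕ U′} (∷-cong
            (K.sym u+u′≈α) P.refl)))) (∷-cong (K.trans (K.sym uu′≈1) (K.sym (K.+-identityʳ _))) P.refl) ⟩
      w ⊛ w ⊕ ⊖ ((U ⊕ U′) ⊛ w) ⊕ U ⊛ U′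
        ≈⟨ S.solve 3 (λ w u u′ → w S.:* w S.:- (u S.:+ u′) S.:* w S.:+ u S.:* u′
            S.:= (w S.:- u) S.:* (w S.:- u′)) P.refl w U U′ ⟩
      (w ⊕ ⊖ U) ⊛ (w ⊕ ⊖ U′)
        ≈⟨ PK.⊛-cong (cubicBinomial-w^ n u) (cubicBinomial-w^ n u′) ⟨
      A.cubicBinomial n u ⊛ A.cubicBinomial n u′       ∎
      where
      open Relation.Binary.Reasoning.Setoid P.setoid
      w = w^ n
      U = u ∷ []
      U′ = u′ ∷ []

    -- The homogenized factors have even degrees, so neither is associated to the
    -- atom x^(3ⁿ) − u, whose degree is odd.
    divisible-factor : ∀ n {d e a b} g h → a F.≉ F.0# → b F.≉ F.0# → PF.Top d g a → PF.Top e h b →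
      homogenize d g ⊛ homogenize e h ≃ A.cubicBinomial n u ⊛ A.cubicBinomial n u′ →
      A.cubicBinomial n u PK.∣ₚ homogenize d g → PF.Unit h
    divisible-factor n {d} {e} {a} {b} g h a≉0 b≉0 t s GH≃ (q , G≃Pq) =
      -- Cancelling the first binomial leaves q times the homogenization of h equal to the second
      -- binomial, an atom. A unit q would give 2d = 3ⁿ, so the homogenization of h is the unit.
      [ (λ q-Unit → ⊥-elim (q-nonunit q-Unit)) , homogenize-Unit h b≉0 s ]′
        (A′ (P.sym (A.cancel-factor (homogenize e h) (A.cubicBinomial n u′)
            (A.cubicBinomial-≄[] n u) G≃Pq GH≃)))
      where
      A′ = A.cubicBinomial-atom u′-noncube n
      q-nonunit : ¬ PK.Unit q
      q-nonunit q-Unit with PK.Unit-const q-Unit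
      ... | c , c≉0 , q-top = d+d≢3^ n d (≡.trans
        (proj₁ (Top-unique (ι-≉0 a≉0) (PK.*-≉0 PK.1≉0 c≉0) (Top-homogenize g t)
          (Top-resp (P.sym G≃Pq) K.refl (Top-⊛ (A.cubicBinomial n u) q (A.Top-cubicBinomial n u) q-top))))
        (ℕ.+-identityʳ (3 ℕ.^ n)))

    iterate-nonzero : ∀ n → ¬ iterate n PF.≃ []
    iterate-nonzero n = PF.Top⇒≄[] PF.1≉0 (Top-iterate n)

    -- The prime x^(3ⁿ) - u divides the homogenization of g or of h; `divisible-factor` then makes
    -- the other polynomial a unit.
    iterate-split : ∀ n g h → iterate n PF.≃ g PF.⊛ h → PF.Unit g ⊎ PF.Unit h
    iterate-split n g h f≃gh with PF.degree g | PF.degree h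
    ... | inj₁ g≃[] | _ = ⊥-elim (iterate-nonzero n (RF.trans f≃gh (RF.*-congʳ {h} g≃[])))
    ... | inj₂ _ | inj₁ h≃[] =
        ⊥-elim (iterate-nonzero n (RF.trans f≃gh (RF.trans (RF.*-congˡ {g} h≃[]) (PF.⊛-zeroʳ g))))
    ... | inj₂ (d , a , a≉0 , t) | inj₂ (e , b , b≉0 , s) =
      [ (λ P∣G → inj₂ (divisible-factor n g h a≉0 b≉0 t s GH≃ P∣G))
      , (λ P∣H → inj₁ (divisible-factor n h g b≉0 a≉0 s t (P.trans (P.*-comm H G) GH≃) P∣H)) ]′
      (PK.atom⇒prime (A.cubicBinomial-atom u-noncube n) G H (A.cubicBinomial n u′ , GH≃))
      where
      G = homogenize d g
      H = homogenize e h
      d+e≡3^n : d ℕ.+ e ≡ 3 ℕ.^ n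
      d+e≡3^n = proj₁ (PF.Top-unique (PF.*-≉0 a≉0 b≉0) PF.1≉0 (PF.Top-⊛ g h t s) (PF.Top-resp f≃gh
          F.refl (Top-iterate n)))
      GH≃ : G ⊛ H ≃ A.cubicBinomial n u ⊛ A.cubicBinomial n u′
      GH≃ = begin
        G ⊛ H                                    ≈⟨ homogenize-⊛ g h t s ⟨
        homogenize (d ℕ.+ e) (g PF.⊛ h)          ≈⟨ homogenize-cong (d ℕ.+ e) f≃gh ⟨
        homogenize (d ℕ.+ e) (iterate n)         ≡⟨ ≡.cong (λ k → homogenize k (iterate n)) d+e≡3^n ⟩
        homogenize (3 ℕ.^ n) (iterate n)         ≈⟨ homogenize-iterate n ⟩
        trinomial (w^ n)                         ≈⟨ trinomial-factor n ⟩
        A.cubicBinomial n u ⊛ A.cubicBinomial n u′ ∎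
        where open Relation.Binary.Reasoning.Setoid P.setoid

    iterate-nonunit : ∀ n → ¬ PF.Unit (iterate n)
    iterate-nonunit n U with PF.Unit-const U
    ... | a , a≉0 , t = ℕ.<⇒≢ (1≤3^ n) (proj₁ (PF.Top-unique a≉0 PF.1≉0 t (Top-iterate n)))

    dynamically-irreducible : PF.DynamicallyIrreducible (cubic α)
    dynamically-irreducible = (3 , s≤s (s≤s z≤n) , PF.1≉0) , λ n _ → mkIrred
      (λ { record { quotient = g ; equality = e } → iterate-nonunit n (g , PF.ext e) })
      (λ {g} {h} e → Sum.map from-Unit from-Unit (iterate-split n g h (PF.ext e)))
      where
      open Algebra.Definitions.RawSemiring PF.polyRawSemiring using (mkIrred; _∣_)
      from-Unit : ∀ {g} → PF.Unit g → g ∣ (F.1# ∷ [])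
      from-Unit (k , PF.ext e) = record { quotient = k ; equality = e }

-- Finite fields: characteristic, squares and roots of D(z) = α

-- Punching out a missed value would leave an injection from `Fin (suc n)` into `Fin n`.
injective⇒surjective : ∀ {n} (f : Fin n → Fin n) → Injective _≡_ _≡_ f → ∀ y → ∃[ x ] f x ≡ y
injective⇒surjective {suc n} f f-inj y with Fin.any? (λ x → f x Fin.≟ y)
... | yes hit = hit
... | no miss = ⊥-elim (ℕ.1+n≰n (Fin.injective⇒≤ {f = λ x → punchOut (y≢f x)}
                  (λ {x} {x′} e → f-inj (Fin.punchOut-injective (y≢f x) (y≢f x′) e))))
  where
  y≢f : ∀ x → y ≢ f x
  y≢f x y≡fx = miss (x , ≡.sym y≡fx)

3∣p^s⇒p≡3 : ∀ p s → Prime p → 3 ℕ.∣ p ℕ.^ s → p ≡ 3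
3∣p^s⇒p≡3 p zero p-prime 3∣1 with ∣1⇒≡1 3∣1
... | ()
3∣p^s⇒p≡3 p (suc s) p-prime 3∣p^1+s with euclidsLemma p (p ℕ.^ s) (from-yes (prime? 3)) 3∣p^1+s
... | inj₂ 3∣p^s = 3∣p^s⇒p≡3 p s p-prime 3∣p^s
... | inj₁ 3∣p with prime⇒irreducible p-prime 3∣p
...   | inj₂ 3≡p = ≡.sym 3≡p

module FiniteField {c ℓ₁ ℓ₂ : Level} (F : HeytingField c ℓ₁ ℓ₂) (q : ℕ) (F-finite : HasCardinality F q) where

  open Field F
  open HeytingFieldProperties F
  private
    module S = IntegerCoefficients commutativeRing
    module I = Inverse F-finite
  open I using (to; from)
  open Relation.Binary.Reasoning.Setoid setoid

  to-injective : ∀ {x y} → to x ≡ to y → x ≈ y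
  to-injective {x} {y} e = begin
    x              ≈⟨ I.strictlyInverseʳ x ⟨
    from (to x)    ≡⟨ ≡.cong from e ⟩
    from (to y)    ≈⟨ I.strictlyInverseʳ y ⟩
    y              ∎

  _≈?_ : ∀ x y → Dec (x ≈ y)
  x ≈? y = map′ to-injective I.to-cong (to x Fin.≟ to y)

  search : ∀ {p} {P : Carrier → Set p} → (∀ {x y} → x ≈ y → P x → P y) → (∀ x → Dec (P x)) → Dec
      (∃[ x ] P x)
  search P-resp P? = map′ (λ { (i , Pi) → from i , Pi })
    (λ { (x , Px) → to x , P-resp (sym (I.strictlyInverseʳ x)) Px }) (Fin.any? (λ i → P? (from i)))

  -- All candidates are tried. If none inverts x, then x cannot be apart from zero, and tightness
  -- makes it zero.
  inverse : ∀ {x} → x ≉ 0# → ∃[ y ] x * y ≈ 1#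
  inverse {x} x≉0 with search (λ y≈y′ → trans (*-congˡ (sym y≈y′))) (λ y → (x * y) ≈? 1#)
  ... | yes found = found
  ... | no none = ⊥-elim (x≉0 (proj₁ (tight x 0#) λ x#0 → none (invert (#⇒invertible x#0))))
    where
    invert : ∃[ y ] (y * (x - 0#) ≈ 1# × (x - 0#) * y ≈ 1#) → ∃[ y ] x * y ≈ 1#
    invert (y , _ , e) = y , trans (*-congʳ (S.solve 1 (λ x → x S.:= x S.:- S.con (+ 0)) refl x)) e

  discrete : IsDiscreteField F
  discrete = record { _≈?_ = _≈?_ ; inverse = inverse }

  open DiscretePolynomials F discrete hiding (_≈?_; inverse; 1≉0; invertible⇒≉0)
  open CubicPolynomial F

  surjective : (f : Carrier → Carrier) → (∀ {x y} → x ≈ y → f x ≈ f y) → (∀ {x y} → f x ≈ f y → x ≈ y) →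
    ∀ y → ∃[ x ] f x ≈ y
  surjective f f-cong f-inj y with injective⇒surjective (to ∘ f ∘ from) to∘f∘from-inj (to y)
    where
    to∘f∘from-inj : Injective _≡_ _≡_ (to ∘ f ∘ from)
    to∘f∘from-inj {i} {j} e = ≡.trans (≡.sym (I.strictlyInverseˡ i))
      (≡.trans (I.to-cong (f-inj (to-injective e))) (I.strictlyInverseˡ j))
  ... | i , e = from i , to-injective e

  -- Translation by 1 permutes the field, so Σ x = Σ (x + 1) = Σ x + q · 1.
  q·1≈0 : q · 1# ≈ 0#
  q·1≈0 = begin
    q · 1#                         ≈⟨ S.solve 2 (λ s t → t
        S.:= (s S.:+ t) S.:- s) refl (sum from) (q · 1#) ⟩
    (sum from + q · 1#) - sum from ≈⟨ +-congʳ shifted ⟨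
    sum from - sum from            ≈⟨ -‿inverseʳ _ ⟩
    0#                             ∎
    where
    open Algebra.Properties.CommutativeMonoid.Sum (CommutativeRing.+-commutativeMonoid commutativeRing)
    shift : Carrier → Fin q → Fin q
    shift a i = to (from i + a)
    unshift : ∀ a b → a + b ≈ 0# → ∀ i → shift b (shift a i) ≡ i
    unshift a b a+b≈0 i = ≡.trans (I.to-cong (begin
      from (to (from i + a)) + b  ≈⟨ +-congʳ (I.strictlyInverseʳ _) ⟩
      from i + a + b              ≈⟨ +-assoc _ _ _ ⟩
      from i + (a + b)            ≈⟨ +-congˡ a+b≈0 ⟩
      from i + 0#                 ≈⟨ +-identityʳ _ ⟩
      from i                      ∎)) (I.strictlyInverseˡ i)
    translation : Permutation q q
    translation = permutation (shift 1#) (shift (- 1#)) (unshift (- 1#) 1# (-‿inverseˡ 1#)) (unshift 1#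
        (- 1#) (-‿inverseʳ 1#))
    shifted : sum from ≈ sum from + q · 1#
    shifted = begin
      sum from                                   ≈⟨ sum-permute from translation ⟩
      sum (λ i → from (to (from i + 1#)))        ≈⟨ sum-cong-≋ (λ i → I.strictlyInverseʳ (from i + 1#)) ⟩
      sum (λ i → from i + 1#)                    ≈⟨ ∑-distrib-+ from (λ _ → 1#) ⟩
      sum from + sum {q} (λ _ → 1#)              ≈⟨ +-congˡ (sum-replicate q) ⟩
      sum from + q · 1#                          ∎

  -- If 3 vanished, `q·1≈0` would make the residue of q modulo 3 vanish as well. Residue 0 is
  -- excluded, residue 1 says 1 = 0, and residue 2 says it through 1 = 3 - 2.
  3≉0 : ¬ 3 ℕ.∣ q → 3 · 1# ≉ 0#
  3≉0 3∤q 3≈0 = by-remainder (q % 3) (m%n<n q 3) (m≡m%n+[m/n]*n q 3)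
    where
    3k·1≈0 : ∀ k → (k ℕ.* 3) · 1# ≈ 0#
    3k·1≈0 zero    = refl
    3k·1≈0 (suc k) = begin
      1# + (1# + (1# + (k ℕ.* 3) · 1#))
        ≈⟨ S.solve 1 (λ x → S.con (+ 1) S.:+ (S.con (+ 1) S.:+ (S.con (+ 1) S.:+ x))
            S.:= (3 S.:× S.con (+ 1)) S.:+ x) refl ((k ℕ.* 3) · 1#) ⟩
      3 · 1# + (k ℕ.* 3) · 1#             ≈⟨ +-cong 3≈0 (3k·1≈0 k) ⟩
      0# + 0#                             ≈⟨ +-identityʳ 0# ⟩
      0#                                  ∎
    t = (q / 3 ℕ.* 3) · 1#
    by-remainder : ∀ r → r ℕ.< 3 → q ≡ r ℕ.+ q / 3 ℕ.* 3 → ⊥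
    by-remainder 0 _ e = 3∤q (divides (q / 3) e)
    by-remainder 1 _ e = 1≉0 (begin
      1#             ≈⟨ +-identityʳ 1# ⟨
      1# + 0#        ≈⟨ +-congˡ (3k·1≈0 (q / 3)) ⟨
      1# + t         ≡⟨ ≡.cong (_· 1#) e ⟨
      q · 1#         ≈⟨ q·1≈0 ⟩
      0#             ∎)
    by-remainder 2 _ e = 1≉0 (begin
      1#                                  ≈⟨ S.solve 1 (λ t → S.con (+ 1)
          S.:= 3 S.:× S.con (+ 1) S.:- (S.con (+ 1) S.:+ (S.con (+ 1) S.:+ t)) S.:+ t) refl t ⟩
      3 · 1# - (1# + (1# + t)) + t
        ≈⟨ +-cong (+-cong 3≈0 (-‿cong (trans (reflexive (≡.sym (≡.cong (_· 1#) e))) q·1≈0))) (3k·1≈0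
            (q / 3)) ⟩
      0# - 0# + 0#                        ≈⟨ S.solve 0 (S.con (+ 0) S.:- S.con (+ 0) S.:+ S.con (+ 0)
          S.:= S.con (+ 0)) refl ⟩
      0#                                  ∎)
    by-remainder (suc (suc (suc _))) (s≤s (s≤s (s≤s ()))) _

  IsSquare : Carrier → Set (c ⊔ ℓ₁)
  IsSquare x = ∃[ y ] y ^ 2 ≈ x

  IsSquare-resp : ∀ {x y} → x ≈ y → IsSquare x → IsSquare y
  IsSquare-resp e (z , p) = z , trans p e

  square? : ∀ x → Dec (IsSquare x)
  square? x = search (λ y≈y′ → trans (*-cong (sym y≈y′) (*-congʳ (sym y≈y′)))) (λ y → (y ^ 2) ≈? x)

  IsSquare-cancel : ∀ {x} y → y ≉ 0# → IsSquare (x * y ^ 2) → IsSquare x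
  IsSquare-cancel {x} y y≉0 (z , z²≈xy²) with inverse y≉0
  ... | w , yw≈1 = z * w , (begin
    (z * w) ^ 2              ≈⟨ S.solve 2 (λ z w → (z S.:* w) S.:^ 2
        S.:= z S.:^ 2 S.:* w S.:^ 2) refl z w ⟩
    z ^ 2 * w ^ 2            ≈⟨ *-congʳ z²≈xy² ⟩
    x * y ^ 2 * w ^ 2        ≈⟨ S.solve 3 (λ x y w → x S.:* y S.:^ 2 S.:* w S.:^ 2
        S.:= x S.:* (y S.:* w) S.:^ 2) refl x y w ⟩
    x * (y * w) ^ 2          ≈⟨ *-congˡ (*-cong yw≈1 (*-congʳ yw≈1)) ⟩
    x * 1# ^ 2               ≈⟨ S.solve 1 (λ x → x S.:* S.con (+ 1) S.:^ 2 S.:= x) refl x ⟩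
    x                        ∎)

  x-y≈0⇒x≈y : ∀ {x y} → x - y ≈ 0# → x ≈ y
  x-y≈0⇒x≈y {x} {y} e = begin
    x              ≈⟨ S.solve 2 (λ x y → x S.:= (x S.:- y) S.:+ y) refl x y ⟩
    (x - y) + y    ≈⟨ +-congʳ e ⟩
    0# + y         ≈⟨ +-identityˡ y ⟩
    y              ∎

  dickson : Carrier → Carrier
  dickson z = z ^ 3 - 3 · z

  dickson-cong : ∀ {x y} → x ≈ y → dickson x ≈ dickson y
  dickson-cong e = +-cong (*-cong e (*-cong e (*-congʳ e))) (-‿cong (+-cong e (+-cong e (+-congʳ e))))

  -- The discriminant of z³ - 3z - t is -27(t² - 4), which is 9 times this value.
  discriminant : Carrier → Carrier
  discriminant t = - (3 · 1#) * (t ^ 2 - 4 · 1#)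

  discriminant-cong : ∀ {x y} → x ≈ y → discriminant x ≈ discriminant y
  discriminant-cong e = *-congˡ (+-congʳ (*-cong e (*-congʳ e)))

  -- For z = y + 1/y one has z² - 4 = (y - 1/y)² and D(z)² - 4 = (y³ - 1/y³)². Their quotient is the
  -- square of y² + 1 + 1/y² = z² - 1.
  discriminant-dickson : ∀ z → discriminant (dickson z) ≈ discriminant z * (z ^ 2 - 1#) ^ 2
  discriminant-dickson = S.solve 1 (λ z →
    let disc = λ t → S.:- (3 S.:× S.con (+ 1)) S.:* (t S.:^ 2 S.:- 4 S.:× S.con (+ 1))
    in disc (z S.:^ 3 S.:- 3 S.:× z) S.:= disc z S.:* (z S.:^ 2 S.:- S.con (+ 1)) S.:^ 2) refl

  discriminant-dickson-nonsquare : ∀ {z} → ¬ IsSquare (discriminant z) → ¬ IsSquare (discriminant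
      (dickson z))
  discriminant-dickson-nonsquare {z} nonsq sq with (z ^ 2 - 1#) ≈? 0#
  ... | no z²≉1 = nonsq (IsSquare-cancel (z ^ 2 - 1#) z²≉1 (IsSquare-resp (discriminant-dickson z) sq))
  -- For z² = 1 the value -3(z² - 4) is 9, the square of 3.
  ... | yes z²≈1 = nonsq (3 · 1# , (begin
    (3 · 1#) ^ 2                     ≈⟨ S.solve 1
        (λ z → let three = 3 S.:× S.con (+ 1) in three S.:^ 2 S.:=
                                          S.:- three S.:* ((z S.:^ 2 S.:- 4 S.:× S.con (+ 1)) S.:-
                                              (z S.:^ 2 S.:- S.con (+ 1)))) refl z ⟩
    - (3 · 1#) * ((z ^ 2 - 4 · 1#) - (z ^ 2 - 1#))   ≈⟨ *-congˡ (+-congˡ (-‿cong z²≈1)) ⟩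
    - (3 · 1#) * ((z ^ 2 - 4 · 1#) - 0#)             ≈⟨ S.solve 1 (λ z → let three = 3 S.:× S.con (+ 1) in
                                          S.:- three S.:* ((z S.:^ 2 S.:- 4 S.:× S.con (+ 1)) S.:- S.con
                                              (+ 0)) S.:= S.:- three S.:* (z S.:^ 2 S.:- 4 S.:× S.con
                                              (+ 1))) refl z ⟩
    discriminant z                   ∎))

  -- The cofactor of x − y in D(x) − D(y) has discriminant −3(x² − 4) as a polynomial in y.
  dickson-injective : ∀ {x y} → ¬ IsSquare (discriminant x) → dickson x ≈ dickson y → x ≈ y
  dickson-injective {x} {y} nonsq e with (x - y) ≈? 0#
  ... | yes x-y≈0 = x-y≈0⇒x≈y x-y≈0
  -- Completing the square in y: once the cofactor vanishes, (2y + x)² equals its discriminant.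
  ... | no x-y≉0 = ⊥-elim (nonsq (2 · y + x , (begin
    (2 · y + x) ^ 2                        ≈⟨ S.solve 2 (λ x y → (2 S.:× y S.:+ x) S.:^ 2 S.:=
                                                (S.:- (3 S.:× S.con (+ 1)) S.:*
                                                    (x S.:^ 2 S.:- 4 S.:× S.con (+ 1))) S.:+ 4 S.:×
                                                    (x S.:^ 2 S.:+ x S.:* y S.:+ y S.:^ 2 S.:- 3 S.:×
                                                    S.con (+ 1))) refl x y ⟩
    discriminant x + 4 · cofactor
      ≈⟨ +-congˡ (+-cong cofactor≈0 (+-cong cofactor≈0 (+-cong cofactor≈0 (+-congʳ cofactor≈0)))) ⟩
    discriminant x + 4 · 0#
      ≈⟨ S.solve 1 (λ d → d S.:+ 4 S.:× S.con (+ 0) S.:= d) refl (discriminant x) ⟩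
    discriminant x                         ∎)))
    where
    cofactor = x ^ 2 + x * y + y ^ 2 - 3 · 1#
    cofactor≈0 : cofactor ≈ 0#
    cofactor≈0 = *-cancel-0 x-y≉0 (begin
      (x - y) * cofactor         ≈⟨ S.solve 2 (λ x y → (x S.:- y) S.:*
          (x S.:^ 2 S.:+ x S.:* y S.:+ y S.:^ 2 S.:- 3 S.:× S.con (+ 1))
                                      S.:= (x S.:^ 3 S.:- 3 S.:× x) S.:- (y S.:^ 3 S.:- 3 S.:× y))
                                          refl x y ⟩
      dickson x - dickson y      ≈⟨ +-congʳ e ⟩
      dickson y - dickson y      ≈⟨ -‿inverseʳ _ ⟩
      0#                         ∎)

  -- D maps {x : −3(x² − 4) is not a square} injectively to itself, hence onto itself.
  dickson-root : ∀ {a} → ¬ IsSquare (discriminant a) → ∃[ z ] dickson z ≈ a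
  dickson-root {a} nonsq = hit (surjective f f-cong f-injective a)
    where
    -- Extending D by the identity on the remaining elements gives an injection on all of F. The
    -- decision is an explicit argument so that two of them can be compared case by case.
    f-by : ∀ x → Dec (IsSquare (discriminant x)) → Carrier
    f-by x (yes _) = x
    f-by x (no _)  = dickson x
    f : Carrier → Carrier
    f x = f-by x (square? (discriminant x))
    f-by-cong : ∀ {x y} → x ≈ y → ∀ p r → f-by x p ≈ f-by y r
    f-by-cong e (yes _) (yes _) = e
    f-by-cong e (no _)  (no _)  = dickson-cong e
    f-by-cong e (yes p) (no ¬p) = ⊥-elim (¬p (IsSquare-resp (discriminant-cong e) p))
    f-by-cong e (no ¬p) (yes p) = ⊥-elim (¬p (IsSquare-resp (discriminant-cong (sym e)) p))
    f-cong : ∀ {x y} → x ≈ y → f x ≈ f y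
    f-cong {x} {y} e = f-by-cong e (square? (discriminant x)) (square? (discriminant y))
    f-by-injective : ∀ {x y} p r → f-by x p ≈ f-by y r → x ≈ y
    f-by-injective (yes _) (yes _) e = e
    f-by-injective (no ¬p) (no _)  e = dickson-injective ¬p e
    f-by-injective (yes p) (no ¬p) e =
        ⊥-elim (discriminant-dickson-nonsquare ¬p (IsSquare-resp (discriminant-cong e) p))
    f-by-injective (no ¬p) (yes p) e =
        ⊥-elim (discriminant-dickson-nonsquare ¬p (IsSquare-resp (discriminant-cong (sym e)) p))
    f-injective : ∀ {x y} → f x ≈ f y → x ≈ y
    f-injective {x} {y} = f-by-injective (square? (discriminant x)) (square? (discriminant y))
    hit-by : ∀ x p → f-by x p ≈ a → ∃[ z ] dickson z ≈ a
    hit-by x (no _)  e = x , e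
    hit-by x (yes p) e = ⊥-elim (nonsq (IsSquare-resp (discriminant-cong e) p))
    hit : ∃[ x ] f x ≈ a → ∃[ z ] dickson z ≈ a
    hit (x , e) = hit-by x (square? (discriminant x)) e

  -3# : Carrier
  -3# = - (3 · 1#)

  -3≉0 : 3 · 1# ≉ 0# → -3# ≉ 0#
  -3≉0 3≉0 e = 3≉0 (begin
    3 · 1#           ≈⟨ S.solve 0 (3 S.:× S.con (+ 1) S.:= S.:- (S.:- (3 S.:× S.con (+ 1)))) refl ⟩
    - -3#            ≈⟨ -‿cong e ⟩
    - 0#             ≈⟨ S.solve 0 (S.:- S.con (+ 0) S.:= S.con (+ 0)) refl ⟩
    0#               ∎)

  ^2-≉0 : ∀ {a b} → a ^ 2 ≈ b → b ≉ 0# → a ≉ 0#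
  ^2-≉0 a²≈b b≉0 a≈0 = b≉0 (trans (sym a²≈b) (trans (*-congʳ a≈0) (zeroˡ _)))

  a*a≈0⇒a≈0 : ∀ {a} → a * a ≈ 0# → a ≈ 0#
  a*a≈0⇒a≈0 {a} e with a ≈? 0#
  ... | yes a≈0 = a≈0
  ... | no a≉0  = *-cancel-0 a≉0 e

  -- The norm of a + b √−3.
  N : Carrier → Carrier → Carrier
  N a b = a * a + 3 · 1# * (b * b)

  -- A zero with b ≠ 0 would give -3 = (a/b)².
  N-anisotropic : ¬ IsSquare -3# → ∀ a b → N a b ≈ 0# → a ≈ 0# × b ≈ 0#
  N-anisotropic ¬sq a b e with b ≈? 0#
  ... | yes b≈0 = a*a≈0⇒a≈0 (begin
      a * a                              ≈⟨ S.solve 2 (λ a b → a S.:* a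
          S.:= (a S.:* a S.:+ 3 S.:× S.con (+ 1) S.:* (b S.:* b)) S.:- 3 S.:× S.con (+ 1) S.:* (b S.:* b))
          refl a b ⟩
      N a b - 3 · 1# * (b * b)           ≈⟨ +-cong e (-‿cong (*-congˡ (*-congʳ b≈0))) ⟩
      0# - 3 · 1# * (0# * b)
        ≈⟨ S.solve 1 (λ b → S.con (+ 0) S.:- 3 S.:× S.con (+ 1) S.:* (S.con (+ 0) S.:* b)
            S.:= S.con (+ 0)) refl b ⟩
      0#                                 ∎) , b≈0
  ... | no b≉0 = ⊥-elim (¬sq (IsSquare-cancel b b≉0 (a , (begin
      a ^ 2                              ≈⟨ S.solve 2 (λ a b → a S.:^ 2
          S.:= (a S.:* a S.:+ 3 S.:× S.con (+ 1) S.:* (b S.:* b)) S.:+ S.:- (3 S.:× S.con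
          (+ 1)) S.:* b S.:^ 2) refl a b ⟩
      N a b + -3# * b ^ 2                ≈⟨ +-congʳ e ⟩
      0# + -3# * b ^ 2                   ≈⟨ +-identityˡ _ ⟩
      -3# * b ^ 2                        ∎))))

  -- D(a + b √−3) − α = realPart + imaginaryPart · √−3
  realPart : Carrier → Carrier → Carrier → Carrier
  realPart α a b = a ^ 3 - 3 · 1# * (3 · 1#) * (a * b ^ 2) - 3 · 1# * a - α

  imaginaryPart : Carrier → Carrier → Carrier
  imaginaryPart a b = 3 · 1# * (b * (a ^ 2 - b ^ 2 - 1#))

  -- If b ≠ 0 then a² − b² = 1, and the sum of the roots a ± b √−3, −2a of D(z) = α is 0.
  rational-root : 3 · 1# ≉ 0# → ∀ {α} a b → realPart α a b ≈ 0# → imaginaryPart a b ≈ 0# → ∃[ z ] dickson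
      z ≈ α
  rational-root 3≉0 {α} a b re≈0 im≈0 with b ≈? 0#
  ... | yes b≈0 = a , (begin
      dickson a                                               ≈⟨ S.solve 3
          (λ α a b → let three = 3 S.:× S.con (+ 1) in a S.:^ 3 S.:- 3 S.:× a S.:=
                                                                   (a S.:^ 3 S.:- three S.:* three S.:*
                                                                       (a S.:* b S.:^ 2) S.:- three S.:* a
                                                                       S.:- α) S.:+ α S.:+ three S.:*
                                                                       three S.:* (a S.:* b) S.:* b)
                                                                       refl α a b ⟩
      realPart α a b + α + 3 · 1# * (3 · 1#) * (a * b) * b    ≈⟨ +-cong (+-congʳ re≈0) (*-congˡ b≈0) ⟩
      0# + α + 3 · 1# * (3 · 1#) * (a * b) * 0#
        ≈⟨ S.solve 2 (λ α c → S.con (+ 0) S.:+ α S.:+ c S.:* S.con (+ 0) S.:= α) refl α _ ⟩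
      α                                                       ∎)
  ... | no b≉0 = - (2 · a) , (begin
      dickson (- (2 · a))                                     ≈⟨ S.solve 3
          (λ α a b → let three = 3 S.:× S.con (+ 1) in (S.:- (2 S.:× a)) S.:^ 3 S.:- 3 S.:× (S.:-
          (2 S.:× a)) S.:=
                                                                   (a S.:^ 3 S.:- three S.:* three S.:*
                                                                       (a S.:* b S.:^ 2) S.:- three S.:* a
                                                                       S.:- α) S.:+ α S.:- three S.:*
                                                                       three S.:* a S.:* (a S.:^ 2 S.:- b
                                                                       S.:^ 2 S.:- S.con (+ 1)))
                                                                       refl α a b ⟩
      realPart α a b + α - 3 · 1# * (3 · 1#) * a * (a ^ 2 - b ^ 2 - 1#)
        ≈⟨ +-cong (+-congʳ re≈0) (-‿cong (*-congˡ (*-cancel-0 b≉0 (*-cancel-0 3≉0 im≈0)))) ⟩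
      0# + α - 3 · 1# * (3 · 1#) * a * 0#
        ≈⟨ S.solve 2 (λ α c → S.con (+ 0) S.:+ α S.:- c S.:* S.con (+ 0) S.:= α) refl α _ ⟩
      α                                                       ∎)

  private
    module P = CommutativeRing polyRing
    module B = CubicBinomials F discrete

  ⊚-X : ∀ f → f ⊚ X ≃ f
  ⊚-X []      = P.refl
  ⊚-X (a ∷ f) = P.trans (P.+-congˡ {a ∷ []} (P.trans (B.X-⊛ (f ⊚ X)) (∷-cong
      refl (⊚-X f)))) (P.sym (∷-as-⊕ a f))

  -- f(x) = D(x + α) - α vanishes at x = z - α. The quadratic factor is the cofactor t² + tz + z² -
  -- 3 of t - z in D(t) - D(z), taken at t = x + α.
  cubic-root-factor : ∀ {α z} → dickson z ≈ α →
    cubic α ≃ (α - z ∷ 1# ∷ []) ⊛ (α ^ 2 + α * z + z ^ 2 - 3 · 1# ∷ 2 · α + z ∷ 1# ∷ [])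
  cubic-root-factor {α} {z} e = ∷-cong (begin
      α ^ 3 - 4 · α                          ≈⟨ S.solve 1 (λ α → α S.:^ 3 S.:- 4 S.:× α
          S.:= α S.:^ 3 S.:- 3 S.:× α S.:- α) refl α ⟩
      α ^ 3 - 3 · α - α                      ≈⟨ +-congˡ (-‿cong e) ⟨
      α ^ 3 - 3 · α - dickson z
        ≈⟨ S.solve 2 (λ α z → α S.:^ 3 S.:- 3 S.:× α S.:- (z S.:^ 3 S.:- 3 S.:× z) S.:=
                                                  (α S.:- z) S.:* (α S.:^ 2 S.:+ α S.:* z S.:+ z S.:^ 2
                                                      S.:- 3 S.:× S.con (+ 1)) S.:+ S.con (+ 0))
                                                      refl α z ⟩
      (α - z) * (α ^ 2 + α * z + z ^ 2 - 3 · 1#) + 0#   ∎)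
    (∷-cong (S.solve 2 (λ α z → 3 S.:× (α S.:^ 2) S.:- 3 S.:× S.con (+ 1) S.:=
        (α S.:- z) S.:* (2 S.:× α S.:+ z) S.:+ (S.con (+ 1) S.:*
            (α S.:^ 2 S.:+ α S.:* z S.:+ z S.:^ 2 S.:- 3 S.:× S.con (+ 1)) S.:+ S.con (+ 0))) refl α z)
    (∷-cong (S.solve 2 (λ α z → 3 S.:× α
        S.:= (α S.:- z) S.:* S.con (+ 1) S.:+ S.con (+ 1) S.:* (2 S.:× α S.:+ z)) refl α z)
    (∷-cong (sym (*-identityˡ 1#)) P.refl)))

  cubic-root⇒reducible : ∀ {α z} → dickson z ≈ α → ¬ Irreducible (cubic α ^∘ 1)
  cubic-root⇒reducible {α} {z} e irr = [ linear-nonunit , quadratic-nonunit ]′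
      (irr.split-∣1 (_≃_.at (P.trans (⊚-X (cubic α)) (cubic-root-factor e))))
    where
    module irr = Algebra.Definitions.RawSemiring.Irreducible irr
    open Algebra.Definitions.RawSemiring polyRawSemiring using (_∤_)
    Top-nonunit : ∀ {n f} → Top (suc n) f 1# → f ∤ (1# ∷ [])
    Top-nonunit t record { quotient = k ; equality = p } with Unit-const (k , ext p)
    ... | a , a≉0 , s with proj₁ (Top-unique a≉0 1≉0 s t)
    ...   | ()
    linear-nonunit = Top-nonunit (Top-∷ (α - z) (Top-const 1#))
    quadratic-nonunit = Top-nonunit (Top-∷ _ (Top-∷ _ (Top-const 1#)))

-- The field F(√-3) inside E and its coordinates over F

module Extension {c ℓ₁ ℓ₂ c′ ℓ₁′ ℓ₂′ : Level} (F : HeytingField c ℓ₁ ℓ₂) (q : ℕ) (F-finite : HasCardinality F q)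
  (E : FieldExtension F c′ ℓ₁′ ℓ₂′)
  (2≉0 : Field._≉_ F (Field._·_ F 2 (Field.1# F)) (Field.0# F)) (3≉0 : Field._≉_ F (Field._·_ F 3
      (Field.1# F)) (Field.0# F))
  (√-3 : FieldExtension.Carrier E)
  (√-3² : FieldExtension._≈_ E (FieldExtension._^_ E √-3 2) (FieldExtension.ι E (Field.-_ F (Field._·_ F 3
      (Field.1# F))))) where

  private
    module F = Field F
    module E = FieldExtension E
    module FF = FiniteField F q F-finite
    module FD = DiscretePolynomials F FF.discrete
    module EP = HeytingFieldProperties E.field′
    module SF = IntegerCoefficients F.commutativeRing
    module S = IntegerCoefficients E.commutativeRing
    module ι = RingMorphisms.IsRingHomomorphism E.isRingHomomorphism
  open E using (ι; _∈K⟨_⟩; base; gen; add; neg; mul; inv; resp; _≈_; _+_; _*_; -_; _-_; 0#; 1#; _·_; _^_)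
  open Relation.Binary.Reasoning.Setoid E.setoid

  ι-minus : ∀ a b → ι (a F.- b) ≈ ι a - ι b
  ι-minus a b = E.trans (ι.+-homo a (F.- b)) (E.+-congˡ (ι.-‿homo b))

  ι-· : ∀ n a → ι (n F.· a) ≈ n · ι a
  ι-· zero    a = ι.0#-homo
  ι-· (suc n) a = E.trans (ι.+-homo a (n F.· a)) (E.+-congˡ (ι-· n a))

  ι-·1 : ∀ n → ι (n F.· F.1#) ≈ n · 1#
  ι-·1 zero    = ι.0#-homo
  ι-·1 (suc n) = E.trans (ι.+-homo F.1# (n F.· F.1#)) (E.+-cong ι.1#-homo (ι-·1 n))

  ι-^ : ∀ a n → ι (a F.^ n) ≈ ι a ^ n
  ι-^ a zero    = ι.1#-homo
  ι-^ a (suc n) = E.trans (ι.*-homo a (a F.^ n)) (E.*-congˡ (ι-^ a n))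

  ι-inverse : ∀ {a b} → a F.* b F.≈ F.1# → ι a * ι b ≈ 1#
  ι-inverse {a} {b} ab≈1 = E.trans (E.sym (ι.*-homo a b)) (E.trans (ι.⟦⟧-cong ab≈1) ι.1#-homo)

  ι-injective-0 : ∀ {a} → ι a ≈ 0# → a F.≈ F.0#
  ι-injective-0 {a} ιa≈0 with a FD.≈? F.0#
  ... | yes a≈0 = a≈0
  ... | no a≉0  = ⊥-elim (EP.invertible⇒≉0 (ι-inverse (proj₂ (FD.inverse a≉0))) ιa≈0)

  ι-injective : ∀ {a b} → ι a ≈ ι b → a F.≈ b
  ι-injective {a} {b} e = FF.x-y≈0⇒x≈y (ι-injective-0 (begin
    ι (a F.- b)   ≈⟨ ι-minus a b ⟩
    ι a - ι b     ≈⟨ E.+-congʳ e ⟩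
    ι b - ι b     ≈⟨ E.-‿inverseʳ _ ⟩
    0#            ∎))

  -- E need not have decidable equality; cotransitivity of apartness decides which factor vanishes.
  zero-product : ∀ {x y w} → x * y ≈ 0# → (x - y) * w ≈ 1# → x ≈ 0# ⊎ y ≈ 0#
  zero-product {x} {y} {w} xy≈0 e
    with E.#-cotrans (E.invertible⇒# (w , E.trans (E.*-comm w _) e , e)) 0#
  ... | inj₁ x#0 = inj₂ (cancel (E.#⇒invertible x#0))
    where
    cancel : ∃[ v ] (v * (x - 0#) ≈ 1# × (x - 0#) * v ≈ 1#) → y ≈ 0#
    cancel (v , p , _) = begin
      y                     ≈⟨ E.*-identityˡ y ⟨
      1# * y                ≈⟨ E.*-congʳ p ⟨
      v * (x - 0#) * y      ≈⟨ S.solve 3 (λ v x y → v S.:* (x S.:- S.con (+ 0)) S.:* y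
          S.:= v S.:* (x S.:* y)) E.refl v x y ⟩
      v * (x * y)           ≈⟨ E.*-congˡ xy≈0 ⟩
      v * 0#                ≈⟨ E.zeroʳ v ⟩
      0#                    ∎
  ... | inj₂ 0#y = inj₁ (cancel (E.#⇒invertible 0#y))
    where
    cancel : ∃[ v ] (v * (0# - y) ≈ 1# × (0# - y) * v ≈ 1#) → x ≈ 0#
    cancel (v , p , _) = begin
      x                     ≈⟨ E.*-identityˡ x ⟨
      1# * x                ≈⟨ E.*-congʳ p ⟨
      v * (0# - y) * x      ≈⟨ S.solve 3 (λ v x y → v S.:* (S.con (+ 0) S.:- y) S.:* x
          S.:= S.:- (v S.:* (x S.:* y))) E.refl v x y ⟩
      - (v * (x * y))       ≈⟨ E.-‿cong (E.*-congˡ xy≈0) ⟩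
      - (v * 0#)            ≈⟨ S.solve 1 (λ v → S.:- (v S.:* S.con (+ 0)) S.:= S.con (+ 0)) E.refl v ⟩
      0#                    ∎

  -- The factors x + a and x - a of x² - a² differ by 2a, whose inverse in F is what `zero-product`
  -- asks for.
  square-roots : ∀ {x a} → a F.≉ F.0# → x ^ 2 ≈ ι a ^ 2 → x ≈ ι a ⊎ x ≈ ι (F.- a)
  square-roots {x} {a} a≉0 e =
      Sum.swap (Sum.map plus minus (zero-product {x + ι a} {x - ι a} {ι w} product≈0 difference))
    where
    w = proj₁ (FD.inverse (FD.*-≉0 2≉0 a≉0))
    2aw≈1 : 2 F.· F.1# F.* a F.* w F.≈ F.1#
    2aw≈1 = proj₂ (FD.inverse (FD.*-≉0 2≉0 a≉0))
    product≈0 : (x + ι a) * (x - ι a) ≈ 0#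
    product≈0 = begin
      (x + ι a) * (x - ι a)
        ≈⟨ S.solve 2 (λ x a → (x S.:+ a) S.:* (x S.:- a) S.:= x S.:^ 2 S.:- a S.:^ 2) E.refl x (ι a) ⟩
      x ^ 2 - ι a ^ 2          ≈⟨ E.+-congʳ e ⟩
      ι a ^ 2 - ι a ^ 2        ≈⟨ E.-‿inverseʳ _ ⟩
      0#                       ∎
    difference : (x + ι a - (x - ι a)) * ι w ≈ 1#
    difference = begin
      (x + ι a - (x - ι a)) * ι w
        ≈⟨ S.solve 3 (λ x a w → (x S.:+ a S.:- (x S.:- a)) S.:* w
            S.:= (2 S.:× S.con (+ 1)) S.:* a S.:* w) E.refl x (ι a) (ι w) ⟩
      2 · 1# * ι a * ι w             ≈⟨ E.*-congʳ (E.trans (ι.*-homo _ a) (E.*-congʳ (ι-·1 2))) ⟨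
      ι (2 F.· F.1# F.* a) * ι w     ≈⟨ ι-inverse 2aw≈1 ⟩
      1#                             ∎
    plus : x + ι a ≈ 0# → x ≈ ι (F.- a)
    plus p = begin
      x                  ≈⟨ S.solve 2 (λ x a → x S.:= (x S.:+ a) S.:- a) E.refl x (ι a) ⟩
      (x + ι a) - ι a    ≈⟨ E.+-congʳ p ⟩
      0# - ι a           ≈⟨ E.+-identityˡ _ ⟩
      - ι a              ≈⟨ ι.-‿homo a ⟨
      ι (F.- a)          ∎
    minus : x - ι a ≈ 0# → x ≈ ι a
    minus p = begin
      x                  ≈⟨ S.solve 2 (λ x a → x S.:= (x S.:- a) S.:+ a) E.refl x (ι a) ⟩
      (x - ι a) + ι a    ≈⟨ E.+-congʳ p ⟩
      0# + ι a           ≈⟨ E.+-identityˡ _ ⟩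
      ι a                ∎

  s = √-3

  s²≈-3 : s * s ≈ - (3 · 1#)
  s²≈-3 = begin
    s * s              ≈⟨ S.solve 1 (λ s → s S.:* s S.:= s S.:^ 2) E.refl s ⟩
    s ^ 2              ≈⟨ √-3² ⟩
    ι FF.-3#              ≈⟨ ι.-‿homo _ ⟩
    - ι (3 F.· F.1#)   ≈⟨ E.-‿cong (ι-·1 3) ⟩
    - (3 · 1#)         ∎

  -3-square? : (∃[ r ] s ≈ ι r) ⊎ ¬ FF.IsSquare FF.-3#
  -3-square? with FF.square? FF.-3#
  ... | no ¬sq = inj₂ ¬sq
  ... | yes (r , r²≈-3) = inj₁ ([ (λ p → r , p) , (λ p → F.- r , p) ]′
    (square-roots (FF.^2-≉0 r²≈-3 (FF.-3≉0 3≉0)) (E.trans √-3² (E.trans (ι.⟦⟧-cong (F.sym r²≈-3))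
        (ι-^ r 2)))))

  ι-N : ∀ a b → (ι a + ι b * s) * (ι a - ι b * s) ≈ ι (FF.N a b)
  ι-N a b = begin
    (ι a + ι b * s) * (ι a - ι b * s)
      ≈⟨ S.solve 3 (λ a b s → (a S.:+ b S.:* s) S.:* (a S.:- b S.:* s)
          S.:= a S.:* a S.:- (s S.:* s) S.:* (b S.:* b)) E.refl (ι a) (ι b) s ⟩
    ι a * ι a - s * s * (ι b * ι b)        ≈⟨ E.+-congˡ (E.-‿cong (E.*-congʳ s²≈-3)) ⟩
    ι a * ι a - - (3 · 1#) * (ι b * ι b)
      ≈⟨ S.solve 2 (λ a b → a S.:* a S.:- (S.:- (3 S.:× S.con (+ 1))) S.:* (b S.:* b)
          S.:= a S.:* a S.:+ 3 S.:× S.con (+ 1) S.:* (b S.:* b)) E.refl (ι a) (ι b) ⟩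
    ι a * ι a + 3 · 1# * (ι b * ι b)
      ≈⟨ E.+-cong (ι.*-homo a a) (E.trans (ι.*-homo _ _) (E.*-cong (ι-·1 3) (ι.*-homo b b))) ⟨
    ι (a F.* a) + ι (3 F.· F.1# F.* (b F.* b))   ≈⟨ ι.+-homo _ _ ⟨
    ι (FF.N a b)                              ∎

  K : E.Carrier → Set (c ⊔ c′ ⊔ ℓ₁′)
  K x = x ∈K⟨ s ⟩

  0∈K : K 0#
  0∈K = resp ι.0#-homo (base F.0#)

  1∈K : K 1#
  1∈K = resp ι.1#-homo (base F.1#)

  infix 4 _≈ᵣ_
  -- A relation rather than a coordinate function, since coordinates are ambiguous when √-3 lies in
  -- F.
  _≈ᵣ_ : E.Carrier → F.Carrier × F.Carrier → Set ℓ₁′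
  x ≈ᵣ (a , b) = x ≈ ι a + ι b * s

  rational : ∀ {x a} → x ≈ ι a → x ≈ᵣ (a , F.0#)
  rational {x} {a} x≈ιa = begin
    x                    ≈⟨ x≈ιa ⟩
    ι a                  ≈⟨ S.solve 2 (λ a s → a S.:= a S.:+ S.con (+ 0) S.:* s) E.refl (ι a) s ⟩
    ι a + 0# * s         ≈⟨ E.+-congˡ (E.*-congʳ ι.0#-homo) ⟨
    ι a + ι F.0# * s     ∎

  ≈ᵣ-+ : ∀ {x y a b a′ b′} → x ≈ᵣ (a , b) → y ≈ᵣ (a′ , b′) → x + y ≈ᵣ (a F.+ a′ , b F.+ b′)
  ≈ᵣ-+ {x} {y} {a} {b} {a′} {b′} p p′ = begin
    x + y                                          ≈⟨ E.+-cong p p′ ⟩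
    (ι a + ι b * s) + (ι a′ + ι b′ * s)
      ≈⟨ S.solve 5 (λ a b a′ b′ s → (a S.:+ b S.:* s) S.:+ (a′ S.:+ b′ S.:* s)
          S.:= (a S.:+ a′) S.:+ (b S.:+ b′) S.:* s) E.refl (ι a) (ι b) (ι a′) (ι b′) s ⟩
    (ι a + ι a′) + (ι b + ι b′) * s
      ≈⟨ E.+-cong (ι.+-homo a a′) (E.*-congʳ (ι.+-homo b b′)) ⟨
    ι (a F.+ a′) + ι (b F.+ b′) * s                ∎

  ≈ᵣ-neg : ∀ {x a b} → x ≈ᵣ (a , b) → - x ≈ᵣ (F.- a , F.- b)
  ≈ᵣ-neg {x} {a} {b} p = begin
    - x                          ≈⟨ E.-‿cong p ⟩
    - (ι a + ι b * s)            ≈⟨ S.solve 3 (λ a b s → S.:- (a S.:+ b S.:* s)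
        S.:= S.:- a S.:+ (S.:- b) S.:* s) E.refl (ι a) (ι b) s ⟩
    - ι a + - ι b * s            ≈⟨ E.+-cong (ι.-‿homo a) (E.*-congʳ (ι.-‿homo b)) ⟨
    ι (F.- a) + ι (F.- b) * s    ∎

  ≈ᵣ-* : ∀ {x y a b a′ b′} → x ≈ᵣ (a , b) → y ≈ᵣ (a′ , b′) →
    x * y ≈ᵣ (a F.* a′ F.- 3 F.· F.1# F.* (b F.* b′) , a F.* b′ F.+ b F.* a′)
  ≈ᵣ-* {x} {y} {a} {b} {a′} {b′} p p′ = begin
    x * y                                                     ≈⟨ E.*-cong p p′ ⟩
    (ι a + ι b * s) * (ι a′ + ι b′ * s)
      ≈⟨ S.solve 5 (λ a b a′ b′ s → (a S.:+ b S.:* s) S.:* (a′ S.:+ b′ S.:* s)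
          S.:= (a S.:* a′ S.:+ (s S.:* s) S.:* (b S.:* b′)) S.:+ (a S.:* b′ S.:+ b S.:* a′) S.:* s)
          E.refl (ι a) (ι b) (ι a′) (ι b′) s ⟩
    (ι a * ι a′ + s * s * (ι b * ι b′)) + (ι a * ι b′ + ι b * ι a′) * s
      ≈⟨ E.+-congʳ (E.+-congˡ (E.*-congʳ s²≈-3)) ⟩
    (ι a * ι a′ + - (3 · 1#) * (ι b * ι b′)) + (ι a * ι b′ + ι b * ι a′) * s
      ≈⟨ E.+-congʳ (E.+-congˡ (S.solve 1 (λ x → S.:- (3 S.:× S.con (+ 1)) S.:* x
          S.:= S.:- (3 S.:× S.con (+ 1) S.:* x)) E.refl (ι b * ι b′))) ⟩
    (ι a * ι a′ - 3 · 1# * (ι b * ι b′)) + (ι a * ι b′ + ι b * ι a′) * s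
      ≈⟨ E.+-cong re (E.*-congʳ im) ⟨
    ι (a F.* a′ F.- 3 F.· F.1# F.* (b F.* b′)) + ι (a F.* b′ F.+ b F.* a′) * s   ∎
    where
    re : ι (a F.* a′ F.- 3 F.· F.1# F.* (b F.* b′)) ≈ ι a * ι a′ - 3 · 1# * (ι b * ι b′)
    re = E.trans (ι-minus _ _) (E.+-cong (ι.*-homo a a′) (E.-‿cong (E.trans (ι.*-homo _ _) (E.*-cong
        (ι-·1 3) (ι.*-homo b b′)))))
    im : ι (a F.* b′ F.+ b F.* a′) ≈ ι a * ι b′ + ι b * ι a′
    im = E.trans (ι.+-homo _ _) (E.+-cong (ι.*-homo a b′) (ι.*-homo b a′))

  inverse-unique : ∀ {x y z} → x * y ≈ 1# → x * z ≈ 1# → y ≈ z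
  inverse-unique {x} {y} {z} xy≈1 xz≈1 = begin
    y              ≈⟨ E.*-identityʳ y ⟨
    y * 1#         ≈⟨ E.*-congˡ xz≈1 ⟨
    y * (x * z)    ≈⟨ S.solve 3 (λ x y z → y S.:* (x S.:* z) S.:= x S.:* y S.:* z) E.refl x y z ⟩
    x * y * z      ≈⟨ E.*-congʳ xy≈1 ⟩
    1# * z         ≈⟨ E.*-identityˡ z ⟩
    z              ∎

  module Rational (r : F.Carrier) (s≈ιr : s ≈ ι r) where

    collapse : ∀ {x a b} → x ≈ᵣ (a , b) → x ≈ ι (a F.+ b F.* r)
    collapse {x} {a} {b} p = begin
      x                      ≈⟨ p ⟩
      ι a + ι b * s          ≈⟨ E.+-congˡ (E.*-congˡ s≈ιr) ⟩
      ι a + ι b * ι r        ≈⟨ E.+-congˡ (ι.*-homo b r) ⟨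
      ι a + ι (b F.* r)      ≈⟨ ι.+-homo _ _ ⟨
      ι (a F.+ b F.* r)      ∎

    zero? : ∀ {x a b} → x ≈ᵣ (a , b) → Dec (x ≈ 0#)
    zero? {x} {a} {b} p = map′
      (λ e → E.trans (collapse {x} {a} {b} p) (E.trans (ι.⟦⟧-cong e) ι.0#-homo))
      (λ e → ι-injective-0 (E.trans (E.sym (collapse {x} {a} {b} p)) e))
      ((a F.+ b F.* r) FF.≈? F.0#)

    reciprocal : ∀ {x a b} → x ≈ᵣ (a ,
        b) → ¬ x ≈ 0# → ∃[ w ] ∃[ a′ ] ∃[ b′ ] (x * w ≈ 1# × w ≈ᵣ (a′ , b′))
    reciprocal {x} {a} {b} p x≉0 =
        ι w , w , F.0# , E.trans (E.*-congʳ (collapse {x} {a} {b} p)) (ι-inverse aw≈1) , rational E.refl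
      where
      a≉0 : a F.+ b F.* r F.≉ F.0#
      a≉0 e = x≉0 (E.trans (collapse {x} {a} {b} p) (E.trans (ι.⟦⟧-cong e) ι.0#-homo))
      w = proj₁ (FF.inverse a≉0)
      aw≈1 : (a F.+ b F.* r) F.* w F.≈ F.1#
      aw≈1 = proj₂ (FF.inverse a≉0)

  module Irrational (¬sq : ¬ FF.IsSquare FF.-3#) where

    -- Multiplication by the conjugate turns the equation into N(a, b) = 0, and N is anisotropic
    -- because -3 is not a square.
    independent : ∀ {a b} → ι a + ι b * s ≈ 0# → a F.≈ F.0# × b F.≈ F.0#
    independent {a} {b} e = FF.N-anisotropic ¬sq a b (ι-injective-0 (begin
      ι (FF.N a b)                         ≈⟨ ι-N a b ⟨
      (ι a + ι b * s) * (ι a - ι b * s)    ≈⟨ E.*-congʳ e ⟩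
      0# * (ι a - ι b * s)                 ≈⟨ E.zeroˡ _ ⟩
      0#                                   ∎))

    vanish : ∀ {a b} → a F.≈ F.0# → b F.≈ F.0# → ι a + ι b * s ≈ 0#
    vanish {a} {b} a≈0 b≈0 = begin
      ι a + ι b * s      ≈⟨ E.+-cong (E.trans (ι.⟦⟧-cong a≈0) ι.0#-homo) (E.*-congʳ (E.trans
          (ι.⟦⟧-cong b≈0) ι.0#-homo)) ⟩
      0# + 0# * s        ≈⟨ S.solve 1 (λ s → S.con (+ 0) S.:+ S.con (+ 0) S.:* s
          S.:= S.con (+ 0)) E.refl s ⟩
      0#                 ∎

    zero? : ∀ {x a b} → x ≈ᵣ (a , b) → Dec (x ≈ 0#)
    zero? {x} {a} {b} p = map′
      (λ N≈0 → let a≈0 , b≈0 = FF.N-anisotropic ¬sq a b N≈0 in E.trans p (vanish a≈0 b≈0))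
      (λ x≈0 → let a≈0 , b≈0 = independent (E.trans (E.sym p) x≈0) in
        F.trans (F.+-cong (F.*-cong a≈0 a≈0) (F.*-congˡ (F.*-cong b≈0 b≈0)))
          (SF.solve 0 (SF.con (+ 0) SF.:* SF.con (+ 0) SF.:+ 3 SF.:× SF.con (+ 1) SF.:* (SF.con
              (+ 0) SF.:* SF.con (+ 0)) SF.:= SF.con (+ 0)) F.refl))
      (FF.N a b FF.≈? F.0#)

    reciprocal : ∀ {x a b} → x ≈ᵣ (a ,
        b) → ¬ x ≈ 0# → ∃[ w ] ∃[ a′ ] ∃[ b′ ] (x * w ≈ 1# × w ≈ᵣ (a′ , b′))
    -- The inverse of a + b√-3 is (a - b√-3)/N(a, b).
    reciprocal {x} {a} {b} p x≉0 = y , a F.* w , F.- b F.* w , xy≈1 , y-rep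
      where
      N≉0 : FF.N a b F.≉ F.0#
      N≉0 N≈0 = let a≈0 , b≈0 = FF.N-anisotropic ¬sq a b N≈0 in x≉0 (E.trans p (vanish a≈0 b≈0))
      w = proj₁ (FF.inverse N≉0)
      Nw≈1 : FF.N a b F.* w F.≈ F.1#
      Nw≈1 = proj₂ (FF.inverse N≉0)
      y = (ι a - ι b * s) * ι w
      xy≈1 : x * y ≈ 1#
      xy≈1 = begin
        x * y                                        ≈⟨ E.*-congʳ p ⟩
        (ι a + ι b * s) * ((ι a - ι b * s) * ι w)    ≈⟨ E.*-assoc _ _ _ ⟨
        (ι a + ι b * s) * (ι a - ι b * s) * ι w      ≈⟨ E.*-congʳ (ι-N a b) ⟩
        ι (FF.N a b) * ι w                           ≈⟨ ι-inverse Nw≈1 ⟩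
        1#                                           ∎
      y-rep : y ≈ᵣ (a F.* w , F.- b F.* w)
      y-rep = begin
        (ι a - ι b * s) * ι w
          ≈⟨ S.solve 4 (λ a b s w → (a S.:- b S.:* s) S.:* w
              S.:= a S.:* w S.:+ ((S.:- b) S.:* w) S.:* s) E.refl (ι a) (ι b) s (ι w) ⟩
        ι a * ι w + - ι b * ι w * s
          ≈⟨ E.+-cong (ι.*-homo a w) (E.*-congʳ (E.trans (ι.*-homo _ w) (E.*-congʳ (ι.-‿homo b)))) ⟨
        ι (a F.* w) + ι (F.- b F.* w) * s            ∎

  zero? : ∀ {x a b} → x ≈ᵣ (a , b) → Dec (x ≈ 0#)
  zero? {x} {a} {b} p = [ (λ (r , s≈ιr) → Rational.zero? r s≈ιr {x} {a} {b} p)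
                        , (λ ¬sq → Irrational.zero? ¬sq {x} {a} {b} p) ]′ -3-square?

  reciprocal : ∀ {x a b} → x ≈ᵣ (a , b) → ¬ x ≈ 0# → ∃[ w ] ∃[ a′ ] ∃[ b′ ] (x * w ≈ 1# × w ≈ᵣ (a′ , b′))
  reciprocal {x} {a} {b} p = [ (λ (r , s≈ιr) → Rational.reciprocal r s≈ιr {x} {a} {b} p)
                             , (λ ¬sq → Irrational.reciprocal ¬sq {x} {a} {b} p) ]′ -3-square?

  -- Induction on the membership proof. In the case `inv` the given inverse agrees with the one
  -- computed by `reciprocal`, as inverses are unique.
  represent : ∀ {x} → K x → ∃[ a ] ∃[ b ] (x ≈ᵣ (a , b))
  represent (base a) = a , F.0# , rational E.refl
  represent gen = F.0# , F.1# , E.trans (S.solve 1 (λ s → s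
      S.:= S.con (+ 0) S.:+ S.con (+ 1) S.:* s) E.refl s)
    (E.sym (E.+-cong ι.0#-homo (E.*-congʳ ι.1#-homo)))
  represent (add x∈K y∈K) =
    let a , b , p = represent x∈K
        a′ , b′ , p′ = represent y∈K
    in _ , _ , ≈ᵣ-+ {a = a} {b} {a′} {b′} p p′
  represent (neg x∈K) = let a , b , p = represent x∈K in _ , _ , ≈ᵣ-neg {a = a} {b} p
  represent (mul x∈K y∈K) =
    let a , b , p = represent x∈K
        a′ , b′ , p′ = represent y∈K
    in _ , _ , ≈ᵣ-* {a = a} {b} {a′} {b′} p p′
  represent (inv x∈K xy≈1) =
    let a , b , p = represent x∈K
        w , a′ , b′ , xw≈1 , p′ = reciprocal {a = a} {b} p (EP.invertible⇒≉0 xy≈1)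
    in a′ , b′ , E.trans (inverse-unique xy≈1 xw≈1) p′
  represent (resp x≈y x∈K) = let a , b , p = represent x∈K in a , b , E.trans (E.sym x≈y) p

  -- Equality and apartness are those of E, so different membership proofs of one element do not
  -- matter. Inverses stay inside by the constructor `inv`.
  subfield : HeytingField (c ⊔ c′ ⊔ ℓ₁′) ℓ₁′ ℓ₂′
  subfield = record
    { Carrier = ∃[ x ] K x
    ; _≈_ = λ x y → proj₁ x ≈ proj₁ y
    ; _#_ = λ x y → proj₁ x E.# proj₁ y
    ; _+_ = λ (x , x∈K) (y , y∈K) → x + y , add x∈K y∈K
    ; _*_ = λ (x , x∈K) (y , y∈K) → x * y , mul x∈K y∈K
    ; -_ = λ (x , x∈K) → - x , neg x∈K
    ; 0# = 0# , 0∈K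
    ; 1# = 1# , 1∈K
    ; isHeytingField = record
      { isHeytingCommutativeRing = record
        { isCommutativeRing = record
          { isRing = record
            { +-isAbelianGroup = record
              { isGroup = record
                { isMonoid = record
                  { isSemigroup = record
                    { isMagma = record
                      { isEquivalence = record { refl = E.refl ; sym = E.sym ; trans = E.trans }
                      ; ∙-cong = E.+-cong }
                    ; assoc = λ _ _ _ → E.+-assoc _ _ _ }
                  ; identity = (λ _ → E.+-identityˡ _) , (λ _ → E.+-identityʳ _) }
                ; inverse = (λ _ → E.-‿inverseˡ _) , (λ _ → E.-‿inverseʳ _)
                ; ⁻¹-cong = E.-‿cong }
              ; comm = λ _ _ → E.+-comm _ _ }
            ; *-cong = E.*-cong
            ; *-assoc = λ _ _ _ → E.*-assoc _ _ _
            ; *-identity = (λ _ → E.*-identityˡ _) , (λ _ → E.*-identityʳ _)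
            ; distrib = (λ _ _ _ → E.distribˡ _ _ _) , (λ _ _ _ → E.distribʳ _ _ _) }
          ; *-comm = λ _ _ → E.*-comm _ _ }
        ; isApartnessRelation = record
          { irrefl = E.#-irrefl
          ; sym = E.#-sym
          ; cotrans = λ x#y (z , _) → E.#-cotrans x#y z }
        ; #⇒invertible = λ {(x , x∈K)} {(y , y∈K)} x#y → let w , p , p′ = E.#⇒invertible x#y in
            (w , inv (add x∈K (neg y∈K)) p′) , p , p′
        ; invertible⇒# = λ ((w , _) , p , p′) → E.invertible⇒# (w , p , p′) }
      ; tight = λ (x , _) (y , _) → E.tight x y } }

  -- Coordinates reduce equality with zero to an equation in the finite field F; this makes
  -- polynomial division available over F(√-3).
  subfield-discrete : IsDiscreteField subfield
  subfield-discrete = record { _≈?_ = eq? ; inverse = λ {x} → invert {x} }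
    where
    eq? : ∀ (x y : ∃[ x ] K x) → Dec (proj₁ x ≈ proj₁ y)
    eq? (x , x∈K) (y , y∈K) =
      let a , b , p = represent (add x∈K (neg y∈K))
      in map′
        (λ e → E.trans (S.solve 2 (λ x y → x
            S.:= (x S.:- y) S.:+ y) E.refl x y) (E.trans (E.+-congʳ e) (E.+-identityˡ y)))
        (λ e → E.trans (E.+-congʳ e) (E.-‿inverseʳ y))
        (zero? {x - y} {a} {b} p)
    invert : ∀ {x : ∃[ x ] K x} → ¬ proj₁ x ≈ 0# → ∃[ y ] (proj₁ x * proj₁ {B = K} y ≈ 1#)
    invert {x , x∈K} x≉0 =
      let a , b , p = represent x∈K
          w , _ , _ , xw≈1 , _ = reciprocal {x} {a} {b} p x≉0
      in (w , inv x∈K xw≈1) , xw≈1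

-- Cubes in F(√-3), roots in F, and the two implications

module CubicRoots {c ℓ₁ ℓ₂ c′ ℓ₁′ ℓ₂′ : Level} (F : HeytingField c ℓ₁ ℓ₂) (q : ℕ) (F-finite : HasCardinality F q)
  (E : FieldExtension F c′ ℓ₁′ ℓ₂′)
  (2≉0 : Field._≉_ F (Field._·_ F 2 (Field.1# F)) (Field.0# F)) (3≉0 : Field._≉_ F (Field._·_ F 3
      (Field.1# F)) (Field.0# F))
  (√-3 : FieldExtension.Carrier E)
  (√-3² : FieldExtension._≈_ E (FieldExtension._^_ E √-3 2) (FieldExtension.ι E (Field.-_ F (Field._·_ F 3
      (Field.1# F)))))
  (α : HeytingField.Carrier F) where

  open Extension F q F-finite E 2≉0 3≉0 √-3 √-3²
  private
    module F = Field F
    module E = FieldExtension E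
    module FF = FiniteField F q F-finite
    module SF = IntegerCoefficients F.commutativeRing
    module S = IntegerCoefficients E.commutativeRing
    module ι = RingMorphisms.IsRingHomomorphism E.isRingHomomorphism
  open E using (ι; base; gen; add; neg; mul; inv; resp; _≈_; _+_; _*_; -_; _-_; 0#; 1#; _·_; _^_;
      IsCubeInK⟨_⟩)
  open CubicPolynomial F
  open Relation.Binary.Reasoning.Setoid E.setoid

  dickson-cong : ∀ {x y} → x ≈ y → x ^ 3 - 3 · x ≈ y ^ 3 - 3 · y
  dickson-cong p = E.+-cong (E.*-cong p (E.*-cong p (E.*-congʳ p))) (E.-‿cong (E.+-cong p (E.+-cong p
      (E.+-congʳ p))))

  -- If √-3 lies in F, then so does z. Otherwise both coordinates of D(z) - α vanish, which is the
  -- hypothesis of `rational-root`.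
  descend : ∀ {z} → K z → z ^ 3 - 3 · z ≈ ι α → ∃[ r ] FF.dickson r F.≈ α
  descend {z} z∈K e = [ rational-case , irrational-case ]′ -3-square?
    where
    a = proj₁ (represent z∈K)
    b = proj₁ (proj₂ (represent z∈K))
    z≈ : z ≈ ι a + ι b * s
    z≈ = proj₂ (proj₂ (represent z∈K))
    rational-case : ∃[ r ] s ≈ ι r → ∃[ r ] FF.dickson r F.≈ α
    rational-case (r , s≈ιr) = t , ι-injective (begin
      ι (t F.^ 3 F.- 3 F.· t)     ≈⟨ E.trans (ι-minus _ _) (E.+-cong (ι-^ t 3) (E.-‿cong (ι-· 3 t))) ⟩
      ι t ^ 3 - 3 · ι t           ≈⟨ dickson-cong (Rational.collapse r s≈ιr {z} {a} {b} z≈) ⟨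
      z ^ 3 - 3 · z               ≈⟨ e ⟩
      ι α                         ∎)
      where
      t = a F.+ b F.* r
    irrational-case : ¬ FF.IsSquare FF.-3# → ∃[ r ] FF.dickson r F.≈ α
    irrational-case ¬sq = FF.rational-root 3≉0 a b (proj₁ parts) (proj₂ parts)
      where
      A = ι a
      B = ι b
      t = 3 · 1#
      re : ι (FF.realPart α a b) ≈ A ^ 3 - t * t * (A * B ^ 2) - t * A - ι α
      re = E.trans (ι-minus _ _) (E.+-congʳ (E.trans (ι-minus _ _) (E.+-cong
             (E.trans (ι-minus _ _) (E.+-cong (ι-^ a 3) (E.-‿cong (E.trans (ι.*-homo _ _) (E.*-cong
               (E.trans (ι.*-homo _ _) (E.*-cong (ι-·1 3) (ι-·1 3))) (E.trans (ι.*-homo _ _) (E.*-congˡ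
                   (ι-^ b 2))))))))
             (E.-‿cong (E.trans (ι.*-homo _ _) (E.*-congʳ (ι-·1 3)))))))
      im : ι (FF.imaginaryPart a b) ≈ t * (B * (A ^ 2 - B ^ 2 - 1#))
      im = E.trans (ι.*-homo _ _) (E.*-cong (ι-·1 3) (E.trans (ι.*-homo _ _) (E.*-congˡ
             (E.trans (ι-minus _ _) (E.+-cong (E.trans (ι-minus _ _) (E.+-cong (ι-^ a 2) (E.-‿cong
                 (ι-^ b 2)))) (E.-‿cong ι.1#-homo))))))
      parts : FF.realPart α a b F.≈ F.0# × FF.imaginaryPart a b F.≈ F.0#
      parts = Irrational.independent ¬sq (begin
        ι (FF.realPart α a b) + ι (FF.imaginaryPart a b) * s      ≈⟨ E.+-cong re (E.*-congʳ im) ⟩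
        (A ^ 3 - t * t * (A * B ^ 2) - t * A - ι α) + t * (B * (A ^ 2 - B ^ 2 - 1#)) * s
          -- The identity holds for arbitrary s; its correction term is a multiple of s² + 3, which
          -- vanishes for s = √-3.
          ≈⟨ S.solve 4 (λ A B s α → let t = 3 S.:× S.con (+ 1) ; z = A S.:+ B S.:* s in
               (A S.:^ 3 S.:- t S.:* t S.:* (A S.:* B S.:^ 2) S.:- t S.:* A S.:- α) S.:+ t S.:* (B S.:*
                   (A S.:^ 2 S.:- B S.:^ 2 S.:- S.con (+ 1))) S.:* s
               S.:= (z S.:^ 3 S.:- 3 S.:× z S.:- α) S.:- (s S.:* s S.:+ t) S.:*
                   (t S.:* A S.:* B S.:^ 2 S.:+ B S.:^ 3 S.:* s)) E.refl A B s (ι α) ⟩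
        ((A + B * s) ^ 3 - 3 · (A + B * s) - ι α) - (s * s + t) * (t * A * B ^ 2 + B ^ 3 * s)
          ≈⟨ E.+-cong (E.trans (E.+-congʳ (E.sym (dickson-cong z≈))) (E.trans (E.+-congʳ e)
              (E.-‿inverseʳ _)))
                      (E.-‿cong (E.*-congʳ (E.trans (E.+-congʳ s²≈-3) (E.-‿inverseˡ t)))) ⟩
        0# - 0# * (t * A * B ^ 2 + B ^ 3 * s)
          ≈⟨ S.solve 1 (λ x → S.con (+ 0) S.:- S.con (+ 0) S.:* x S.:= S.con (+ 0)) E.refl _ ⟩
        0#                                         ∎)

  -- If u = v³ then v + 1/v is a root of D(z) = u + 1/u.
  cube⇒root : ∀ {u u′} → u + u′ ≈ ι α → u * u′ ≈ 1# → IsCubeInK⟨ √-3 ⟩ u → ∃[ r ] FF.dickson r F.≈ α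
  cube⇒root {u} {u′} u+u′≈α uu′≈1 (v , v∈K , v³≈u) = descend (add v∈K (inv v∈K vw≈1)) (begin
    (v + w) ^ 3 - 3 · (v + w)
      ≈⟨ S.solve 2 (λ v w → (v S.:+ w) S.:^ 3 S.:- 3 S.:× (v S.:+ w)
          S.:= (v S.:^ 3 S.:+ w S.:^ 3) S.:+ 3 S.:× ((v S.:* w S.:- S.con (+ 1)) S.:* (v S.:+ w)))
          E.refl v w ⟩
    (v ^ 3 + w ^ 3) + 3 · ((v * w - 1#) * (v + w))
      ≈⟨ E.+-cong (E.+-cong v³≈u w³≈u′) (E.+-cong k≈0 (E.+-cong k≈0 (E.+-congʳ k≈0))) ⟩
    (u + u′) + 3 · 0#                 ≈⟨ S.solve 1 (λ x → x S.:+ 3 S.:× S.con (+ 0)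
        S.:= x) E.refl (u + u′) ⟩
    u + u′                            ≈⟨ u+u′≈α ⟩
    ι α                               ∎)
    where
    -- This is 1/v, since v³ u′ = u u′ = 1.
    w = v ^ 2 * u′
    vw≈1 : v * w ≈ 1#
    vw≈1 = begin
      v * (v ^ 2 * u′)     ≈⟨ S.solve 2 (λ v u′ → v S.:* (v S.:^ 2 S.:* u′)
          S.:= v S.:^ 3 S.:* u′) E.refl v u′ ⟩
      v ^ 3 * u′           ≈⟨ E.*-congʳ v³≈u ⟩
      u * u′               ≈⟨ uu′≈1 ⟩
      1#                   ∎
    w³≈u′ : w ^ 3 ≈ u′
    w³≈u′ = begin
      (v ^ 2 * u′) ^ 3             ≈⟨ S.solve 2 (λ v u′ → (v S.:^ 2 S.:* u′) S.:^ 3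
          S.:= (v S.:^ 3 S.:* u′) S.:^ 2 S.:* u′) E.refl v u′ ⟩
      (v ^ 3 * u′) ^ 2 * u′        ≈⟨ E.*-congʳ (E.*-cong vu (E.*-congʳ vu)) ⟩
      1# ^ 2 * u′                  ≈⟨ S.solve 1 (λ u′ → S.con (+ 1) S.:^ 2 S.:* u′ S.:= u′) E.refl u′ ⟩
      u′                           ∎
      where
      vu : v ^ 3 * u′ ≈ 1#
      vu = E.trans (E.*-congʳ v³≈u) uu′≈1
    k≈0 : (v * w - 1#) * (v + w) ≈ 0#
    k≈0 = E.trans (E.*-congʳ (E.trans (E.+-congʳ vw≈1) (E.-‿inverseʳ 1#))) (E.zeroˡ _)

  module Equivalence (α≉2 : α F.≉ 2 F.· F.1#) (α≉-2 : α F.≉ F.- (2 F.· F.1#))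
    (½ √Δ : E.Carrier) (2½≈1 : (2 · 1#) * ½ ≈ 1#) (√Δ² : √Δ ^ 2 ≈ ι (α F.^ 2 F.- 4 F.· F.1#)) where

    private module FD = DiscretePolynomials F FF.discrete

    u u′ : E.Carrier
    u  = ½ * (ι α + √Δ)
    u′ = ½ * (ι α - √Δ)

    u+u′≈α : u + u′ ≈ ι α
    u+u′≈α = begin
      ½ * (ι α + √Δ) + ½ * (ι α - √Δ)
        ≈⟨ S.solve 3 (λ h a d → h S.:* (a S.:+ d) S.:+ h S.:* (a S.:- d)
            S.:= (2 S.:× S.con (+ 1) S.:* h) S.:* a) E.refl ½ (ι α) √Δ ⟩
      (2 · 1#) * ½ * ι α                 ≈⟨ E.*-congʳ 2½≈1 ⟩
      1# * ι α                           ≈⟨ E.*-identityˡ _ ⟩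
      ι α                                ∎

    uu′≈1 : u * u′ ≈ 1#
    uu′≈1 = begin
      ½ * (ι α + √Δ) * (½ * (ι α - √Δ))
        ≈⟨ S.solve 3 (λ h a d → h S.:* (a S.:+ d) S.:* (h S.:* (a S.:- d))
            S.:= h S.:^ 2 S.:* (a S.:^ 2 S.:- d S.:^ 2)) E.refl ½ (ι α) √Δ ⟩
      ½ ^ 2 * (ι α ^ 2 - √Δ ^ 2)
        ≈⟨ E.*-congˡ (E.+-congˡ (E.-‿cong (E.trans √Δ² (E.trans (ι-minus _ _) (E.+-cong (ι-^ α 2)
            (E.-‿cong (ι-·1 4))))))) ⟩
      ½ ^ 2 * (ι α ^ 2 - (ι α ^ 2 - 4 · 1#))
        ≈⟨ S.solve 2 (λ h a → h S.:^ 2 S.:* (a S.:^ 2 S.:- (a S.:^ 2 S.:- 4 S.:× S.con (+ 1)))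
            S.:= (2 S.:× S.con (+ 1) S.:* h) S.:^ 2) E.refl ½ (ι α) ⟩
      ((2 · 1#) * ½) ^ 2                               ≈⟨ E.*-cong 2½≈1 (E.*-congʳ 2½≈1) ⟩
      1# ^ 2                                           ≈⟨ S.solve 0 (S.con (+ 1) S.:^ 2
          S.:= S.con (+ 1)) E.refl ⟩
      1#                                               ∎

    Conditions : Set _
    Conditions = F.IsNonzeroSquare (F.- (3 F.· F.1#) F.* (α F.^ 2 F.- 4 F.· F.1#))
      × ¬ IsCubeInK⟨ √-3 ⟩ u × ¬ IsCubeInK⟨ √-3 ⟩ u′

    Δ≉0 : α F.^ 2 F.- 4 F.· F.1# F.≉ F.0#
    Δ≉0 e = α≉-2 (FF.x-y≈0⇒x≈y (FD.*-cancel-0 (λ p → α≉2 (FF.x-y≈0⇒x≈y p))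
      (F.trans (SF.solve 1 (λ a → (a SF.:- 2 SF.:× SF.con (+ 1)) SF.:* (a SF.:- SF.:- (2 SF.:× SF.con
          (+ 1))) SF.:= a SF.:^ 2 SF.:- 4 SF.:× SF.con (+ 1)) F.refl α) e)))

    root⇒reducible : ∃[ r ] FF.dickson r F.≈ α → ¬ FD.DynamicallyIrreducible (cubic α)
    root⇒reducible (r , e) (_ , irr) = FF.cubic-root⇒reducible e (irr 1 (s≤s z≤n))

    -- If a square root or a non-cube condition fails, D(z) = α gets a root in F, and already the
    -- first iterate is reducible. For u′ the roles of the two roots are exchanged.
    necessary : FD.DynamicallyIrreducible (cubic α) → Conditions
    necessary dyn = (FD.*-≉0 (FF.-3≉0 3≉0) Δ≉0 , square (FF.square? (FF.discriminant α)))
      , (λ cube → root⇒reducible (cube⇒root u+u′≈α uu′≈1 cube) dyn)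
      , (λ cube → root⇒reducible (cube⇒root (E.trans (E.+-comm u′ u) u+u′≈α) (E.trans
          (E.*-comm u′ u) uu′≈1) cube) dyn)
      where
      square : Dec (FF.IsSquare (FF.discriminant α)) → FF.IsSquare (FF.discriminant α)
      square (yes sq) = sq
      square (no ¬sq) = ⊥-elim (root⇒reducible (FF.dickson-root ¬sq) dyn)

    ½∈K : K ½
    ½∈K = inv (add 1∈K (add 1∈K 0∈K)) 2½≈1

    -- √−3 √Δ = ± y when y² = −3Δ, so √Δ = ∓ (y/3) √−3.
    √Δ∈K : F.IsNonzeroSquare (F.- (3 F.· F.1#) F.* (α F.^ 2 F.- 4 F.· F.1#)) → K √Δ
    √Δ∈K (d≉0 , y , y²≈d) =
        [ from-product y , from-product (F.- y) ]′ (square-roots (FF.^2-≉0 y²≈d d≉0) (begin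
      (s * √Δ) ^ 2                       ≈⟨ S.solve 2 (λ s d → (s S.:* d) S.:^ 2
          S.:= s S.:^ 2 S.:* d S.:^ 2) E.refl s √Δ ⟩
      s ^ 2 * √Δ ^ 2                     ≈⟨ E.*-cong √-3² √Δ² ⟩
      ι FF.-3# * ι (α F.^ 2 F.- 4 F.· F.1#)   ≈⟨ ι.*-homo _ _ ⟨
      ι (FF.discriminant α)              ≈⟨ ι.⟦⟧-cong y²≈d ⟨
      ι (y F.^ 2)                        ≈⟨ ι-^ y 2 ⟩
      ι y ^ 2                            ∎))
      where
      -⅓ = proj₁ (FF.inverse (FF.-3≉0 3≉0))
      -3·-⅓≈1 : FF.-3# F.* -⅓ F.≈ F.1#
      -3·-⅓≈1 = proj₂ (FF.inverse (FF.-3≉0 3≉0))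
      from-product : ∀ y → s * √Δ ≈ ι y → K √Δ
      from-product y e = resp (begin
        ι -⅓ * (s * ι y)             ≈⟨ E.*-congˡ (E.*-congˡ e) ⟨
        ι -⅓ * (s * (s * √Δ))
          ≈⟨ S.solve 3 (λ t s d → t S.:* (s S.:* (s S.:* d))
              S.:= s S.:^ 2 S.:* t S.:* d) E.refl (ι -⅓) s √Δ ⟩
        s ^ 2 * ι -⅓ * √Δ            ≈⟨ E.*-congʳ (E.*-congʳ √-3²) ⟩
        ι FF.-3# * ι -⅓ * √Δ         ≈⟨ E.*-congʳ (ι-inverse -3·-⅓≈1) ⟩
        1# * √Δ                      ≈⟨ E.*-identityˡ √Δ ⟩
        √Δ                           ∎) (mul (base -⅓) (mul gen (base y)))

    -- `IsCubeInK⟨_⟩` demands a cube root in F(√-3), so u and u′ are non-cubes of the field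
    -- `subfield`. The square condition is what places them in it.
    sufficient : Conditions → FD.DynamicallyIrreducible (cubic α)
    sufficient (sq , u-noncube , u′-noncube) = IrreducibleIterates.dynamically-irreducible
      F FF.discrete subfield subfield-discrete (λ a → ι a , base a) ι-hom α
      (u , mul ½∈K (add (base α) (√Δ∈K sq))) (u′ , mul ½∈K (add (base α) (neg (√Δ∈K sq))))
      u+u′≈α uu′≈1 (λ (v , v∈K) e → u-noncube (v , v∈K , e)) (λ (v , v∈K) e → u′-noncube (v , v∈K , e))
      where
      ι-hom : RingMorphisms.IsRingHomomorphism F.rawRing (Field.rawRing subfield) (λ a → ι a , base a)
      ι-hom = record
        { isSemiringHomomorphism = record
          { isNearSemiringHomomorphism = record
            { +-isMonoidHomomorphism = record
              { isMagmaHomomorphism = record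
                { isRelHomomorphism = record { cong = ι.⟦⟧-cong }
                ; homo = ι.+-homo }
              ; ε-homo = ι.0#-homo }
            ; *-homo = ι.*-homo }
          ; 1#-homo = ι.1#-homo }
        ; -‿homo = ι.-‿homo }

proposition25 :
    ∀ {c ℓ₁ ℓ₂ c′ ℓ₁′ ℓ₂′} (p s : ℕ) → Prime p → p > 3 → s ≥ 1 →
    (F : HeytingField c ℓ₁ ℓ₂) → HasCardinality F (p ℕ.^ s) →
    let open Field F
        open Polynomial F using (DynamicallyIrreducible) in
    (α : Carrier) → α ≉ 2 · 1# → α ≉ - (2 · 1#) →
    (E : FieldExtension F c′ ℓ₁′ ℓ₂′) →
    let module E = FieldExtension E in
    (½ √-3 √Δ : E.Carrier) →
    (2 E.· E.1#) E.* ½ E.≈ E.1# →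
    √-3 E.^ 2 E.≈ E.ι (- (3 · 1#)) →
    √Δ E.^ 2 E.≈ E.ι (α ^ 2 - 4 · 1#) →
    DynamicallyIrreducible
      ((α ^ 3 - 4 · α) ∷ (3 · α ^ 2 - 3 · 1#) ∷ (3 · α) ∷ 1# ∷ [])
    ⇔
    ( IsNonzeroSquare (- (3 · 1#) * (α ^ 2 - 4 · 1#))
    × ¬ E.IsCubeInK⟨ √-3 ⟩ (½ E.* (E.ι α E.+ √Δ))
    × ¬ E.IsCubeInK⟨ √-3 ⟩ (½ E.* (E.ι α E.- √Δ)) )
proposition25 p s p-prime p>3 s≥1 F F-finite α α≉2 α≉-2 E ½ √-3 √Δ 2½≈1 √-3² √Δ² =
  mk⇔ Main.necessary Main.sufficient
  where
  module F = Field F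
  module E = FieldExtension E
  module ι = RingMorphisms.IsRingHomomorphism E.isRingHomomorphism
  -- `½` inverts 2 in E, and ι maps the 2 of F to it.
  2≉0 : 2 F.· F.1# F.≉ F.0#
  2≉0 e = HeytingFieldProperties.invertible⇒≉0 E.field′ 2½≈1 (begin
    2 E.· E.1#             ≈⟨ E.+-cong ι.1#-homo (E.+-cong ι.1#-homo ι.0#-homo) ⟨
    E.ι F.1# E.+ (E.ι F.1# E.+ E.ι F.0#)   ≈⟨ E.trans (ι.+-homo _ _) (E.+-congˡ (ι.+-homo _ _)) ⟨
    E.ι (2 F.· F.1#)       ≈⟨ ι.⟦⟧-cong e ⟩
    E.ι F.0#               ≈⟨ ι.0#-homo ⟩
    E.0#                   ∎)
    where open Relation.Binary.Reasoning.Setoid E.setoid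
  3≉0 : 3 F.· F.1# F.≉ F.0#
  3≉0 = FiniteField.3≉0 F (p ℕ.^ s) F-finite
    (λ 3∣p^s → ℕ.<⇒≢ p>3 (≡.sym (3∣p^s⇒p≡3 p s p-prime 3∣p^s)))
  module Main = CubicRoots.Equivalence F (p ℕ.^ s) F-finite E 2≉0 3≉0 √-3 √-3² α α≉2 α≉-2 ½ √Δ 2½≈1 √Δ²
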